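{- Let $\mathbb{F}$ be a field. Let $X$ be a simplicial complex and let $\Gamma$ be a finite collection of subcomplexes of $X$ such that $\bigcup\Gamma=X$. Let $k$ and $\ell$ be two integers such that $-1\le k\le \ell<|\Gamma|$. Suppose that the following two conditions are satisfied: (1) $\widetilde{H}_{k-|\sigma|}\big(\bigcap\sigma,\mathbb{F}\big)=0$ for every simplex $\sigma\in N(\Gamma)$ of dimension at most $k$; (2) $\widetilde{H}_{|\sigma|-2}\big(\bigcup\sigma,\mathbb{F}\big)=0$ for every simplex $\sigma\in N(\Gamma)$ of dimension at least $k+1$ and at most $\ell$. Then $\dim\widetilde{H}_{\ell}(N(\Gamma),\mathbb{F})\le\dim\widetilde{H}_{\ell}(X,\mathbb{F})$.
   Context: Simplicial complexes are abstract and the empty set is not a simplex, so the minimal dimension of a simplex is $0$ (a complex may be empty). $\widetilde{H}$ denotes reduced simplicial homology; $\widetilde{H}_{ -1}(Y,\mathbb{F})=0$ if and only if $Y$ is nonempty. A collection allows repetitions, and cardinalities are counted with repetitions. For a finite collection $\Gamma$ of subcomplexes of a simplicial complex, the nerve $N(\Gamma)$ is the simplicial complex whose vertices are the subcomplexes in $\Gamma$ and whose simplices are the (nonempty) subcollections of $\Gamma$ with nonempty intersection. For $\sigma\in N(\Gamma)$, $|\sigma|$ is the number of members of $\sigma$ (so $\dim\sigma=|\sigma|-1$), and $\bigcap\sigma$, $\bigcup\sigma$ are the intersection and the union of the subcomplexes in $\sigma$. -}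

module Defs where

open import Algebra.Bundles using (CommutativeMonoid; CommutativeRing; Ring)
import Algebra.Definitions.RawMonoid as RawMonoidDefinitions
open import Algebra.Module.Bundles using (LeftModule)
import Algebra.Module.Construct.Zero as Zero
open import Algebra.Module.Morphism.Structures using (module LeftModuleMorphisms)
import Algebra.Properties.AbelianGroup as AbelianGroupProperties
import Algebra.Properties.CommutativeSemigroup as CommutativeSemigroupProperties
open import Data.Fin.Base using (Fin; zero; suc)
open import Data.Integer.Base using (ℤ; +_; -[1+_]; _-_; 1ℤ)
open import Data.List.Base using (List; []; _∷_; length)
open import Data.List.Relation.Binary.Subset.Propositional using (_⊆_)
open import Data.List.Relation.Binary.Subset.Propositional.Properties
  using (Any-resp-⊆; All-resp-⊇)
open import Data.List.Relation.Unary.All as All using (All)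
open import Data.List.Relation.Unary.Any as Any using (Any; here; there)
open import Data.List.Relation.Unary.Unique.Propositional using (Unique)
open import Data.Nat.Base using (ℕ; zero; suc; pred)
open import Data.Product.Base using (Σ; ∃; ∃-syntax; _×_; _,_; proj₁; proj₂)
open import Data.Unit.Polymorphic.Base using (⊤; tt)
open import Data.Vec.Base using (Vec; []; _∷_; removeAt; toList)
open import Function.Base using (_∘_)
open import Level using (Level; _⊔_) renaming (suc to lsuc)
open import Relation.Binary.PropositionalEquality.Core using (_≡_; _≢_; refl)
import Relation.Binary.Reasoning.Setoid as SetoidReasoning
open import Relation.Nullary.Negation.Core using (¬_; contradiction)

record Field c ℓ : Set (lsuc (c ⊔ ℓ)) where
  field
    commutativeRing : CommutativeRing c ℓ
  open CommutativeRing commutativeRing public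
  field
    0≉1     : ¬ (0# ≈ 1#)
    inverse : ∀ x → ¬ (x ≈ 0#) → ∃[ y ] x * y ≈ 1#

-- Stated over a ring because unification cannot recover a Field from its
-- underlying ring.
module _ {r ℓr} {R : Ring r ℓr} {m ℓm} (M : LeftModule R m ℓm) where
  open Ring R using (Carrier; _≈_; 0#)
  open LeftModule M
  open RawMonoidDefinitions +ᴹ-rawMonoid using (sum)

  IsZero : Set (m ⊔ ℓm)
  IsZero = ∀ x → x ≈ᴹ 0ᴹ

  LinearlyIndependent : ∀ {n} → (Fin n → Carrierᴹ) → Set (r ⊔ ℓr ⊔ ℓm)
  LinearlyIndependent {n} x =
    (a : Fin n → Carrier) → sum (λ i → a i *ₗ x i) ≈ᴹ 0ᴹ → ∀ i → a i ≈ 0#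

  HasIndependent : ℕ → Set (r ⊔ ℓr ⊔ m ⊔ ℓm)
  HasIndependent n = ∃[ x ] LinearlyIndependent {n} x

-- The dimension, as a value in ℕ ∪ {∞}, is the supremum of the n with
-- HasIndependent M n; these n are closed downwards.
module _ {r ℓr} {R : Ring r ℓr} {m ℓm m′ ℓm′ : Level} where

  infix 4 _dim≤dim_

  _dim≤dim_ : LeftModule R m ℓm → LeftModule R m′ ℓm′ →
              Set (r ⊔ ℓr ⊔ m ⊔ ℓm ⊔ m′ ⊔ ℓm′)
  M dim≤dim N = ∀ n → HasIndependent M n → HasIndependent N n

-- Homology of  A --f--> B --g--> C  at B : kernel of g modulo image of f.
module _ {r ℓr} {R : Ring r ℓr}
  {a ℓa b ℓb d ℓd}
  (A : LeftModule R a ℓa) (B : LeftModule R b ℓb) (C : LeftModule R d ℓd)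
  {f : LeftModule.Carrierᴹ A → LeftModule.Carrierᴹ B}
  {g : LeftModule.Carrierᴹ B → LeftModule.Carrierᴹ C}
  (f-hom : LeftModuleMorphisms.IsLeftModuleHomomorphism
             (LeftModule.rawLeftModule A) (LeftModule.rawLeftModule B) f)
  (g-hom : LeftModuleMorphisms.IsLeftModuleHomomorphism
             (LeftModule.rawLeftModule B) (LeftModule.rawLeftModule C) g)
  where

  private
    module A = LeftModule A
    module B = LeftModule B
    module C = LeftModule C
    module f = LeftModuleMorphisms.IsLeftModuleHomomorphism f-hom
    module g = LeftModuleMorphisms.IsLeftModuleHomomorphism g-hom
    module BG = AbelianGroupProperties B.+ᴹ-abelianGroup
    module CG = AbelianGroupProperties C.+ᴹ-abelianGroup
    module R = Ring R
    open SetoidReasoning B.≈ᴹ-setoid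
    open CommutativeSemigroupProperties
      (CommutativeMonoid.commutativeSemigroup B.+ᴹ-commutativeMonoid)
      using (interchange)

  Cycle : Set (b ⊔ ℓd)
  Cycle = Σ B.Carrierᴹ λ z → g z C.≈ᴹ C.0ᴹ

  Homologous : Cycle → Cycle → Set (a ⊔ ℓb)
  Homologous (z , _) (w , _) = ∃[ x ] z B.+ᴹ B.-ᴹ w B.≈ᴹ f x

  private
    ≈⇒Homologous : ∀ {z w} → proj₁ z B.≈ᴹ proj₁ w → Homologous z w
    ≈⇒Homologous z≈w = A.0ᴹ ,
      B.≈ᴹ-trans (B.+ᴹ-congʳ z≈w)
        (B.≈ᴹ-trans (B.-ᴹ‿inverseʳ _) (B.≈ᴹ-sym f.0ᴹ-homo))

    homologous-sym : ∀ {z w} → Homologous z w → Homologous w z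
    homologous-sym {z , _} {w , _} (x , eq) = A.-ᴹ x , (begin
      w B.+ᴹ B.-ᴹ z              ≈⟨ B.+ᴹ-congʳ (BG.⁻¹-involutive w) ⟨
      B.-ᴹ B.-ᴹ w B.+ᴹ B.-ᴹ z    ≈⟨ BG.⁻¹-anti-homo-∙ z (B.-ᴹ w) ⟨
      B.-ᴹ (z B.+ᴹ B.-ᴹ w)       ≈⟨ B.-ᴹ‿cong eq ⟩
      B.-ᴹ f x                   ≈⟨ f.-ᴹ-homo x ⟨
      f (A.-ᴹ x)                 ∎)

    homologous-trans : ∀ {z w u} → Homologous z w → Homologous w u →
                       Homologous z u
    homologous-trans {z , _} {w , _} {u , _} (x , p) (y , q) = x A.+ᴹ y , (begin
      z B.+ᴹ B.-ᴹ u
        ≈⟨ B.+ᴹ-congˡ (B.+ᴹ-identityˡ _) ⟨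
      z B.+ᴹ (B.0ᴹ B.+ᴹ B.-ᴹ u)
        ≈⟨ B.+ᴹ-congˡ (B.+ᴹ-congʳ (B.-ᴹ‿inverseˡ w)) ⟨
      z B.+ᴹ ((B.-ᴹ w B.+ᴹ w) B.+ᴹ B.-ᴹ u)
        ≈⟨ B.+ᴹ-congˡ (B.+ᴹ-assoc _ _ _) ⟩
      z B.+ᴹ (B.-ᴹ w B.+ᴹ (w B.+ᴹ B.-ᴹ u))
        ≈⟨ B.+ᴹ-assoc _ _ _ ⟨
      (z B.+ᴹ B.-ᴹ w) B.+ᴹ (w B.+ᴹ B.-ᴹ u)
        ≈⟨ B.+ᴹ-cong p q ⟩
      f x B.+ᴹ f y
        ≈⟨ f.+ᴹ-homo x y ⟨
      f (x A.+ᴹ y) ∎)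

    _+ᶻ_ : Cycle → Cycle → Cycle
    (z , p) +ᶻ (w , q) = z B.+ᴹ w ,
      C.≈ᴹ-trans (g.+ᴹ-homo z w)
        (C.≈ᴹ-trans (C.+ᴹ-cong p q) (C.+ᴹ-identityˡ _))

    0ᶻ : Cycle
    0ᶻ = B.0ᴹ , g.0ᴹ-homo

    -ᶻ_ : Cycle → Cycle
    -ᶻ (z , p) = B.-ᴹ z ,
      C.≈ᴹ-trans (g.-ᴹ-homo z) (C.≈ᴹ-trans (C.-ᴹ‿cong p) CG.ε⁻¹≈ε)

    _*ᶻ_ : R.Carrier → Cycle → Cycle
    r *ᶻ (z , p) = r B.*ₗ z ,
      C.≈ᴹ-trans (g.*ₗ-homo r z) (C.≈ᴹ-trans (C.*ₗ-congˡ p) (C.*ₗ-zeroʳ r))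

    +ᶻ-cong : ∀ {z z′ w w′} → Homologous z z′ → Homologous w w′ →
              Homologous (z +ᶻ w) (z′ +ᶻ w′)
    +ᶻ-cong {z , _} {z′ , _} {w , _} {w′ , _} (x , p) (y , q) = x A.+ᴹ y , (begin
      (z B.+ᴹ w) B.+ᴹ B.-ᴹ (z′ B.+ᴹ w′)
        ≈⟨ B.+ᴹ-congˡ (BG.⁻¹-∙-comm z′ w′) ⟨
      (z B.+ᴹ w) B.+ᴹ (B.-ᴹ z′ B.+ᴹ B.-ᴹ w′)
        ≈⟨ interchange _ _ _ _ ⟩
      (z B.+ᴹ B.-ᴹ z′) B.+ᴹ (w B.+ᴹ B.-ᴹ w′)
        ≈⟨ B.+ᴹ-cong p q ⟩
      f x B.+ᴹ f y
        ≈⟨ f.+ᴹ-homo x y ⟨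
      f (x A.+ᴹ y) ∎)

    -ᶻ-cong : ∀ {z w} → Homologous z w → Homologous (-ᶻ z) (-ᶻ w)
    -ᶻ-cong {z , _} {w , _} (x , p) = A.-ᴹ x , (begin
      B.-ᴹ z B.+ᴹ B.-ᴹ B.-ᴹ w    ≈⟨ BG.⁻¹-∙-comm z (B.-ᴹ w) ⟩
      B.-ᴹ (z B.+ᴹ B.-ᴹ w)       ≈⟨ B.-ᴹ‿cong p ⟩
      B.-ᴹ f x                   ≈⟨ f.-ᴹ-homo x ⟨
      f (A.-ᴹ x)                 ∎)

    *ᶻ-cong : ∀ {r s z w} → r R.≈ s → Homologous z w →
              Homologous (r *ᶻ z) (s *ᶻ w)
    *ᶻ-cong {r} {s} {z , _} {w , _} r≈s (x , p) = r A.*ₗ x , (begin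
      r B.*ₗ z B.+ᴹ B.-ᴹ (s B.*ₗ w)
        ≈⟨ B.+ᴹ-congˡ (B.-ᴹ‿cong (B.*ₗ-congʳ r≈s)) ⟨
      r B.*ₗ z B.+ᴹ B.-ᴹ (r B.*ₗ w)
        ≈⟨ B.+ᴹ-congˡ (BG.inverseʳ-unique (r B.*ₗ w) (r B.*ₗ (B.-ᴹ w)) (begin
             r B.*ₗ w B.+ᴹ r B.*ₗ (B.-ᴹ w)  ≈⟨ B.*ₗ-distribˡ r w (B.-ᴹ w) ⟨
             r B.*ₗ (w B.+ᴹ B.-ᴹ w)         ≈⟨ B.*ₗ-congˡ (B.-ᴹ‿inverseʳ w) ⟩
             r B.*ₗ B.0ᴹ                    ≈⟨ B.*ₗ-zeroʳ r ⟩
             B.0ᴹ                           ∎)) ⟨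
      r B.*ₗ z B.+ᴹ r B.*ₗ (B.-ᴹ w)
        ≈⟨ B.*ₗ-distribˡ r z (B.-ᴹ w) ⟨
      r B.*ₗ (z B.+ᴹ B.-ᴹ w)
        ≈⟨ B.*ₗ-congˡ p ⟩
      r B.*ₗ f x
        ≈⟨ f.*ₗ-homo r x ⟨
      f (r A.*ₗ x) ∎)

  homology : LeftModule R (b ⊔ ℓd) (a ⊔ ℓb)
  homology = record
    { Carrierᴹ = Cycle
    ; _≈ᴹ_     = Homologous
    ; _+ᴹ_     = _+ᶻ_
    ; _*ₗ_     = _*ᶻ_
    ; 0ᴹ       = 0ᶻ
    ; -ᴹ_      = -ᶻ_
    ; isLeftModule = record
      { isLeftSemimodule = record
        { +ᴹ-isCommutativeMonoid = record
          { isMonoid = record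
            { isSemigroup = record
              { isMagma = record
                { isEquivalence = record
                  { refl  = λ {z} → ≈⇒Homologous {z} {z} B.≈ᴹ-refl
                  ; sym   = λ {z w} → homologous-sym {z} {w}
                  ; trans = λ {z w u} → homologous-trans {z} {w} {u}
                  }
                ; ∙-cong = λ {z z′ w w′} → +ᶻ-cong {z} {z′} {w} {w′}
                }
              ; assoc = λ z w u → lift {(z +ᶻ w) +ᶻ u} {z +ᶻ (w +ᶻ u)}
                  (B.+ᴹ-assoc _ _ _)
              }
            ; identity = (λ z → lift {0ᶻ +ᶻ z} {z} (B.+ᴹ-identityˡ _))
                       , (λ z → lift {z +ᶻ 0ᶻ} {z} (B.+ᴹ-identityʳ _))
            }
          ; comm = λ z w → lift {z +ᶻ w} {w +ᶻ z} (B.+ᴹ-comm _ _)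
          }
        ; isPreleftSemimodule = record
          { *ₗ-cong      = λ {r s z w} → *ᶻ-cong {r} {s} {z} {w}
          ; *ₗ-zeroˡ     = λ z → lift {R.0# *ᶻ z} {0ᶻ} (B.*ₗ-zeroˡ _)
          ; *ₗ-distribʳ  = λ z r s → lift {(r R.+ s) *ᶻ z} {(r *ᶻ z) +ᶻ (s *ᶻ z)}
              (B.*ₗ-distribʳ _ _ _)
          ; *ₗ-identityˡ = λ z → lift {R.1# *ᶻ z} {z} (B.*ₗ-identityˡ _)
          ; *ₗ-assoc     = λ r s z → lift {(r R.* s) *ᶻ z} {r *ᶻ (s *ᶻ z)}
              (B.*ₗ-assoc _ _ _)
          ; *ₗ-zeroʳ     = λ r → lift {r *ᶻ 0ᶻ} {0ᶻ} (B.*ₗ-zeroʳ _)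
          ; *ₗ-distribˡ  = λ r z w → lift {r *ᶻ (z +ᶻ w)} {(r *ᶻ z) +ᶻ (r *ᶻ w)}
              (B.*ₗ-distribˡ _ _ _)
          }
        }
      ; -ᴹ‿cong    = λ {z w} → -ᶻ-cong {z} {w}
      ; -ᴹ‿inverse = (λ z → lift {(-ᶻ z) +ᶻ z} {0ᶻ} (B.-ᴹ‿inverseˡ _))
                   , (λ z → lift {z +ᶻ (-ᶻ z)} {0ᶻ} (B.-ᴹ‿inverseʳ _))
      }
    }
    where
    lift : ∀ {z w} → proj₁ z B.≈ᴹ proj₁ w → Homologous z w
    lift {z} {w} = ≈⇒Homologous {z} {w}

-- A list stands for the finite set of its entries; by down-closed,
-- Simplex does not depend on order or multiplicity. Not every element of
-- V need be a vertex, so that all subcomplexes share the same V.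
record SimplicialComplex {v} (V : Set v) p : Set (v ⊔ lsuc p) where
  field
    Simplex     : List V → Set p
    nonempty    : ¬ Simplex []
    down-closed : ∀ {ρ τ} → ρ ⊆ τ → ρ ≢ [] → Simplex τ → Simplex ρ

open SimplicialComplex public using (Simplex)

record SimplexOf {v p} {V : Set v} (K : SimplicialComplex V p) :
                 Set (v ⊔ p) where
  field
    vertices  : List V
    unique    : Unique vertices
    isSimplex : Simplex K vertices

  card : ℕ
  card = length vertices

  dim : ℤ
  dim = + card - 1ℤ

open SimplexOf public using (vertices; card; dim)

module _ {v p : Level} {V : Set v} where

  infix 4 _≐_

  _≐_ : SimplicialComplex V p → SimplicialComplex V p → Set (v ⊔ p)
  K ≐ L = ∀ τ → (Simplex K τ → Simplex L τ) × (Simplex L τ → Simplex K τ)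

  Inhabited : SimplicialComplex V p → Set (v ⊔ p)
  Inhabited K = ∃[ τ ] Simplex K τ

  record Subcomplex (X : SimplicialComplex V p) : Set (v ⊔ lsuc p) where
    field
      complex  : SimplicialComplex V p
      included : ∀ {τ} → Simplex complex τ → Simplex X τ

  open Subcomplex public

  module _ {X : SimplicialComplex V p} {I : Set} (Γ : I → Subcomplex X) where

    private
      _∈Γ_ : List V → I → Set p
      τ ∈Γ i = Simplex (complex (Γ i)) τ

    -- The intersection of the empty subcollection is X.
    ⋂ : List I → SimplicialComplex V p
    ⋂ σ = record
      { Simplex     = λ τ → Simplex X τ × All (τ ∈Γ_) σ
      ; nonempty    = λ (s , _) → SimplicialComplex.nonempty X s
      ; down-closed = λ ρ⊆τ ρ≢[] (s , all) →
          SimplicialComplex.down-closed X ρ⊆τ ρ≢[] s ,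
          All.map (λ {i} →
            SimplicialComplex.down-closed (complex (Γ i)) ρ⊆τ ρ≢[]) all
      }

    ⋃ : List I → SimplicialComplex V p
    ⋃ σ = record
      { Simplex     = λ τ → Any (τ ∈Γ_) σ
      ; nonempty    = λ any → let i , s = Any.satisfied any in
          SimplicialComplex.nonempty (complex (Γ i)) s
      ; down-closed = λ ρ⊆τ ρ≢[] → Any.map (λ {i} →
          SimplicialComplex.down-closed (complex (Γ i)) ρ⊆τ ρ≢[])
      }

    nerve : SimplicialComplex I (v ⊔ p)
    nerve = record
      { Simplex     = λ σ → σ ≢ [] × Inhabited (⋂ σ)
      ; nonempty    = λ (σ≢[] , _) → contradiction refl σ≢[]
      ; down-closed = λ ρ⊆σ ρ≢[] (_ , τ , s , all) →
          ρ≢[] , τ , s , All-resp-⊇ ρ⊆σ all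
      }

module _ {a} {A : Set a} where

  data AdjacentSwap : ∀ {n} → Vec A n → Vec A n → Set a where
    here  : ∀ {n x y} {τ : Vec A n} → AdjacentSwap (x ∷ y ∷ τ) (y ∷ x ∷ τ)
    there : ∀ {n x} {τ τ′ : Vec A n} → AdjacentSwap τ τ′ →
            AdjacentSwap (x ∷ τ) (x ∷ τ′)

  data AdjacentRepeat : ∀ {n} → Vec A n → Set a where
    here  : ∀ {n x} {τ : Vec A n} → AdjacentRepeat (x ∷ x ∷ τ)
    there : ∀ {n x} {τ : Vec A n} → AdjacentRepeat τ → AdjacentRepeat (x ∷ τ)

  removeAt-⊆ : ∀ {n} (τ : Vec A (suc n)) i → toList (removeAt τ i) ⊆ toList τ
  removeAt-⊆ (x ∷ τ)         zero    z∈         = there z∈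
  removeAt-⊆ (x ∷ τ@(_ ∷ _)) (suc i) (here eq)  = here eq
  removeAt-⊆ (x ∷ τ@(_ ∷ _)) (suc i) (there z∈) = there (removeAt-⊆ τ i z∈)

VectorSpace : ∀ {c ℓ} → Field c ℓ → (m ℓm : Level) → Set (c ⊔ ℓ ⊔ lsuc (m ⊔ ℓm))
VectorSpace F m ℓm = LeftModule (Field.ring F) m ℓm

module ChainComplex
  {c ℓ} (F : Field c ℓ) {v p} {V : Set v} (K : SimplicialComplex V p)
  where

  private
    module R = Field F
    open R using (Carrier; _≈_; _+_; _*_; -_; 0#; 1#)

  -- The vertices of τ span a simplex, or τ is the empty tuple.
  Spans : ∀ {n} → Vec V n → Set p
  Spans []        = ⊤
  Spans τ@(_ ∷ _) = Simplex K (toList τ)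

  removeAt-Spans : ∀ {n} (τ : Vec V (suc n)) i → Spans τ → Spans (removeAt τ i)
  removeAt-Spans {zero}  (x ∷ [])        zero    s = tt
  removeAt-Spans {suc n} (x ∷ τ@(_ ∷ _)) zero    s =
    SimplicialComplex.down-closed K (removeAt-⊆ (x ∷ τ) zero) (λ ()) s
  removeAt-Spans {suc n} (x ∷ τ@(_ ∷ _)) (suc i) s =
    SimplicialComplex.down-closed K (removeAt-⊆ (x ∷ τ) (suc i)) (λ ()) s

  -- Oriented chains of dimension n - 1, as the vector space presented by
  -- generators, the n-tuples of vertices spanning a simplex, and relations:
  -- a tuple with a repeated vertex is zero, and permuting a tuple multiplies
  -- it by the sign. Adjacent swaps and adjacent repeats generate these
  -- relations. For n = 0 the single generator is the empty tuple.
  infixl 6 _⊕_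
  infixr 7 _·_
  infix  4 _∼_

  data Chain (n : ℕ) : Set (c ⊔ v ⊔ p) where
    gen : (τ : Vec V n) → Spans τ → Chain n
    𝟘   : Chain n
    _⊕_ : Chain n → Chain n → Chain n
    _·_ : Carrier → Chain n → Chain n

  ⊖_ : ∀ {n} → Chain n → Chain n
  ⊖ x = (- 1#) · x

  data _∼_ {n : ℕ} : Chain n → Chain n → Set (c ⊔ ℓ ⊔ v ⊔ p) where
    ∼-refl       : ∀ {x} → x ∼ x
    ∼-sym        : ∀ {x y} → x ∼ y → y ∼ x
    ∼-trans      : ∀ {x y z} → x ∼ y → y ∼ z → x ∼ z
    ⊕-cong       : ∀ {x x′ y y′} → x ∼ x′ → y ∼ y′ → x ⊕ y ∼ x′ ⊕ y′
    ·-cong       : ∀ {r s x y} → r ≈ s → x ∼ y → r · x ∼ s · y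
    ⊕-assoc      : ∀ x y z → (x ⊕ y) ⊕ z ∼ x ⊕ (y ⊕ z)
    ⊕-comm       : ∀ x y → x ⊕ y ∼ y ⊕ x
    ⊕-identityˡ  : ∀ x → 𝟘 ⊕ x ∼ x
    ·-zeroˡ      : ∀ x → 0# · x ∼ 𝟘
    ·-identityˡ  : ∀ x → 1# · x ∼ x
    ·-assoc      : ∀ r s x → (r * s) · x ∼ r · (s · x)
    ·-distribʳ   : ∀ x r s → (r + s) · x ∼ r · x ⊕ s · x
    ·-distribˡ   : ∀ r x y → r · (x ⊕ y) ∼ r · x ⊕ r · y
    gen-cong     : ∀ {τ} (s t : Spans τ) → gen τ s ∼ gen τ t
    gen-swap     : ∀ {τ τ′} → AdjacentSwap τ τ′ → ∀ s t →
                   gen τ s ∼ ⊖ gen τ′ t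
    gen-repeat   : ∀ {τ} → AdjacentRepeat τ → ∀ s → gen τ s ∼ 𝟘

  chains : ℕ → VectorSpace F (c ⊔ v ⊔ p) (c ⊔ ℓ ⊔ v ⊔ p)
  chains n = record
    { Carrierᴹ = Chain n
    ; _≈ᴹ_     = _∼_
    ; _+ᴹ_     = _⊕_
    ; _*ₗ_     = _·_
    ; 0ᴹ       = 𝟘
    ; -ᴹ_      = ⊖_
    ; isLeftModule = record
      { isLeftSemimodule = record
        { +ᴹ-isCommutativeMonoid = record
          { isMonoid = record
            { isSemigroup = record
              { isMagma = record
                { isEquivalence = record
                  { refl = ∼-refl ; sym = ∼-sym ; trans = ∼-trans }
                ; ∙-cong = ⊕-cong
                }
              ; assoc = ⊕-assoc
              }
            ; identity = ⊕-identityˡ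
                       , λ x → ∼-trans (⊕-comm x 𝟘) (⊕-identityˡ x)
            }
          ; comm = ⊕-comm
          }
        ; isPreleftSemimodule = record
          { *ₗ-cong      = ·-cong
          ; *ₗ-zeroˡ     = ·-zeroˡ
          ; *ₗ-distribʳ  = ·-distribʳ
          ; *ₗ-identityˡ = ·-identityˡ
          ; *ₗ-assoc     = ·-assoc
          ; *ₗ-zeroʳ     = ·-zeroʳ
          ; *ₗ-distribˡ  = ·-distribˡ
          }
        }
      ; -ᴹ‿cong    = ·-cong R.refl
      ; -ᴹ‿inverse = inverseˡ , λ x → ∼-trans (⊕-comm _ _) (inverseˡ x)
      }
    }
    where
    ·-zeroʳ : ∀ r → r · 𝟘 ∼ 𝟘
    ·-zeroʳ r = ∼-trans (·-cong R.refl (∼-sym (·-zeroˡ 𝟘)))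
      (∼-trans (∼-sym (·-assoc r 0# 𝟘))
      (∼-trans (·-cong (R.zeroʳ r) ∼-refl) (·-zeroˡ 𝟘)))

    inverseˡ : ∀ x → (⊖ x) ⊕ x ∼ 𝟘
    inverseˡ x = ∼-trans (⊕-cong ∼-refl (∼-sym (·-identityˡ x)))
      (∼-trans (∼-sym (·-distribʳ x (- 1#) 1#))
      (∼-trans (·-cong (R.-‿inverseˡ 1#) ∼-refl) (·-zeroˡ x)))

  -- Σᵢ (-1)ⁱ f i
  altSum : ∀ {n k} → (Fin k → Chain n) → Chain n
  altSum {k = zero}  f = 𝟘
  altSum {k = suc k} f = f zero ⊕ (⊖ altSum (f ∘ suc))

  ∂-gen : ∀ {n} (τ : Vec V n) → Spans τ → Chain (pred n)
  ∂-gen {zero}  τ s = 𝟘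
  ∂-gen {suc n} τ s = altSum λ i → gen (removeAt τ i) (removeAt-Spans τ i s)

  ∂ : ∀ {n} → Chain n → Chain (pred n)
  ∂ (gen τ s)         = ∂-gen τ s
  ∂ 𝟘                 = 𝟘
  ∂ (x ⊕ y)           = ∂ x ⊕ ∂ y
  ∂ (r · x)           = r · ∂ x

  private
    module _ {n : ℕ} where
      open LeftModule (chains n) public
        using (*ₗ-zeroʳ; ≈ᴹ-setoid; +ᴹ-identityʳ; -ᴹ‿inverseʳ; +ᴹ-abelianGroup)
        renaming (*ₗ-congˡ to ·-congˡ; *ₗ-congʳ to ·-congʳ; +ᴹ-congˡ to ⊕-congˡ)
      open AbelianGroupProperties +ᴹ-abelianGroup public
        using (⁻¹-involutive; ⁻¹-∙-comm)

    altSum-cong : ∀ {n k} {f g : Fin k → Chain n} → (∀ i → f i ∼ g i) →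
                  altSum f ∼ altSum g
    altSum-cong {k = zero}  f∼g = ∼-refl
    altSum-cong {k = suc k} f∼g =
      ⊕-cong (f∼g zero) (·-congˡ (altSum-cong (f∼g ∘ suc)))

    altSum-⊖ : ∀ {n k} {f g : Fin k → Chain n} → (∀ i → f i ∼ ⊖ g i) →
               altSum f ∼ ⊖ altSum g
    altSum-⊖ {k = zero}  f∼⊖g = ∼-sym (*ₗ-zeroʳ (- 1#))
    altSum-⊖ {k = suc k} f∼⊖g = ∼-trans
      (⊕-cong (f∼⊖g zero) (·-congˡ (altSum-⊖ (f∼⊖g ∘ suc))))
      (∼-sym (·-distribˡ (- 1#) _ _))

    altSum-𝟘 : ∀ {n k} {f : Fin k → Chain n} → (∀ i → f i ∼ 𝟘) → altSum f ∼ 𝟘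
    altSum-𝟘 {k = zero}  f∼𝟘 = ∼-refl
    altSum-𝟘 {k = suc k} f∼𝟘 = ∼-trans
      (⊕-cong (f∼𝟘 zero) (∼-trans (·-congˡ (altSum-𝟘 (f∼𝟘 ∘ suc)))
        (*ₗ-zeroʳ (- 1#))))
      (⊕-identityˡ 𝟘)

    cancel-pair : ∀ {n} {x y z : Chain n} → x ∼ y → z ∼ 𝟘 →
                  x ⊕ ⊖ (y ⊕ ⊖ z) ∼ 𝟘
    cancel-pair {x = x} {y} {z} x∼y z∼𝟘 = begin
      x ⊕ ⊖ (y ⊕ ⊖ z)
        ≈⟨ ⊕-cong x∼y (·-congˡ (⊕-congˡ (∼-trans (·-congˡ z∼𝟘) (*ₗ-zeroʳ _)))) ⟩
      y ⊕ ⊖ (y ⊕ 𝟘)  ≈⟨ ⊕-congˡ (·-congˡ (+ᴹ-identityʳ y)) ⟩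
      y ⊕ ⊖ y        ≈⟨ -ᴹ‿inverseʳ y ⟩
      𝟘              ∎
      where open SetoidReasoning ≈ᴹ-setoid

    exchange : ∀ {n} {x x′ y y′ z z′ : Chain n} → x ∼ x′ → y ∼ y′ → z ∼ ⊖ z′ →
               x ⊕ ⊖ (y ⊕ ⊖ z) ∼ ⊖ (y′ ⊕ ⊖ (x′ ⊕ ⊖ z′))
    exchange {x = x} {x′} {y} {y′} {z} {z′} x∼ y∼ z∼ = begin
      x ⊕ ⊖ (y ⊕ ⊖ z)
        ≈⟨ ⊕-cong x∼ (·-congˡ (⊕-cong y∼
             (∼-trans (·-congˡ z∼) (⁻¹-involutive z′)))) ⟩
      x′ ⊕ ⊖ (y′ ⊕ z′)         ≈⟨ ⊕-congˡ (·-distribˡ _ y′ z′) ⟩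
      x′ ⊕ (⊖ y′ ⊕ ⊖ z′)       ≈⟨ ⊕-assoc _ _ _ ⟨
      (x′ ⊕ ⊖ y′) ⊕ ⊖ z′       ≈⟨ ⊕-cong (⊕-comm _ _) ∼-refl ⟩
      (⊖ y′ ⊕ x′) ⊕ ⊖ z′       ≈⟨ ⊕-assoc _ _ _ ⟩
      ⊖ y′ ⊕ (x′ ⊕ ⊖ z′)       ≈⟨ ⊕-congˡ (⁻¹-involutive _) ⟨
      ⊖ y′ ⊕ ⊖ ⊖ (x′ ⊕ ⊖ z′)   ≈⟨ ·-distribˡ _ y′ _ ⟨
      ⊖ (y′ ⊕ ⊖ (x′ ⊕ ⊖ z′))   ∎
      where open SetoidReasoning ≈ᴹ-setoid

    altSum-swap : ∀ {m n} {Q : Vec V m → Set p} (g : ∀ ρ → Q ρ → Chain n) →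
                  (∀ {ρ} s t → g ρ s ∼ g ρ t) →
                  (∀ {ρ ρ′} → AdjacentSwap ρ ρ′ → ∀ s t → g ρ s ∼ ⊖ g ρ′ t) →
                  ∀ {τ τ′} → AdjacentSwap τ τ′ →
                  (s : ∀ i → Q (removeAt τ i)) (t : ∀ i → Q (removeAt τ′ i)) →
                  altSum (λ i → g (removeAt τ i) (s i)) ∼
                  ⊖ altSum (λ i → g (removeAt τ′ i) (t i))
    altSum-swap g irr swap (here {τ = []}) s t =
      exchange (irr _ _) (irr _ _) (∼-sym (*ₗ-zeroʳ (- 1#)))
    altSum-swap g irr swap (here {τ = _ ∷ _}) s t =
      exchange (irr _ _) (irr _ _) (altSum-⊖ λ i → swap here (s (suc (suc i))) (t (suc (suc i))))
    altSum-swap g irr swap (there {τ = _ ∷ _} {τ′ = _ ∷ _} w) s t = ∼-trans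
      (⊕-cong (swap w _ _) (·-congˡ
        (altSum-swap (λ ρ → g (_ ∷ ρ)) irr (swap ∘ there) w (s ∘ suc) (t ∘ suc))))
      (∼-sym (·-distribˡ (- 1#) _ _))

    altSum-repeat : ∀ {m n} {Q : Vec V m → Set p} (g : ∀ ρ → Q ρ → Chain n) →
                    (∀ {ρ} s t → g ρ s ∼ g ρ t) →
                    (∀ {ρ} → AdjacentRepeat ρ → ∀ s → g ρ s ∼ 𝟘) →
                    ∀ {τ} → AdjacentRepeat τ → (s : ∀ i → Q (removeAt τ i)) →
                    altSum (λ i → g (removeAt τ i) (s i)) ∼ 𝟘
    altSum-repeat g irr rep (here {τ = []}) s = cancel-pair (irr _ _) ∼-refl
    altSum-repeat g irr rep (here {τ = _ ∷ _}) s =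
      cancel-pair (irr _ _) (altSum-𝟘 λ i → rep here (s (suc (suc i))))
    altSum-repeat g irr rep (there {τ = _ ∷ _} r) s = ∼-trans
      (⊕-cong (rep r _) (∼-trans (·-congˡ
        (altSum-repeat (λ ρ → g (_ ∷ ρ)) irr (rep ∘ there) r (s ∘ suc)))
        (*ₗ-zeroʳ (- 1#))))
      (⊕-identityˡ 𝟘)

  ∂-cong : ∀ {n} {x y : Chain n} → x ∼ y → ∂ x ∼ ∂ y
  ∂-cong ∼-refl             = ∼-refl
  ∂-cong (∼-sym p)          = ∼-sym (∂-cong p)
  ∂-cong (∼-trans p q)      = ∼-trans (∂-cong p) (∂-cong q)
  ∂-cong (⊕-cong p q)       = ⊕-cong (∂-cong p) (∂-cong q)
  ∂-cong (·-cong r≈s p)     = ·-cong r≈s (∂-cong p)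
  ∂-cong (⊕-assoc x y z)    = ⊕-assoc _ _ _
  ∂-cong (⊕-comm x y)       = ⊕-comm _ _
  ∂-cong (⊕-identityˡ x)    = ⊕-identityˡ _
  ∂-cong (·-zeroˡ x)        = ·-zeroˡ _
  ∂-cong (·-identityˡ x)    = ·-identityˡ _
  ∂-cong (·-assoc r s x)    = ·-assoc r s _
  ∂-cong (·-distribʳ x r s) = ·-distribʳ _ r s
  ∂-cong (·-distribˡ r x y) = ·-distribˡ r _ _
  ∂-cong {zero}  (gen-cong s t)   = ∼-refl
  ∂-cong {suc n} (gen-cong {τ} s t)   = altSum-cong λ i →
    gen-cong {τ = removeAt τ i} (removeAt-Spans τ i s) (removeAt-Spans τ i t)
  ∂-cong {suc n} (gen-swap {τ} {τ′} w s t) = altSum-swap gen gen-cong gen-swap w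
    (λ i → removeAt-Spans τ i s) (λ i → removeAt-Spans τ′ i t)
  ∂-cong {suc n} (gen-repeat {τ} r s) = altSum-repeat gen gen-cong gen-repeat r
    (λ i → removeAt-Spans τ i s)

  ∂-isHomomorphism : ∀ n → LeftModuleMorphisms.IsLeftModuleHomomorphism
    (LeftModule.rawLeftModule (chains n))
    (LeftModule.rawLeftModule (chains (pred n))) ∂
  ∂-isHomomorphism n = record
    { +ᴹ-isGroupHomomorphism = record
      { isMonoidHomomorphism = record
        { isMagmaHomomorphism = record
          { isRelHomomorphism = record { cong = ∂-cong }
          ; homo = λ _ _ → ∼-refl
          }
        ; ε-homo = ∼-refl
        }
      ; ⁻¹-homo = λ _ → ∼-refl
      }
    ; *ₗ-homo = λ _ _ → ∼-refl
    }

  -- Shifted: chains n has dimension n - 1, and ∂ vanishes on chains 0.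
  homologyAt : ℕ → VectorSpace F (c ⊔ ℓ ⊔ v ⊔ p) (c ⊔ ℓ ⊔ v ⊔ p)
  homologyAt n = homology (chains (suc n)) (chains n) (chains (pred n))
    (∂-isHomomorphism (suc n)) (∂-isHomomorphism n)

module _ {c ℓ v p : Level} {V : Set v} where

  H̃ : ℤ → SimplicialComplex V p → (F : Field c ℓ) →
      VectorSpace F (c ⊔ ℓ ⊔ v ⊔ p) (c ⊔ ℓ ⊔ v ⊔ p)
  H̃ (+ q)        K F = homologyAt (suc q)
    where open ChainComplex F K
  H̃ -[1+ zero ]  K F = homologyAt 0
    where open ChainComplex F K
  H̃ -[1+ suc _ ] K F = Zero.leftModule

{-# OPTIONS --safe #-}
-- Let J be the double mapping cylinder of X and the nerve N: its simplices are the joins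
-- τ * α with α a set of indices and τ a simplex of every member of α. A nonempty τ can
-- be coned off along an index i with τ ∈ Γ i, so every chain of J with boundary in N is
-- homologous to a chain of N. Hence N → J is injective on homology, and the cylinder of
-- a subfamily that is a simplex of N is acyclic, like that simplex.
--
-- It remains to find a linear map w from the ℓ-cycles of N to the ℓ-cycles of X with w z
-- homologous to z in J: if w z bounds in X, then z bounds in J, hence in N. For ℓ = k,
-- the homotopy is built by removing the indices one size at a time: the component of a
-- cycle along a set ρ of indices is a cycle of ⋂ ρ, hence a boundary by (1). The
-- primitives are chosen linearly in z and carried by subfamilies, so that w maps the
-- cycles of the simplex spanned by σ into ⋃ σ. This allows raising the degree: for
-- σ ∈ N, the cycle w (∂ σ) bounds in ⋃ σ by (2), say w (∂ σ) = ∂ (w σ), and the homotopy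
-- extends to σ because the cylinder of σ is acyclic.
module Submission where

open import Defs
open import Algebra.Bundles using (AbelianGroup; CommutativeMonoid; Ring)
import Algebra.Definitions.RawMonoid as RawMonoidDefinitions
open import Algebra.Module.Bundles using (LeftModule)
import Algebra.Properties.AbelianGroup as AbelianGroupProperties
import Algebra.Properties.CommutativeMonoid.Sum as SumProperties
import Algebra.Properties.CommutativeSemigroup as CommutativeSemigroupProperties
import Algebra.Properties.Monoid.Mult as MultProperties
open import Axiom.ExcludedMiddle using (ExcludedMiddle)
open import Data.Fin.Base using (Fin; zero; suc)
open import Data.Integer.Base
  using (ℤ; +_; -[1+_]; -1ℤ; 1ℤ; _+_; _-_; _≤_; _<_; +≤+; -≤-)
import Data.Integer.Properties as ℤ
open import Data.Integer.Solver using (module +-*-Solver)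
open import Data.List.Base
  using (List; []; _∷_; _++_; map; length; mapMaybe; foldr; lookup; allFin)
open import Data.List.Membership.Propositional using (_∈_; _∉_)
open import Data.List.Membership.Propositional.Properties using (∈-allFin; ∈-lookup)
open import Data.List.Properties
  using ( length-map; length-++; length-mapMaybe; ++-identityʳ
        ; mapMaybeIsInj₁∘mapInj₁; mapMaybeIsInj₂∘mapInj₁)
open import Data.List.Relation.Binary.Permutation.Propositional
  using (_↭_; ↭-refl; ↭-sym; ↭-trans; prep; swap)
open import Data.List.Relation.Binary.Permutation.Propositional.Properties
  using (↭-length; ↭-empty-inv; All-resp-↭; mapMaybe-↭; ++⁺ˡ)
open import Data.List.Relation.Binary.Subset.Propositional using (_⊆_)
open import Data.List.Relation.Binary.Subset.Propositional.Properties
  using (⊆-reflexive-↭; All-resp-⊇; Any-resp-⊆; xs⊆xs++ys)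
open import Data.List.Relation.Unary.All as All using (All; []; _∷_)
import Data.List.Relation.Unary.All.Properties as All
open import Data.List.Relation.Unary.AllPairs using ([]; _∷_)
open import Data.List.Relation.Unary.Any as Any using (Any; here; there)
open import Data.List.Relation.Unary.Unique.Propositional using (Unique)
open import Data.List.Relation.Unary.Unique.Propositional.Properties using (allFin⁺)
open import Data.Maybe.Base as Maybe using (Maybe; just; nothing)
open import Data.Maybe.Relation.Binary.Pointwise using (Pointwise; just; nothing)
open import Data.Maybe.Relation.Unary.All using (just; nothing) renaming (All to AllMaybe)
open import Data.Nat.Base as ℕ using (ℕ; zero; suc; pred; z≤n; s≤s; s≤s⁻¹)
import Data.Nat.Properties as ℕ
open import Data.Product.Base using (Σ; ∃-syntax; _×_; _,_; proj₁; proj₂)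
open import Data.Sum using (_⊎_; inj₁; inj₂; isInj₁; isInj₂)
open import Data.Unit.Polymorphic.Base using (⊤; tt)
open import Data.Vec.Base as Vec using (Vec; []; _∷_; toList; fromList; removeAt; _[_]≔_)
open import Data.Vec.Properties using (toList∘fromList; length-toList)
open import Function.Base using (_∘_; id)
open import Level using (Level; _⊔_)
open import Relation.Binary.Definitions using (DecidableEquality)
open import Relation.Binary.PropositionalEquality as ≡ using (_≡_; _≢_)
import Relation.Binary.Reasoning.Setoid as SetoidReasoning
open import Relation.Nullary.Decidable.Core using (yes; no)
open import Relation.Nullary.Negation.Core using (¬_; contradiction)

-- The obstacle is that the component of a single simplex along `ρ` need not be a cycle; only the
-- combinations that come from cycles of N are. Primitives therefore cannot be chosen simplex by
-- simplex. As there are finitely many subfamilies, the components form a finite list, and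
-- `FiniteSection` assigns a vector to each so that every combination that is a cycle is the
-- boundary of the same combination of vectors. It also sends zero to zero. The component along `ρ`
-- vanishes on the subfamilies not containing `ρ`, so this keeps the choice carried by subfamilies,
-- and condition (2) can be applied to one union at a time.
--
-- All chains live in one exterior algebra on V ⊎ Fin m. There a join is a product, stripping
-- indices is a contraction, and a subcomplex is a predicate on words. Only the hypotheses and the
-- conclusion speak of oriented chains, which are transported along an embedding with a left
-- inverse. Dimensions are compared through independent families, so no basis of homology is needed.

-- An expression equals its positive part minus its negative part, so an identity
-- of abelian groups reduces to one between vectors of natural numbers.
module GroupSolver {a ℓ : Level} (G : AbelianGroup a ℓ) where

  open AbelianGroup G
  open MultProperties monoid using (×-homo-+) renaming (_×_ to _times_)
  open AbelianGroupProperties G using (∙-cancelʳ)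
  open CommutativeSemigroupProperties
    (CommutativeMonoid.commutativeSemigroup commutativeMonoid)
    using (interchange)
  open SetoidReasoning setoid

  infixl 6 _:+_
  infix  8 :-_

  data Expr (n : ℕ) : Set where
    var  : Fin n → Expr n
    :0   : Expr n
    _:+_ : Expr n → Expr n → Expr n
    :-_  : Expr n → Expr n

  private
    variable
      n : ℕ

    Combination : Vec Carrier n → Vec ℕ n → Carrier
    Combination []      []      = ε
    Combination (x ∷ ρ) (k ∷ v) = (k times x) ∙ Combination ρ v

    unit : Fin n → Vec ℕ n
    unit i = Vec.replicate _ 0 [ i ]≔ 1

    combination-0 : (ρ : Vec Carrier n) → Combination ρ (Vec.replicate n 0) ≈ ε
    combination-0 []      = refl
    combination-0 (x ∷ ρ) = trans (identityˡ _) (combination-0 ρ)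

    combination-unit : (ρ : Vec Carrier n) (i : Fin n) →
                       Combination ρ (unit i) ≈ Vec.lookup ρ i
    combination-unit (x ∷ ρ) zero    =
      trans (∙-cong (identityʳ x) (combination-0 ρ)) (identityʳ x)
    combination-unit (x ∷ ρ) (suc i) = trans (identityˡ _) (combination-unit ρ i)

    combination-+ : (ρ : Vec Carrier n) (u v : Vec ℕ n) →
                    Combination ρ (Vec.zipWith ℕ._+_ u v) ≈
                    Combination ρ u ∙ Combination ρ v
    combination-+ []      []      []      = sym (identityˡ ε)
    combination-+ (x ∷ ρ) (j ∷ u) (k ∷ v) =
      trans (∙-cong (×-homo-+ x j k) (combination-+ ρ u v)) (interchange _ _ _ _)

  positive negative : Expr n → Vec ℕ n
  positive (var i)  = unit i
  positive :0       = Vec.replicate _ 0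
  positive (a :+ b) = Vec.zipWith ℕ._+_ (positive a) (positive b)
  positive (:- a)   = negative a
  negative (var i)  = Vec.replicate _ 0
  negative :0       = Vec.replicate _ 0
  negative (a :+ b) = Vec.zipWith ℕ._+_ (negative a) (negative b)
  negative (:- a)   = positive a

  ⟦_⟧ : Expr n → Vec Carrier n → Carrier
  ⟦ var i ⟧  ρ = Vec.lookup ρ i
  ⟦ :0 ⟧     ρ = ε
  ⟦ a :+ b ⟧ ρ = ⟦ a ⟧ ρ ∙ ⟦ b ⟧ ρ
  ⟦ :- a ⟧   ρ = ⟦ a ⟧ ρ ⁻¹

  private
    correct : (e : Expr n) (ρ : Vec Carrier n) →
              ⟦ e ⟧ ρ ∙ Combination ρ (negative e) ≈ Combination ρ (positive e)
    correct (var i)  ρ = trans (∙-congˡ (combination-0 ρ))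
      (trans (identityʳ _) (sym (combination-unit ρ i)))
    correct :0       ρ = identityˡ _
    correct (a :+ b) ρ = begin
      (⟦ a ⟧ ρ ∙ ⟦ b ⟧ ρ) ∙ Combination ρ (Vec.zipWith ℕ._+_ (negative a) (negative b))
        ≈⟨ ∙-congˡ (combination-+ ρ (negative a) (negative b)) ⟩
      (⟦ a ⟧ ρ ∙ ⟦ b ⟧ ρ) ∙ (Combination ρ (negative a) ∙ Combination ρ (negative b))
        ≈⟨ interchange _ _ _ _ ⟩
      (⟦ a ⟧ ρ ∙ Combination ρ (negative a)) ∙ (⟦ b ⟧ ρ ∙ Combination ρ (negative b))
        ≈⟨ ∙-cong (correct a ρ) (correct b ρ) ⟩
      Combination ρ (positive a) ∙ Combination ρ (positive b)
        ≈⟨ combination-+ ρ (positive a) (positive b) ⟨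
      Combination ρ (Vec.zipWith ℕ._+_ (positive a) (positive b)) ∎
    correct (:- a)   ρ = begin
      ⟦ a ⟧ ρ ⁻¹ ∙ Combination ρ (positive a)
        ≈⟨ ∙-congˡ (correct a ρ) ⟨
      ⟦ a ⟧ ρ ⁻¹ ∙ (⟦ a ⟧ ρ ∙ Combination ρ (negative a))
        ≈⟨ assoc _ _ _ ⟨
      (⟦ a ⟧ ρ ⁻¹ ∙ ⟦ a ⟧ ρ) ∙ Combination ρ (negative a)
        ≈⟨ ∙-congʳ (inverseˡ _) ⟩
      ε ∙ Combination ρ (negative a)
        ≈⟨ identityˡ _ ⟩
      Combination ρ (negative a) ∎

  solve : (ρ : Vec Carrier n) (a b : Expr n) →
          Vec.zipWith ℕ._+_ (positive a) (negative b) ≡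
          Vec.zipWith ℕ._+_ (positive b) (negative a) →
          ⟦ a ⟧ ρ ≈ ⟦ b ⟧ ρ
  solve ρ a b eq = ∙-cancelʳ (Combination ρ (negative a) ∙ Combination ρ (negative b)) _ _
    (begin
      ⟦ a ⟧ ρ ∙ (Combination ρ (negative a) ∙ Combination ρ (negative b))
        ≈⟨ assoc _ _ _ ⟨
      (⟦ a ⟧ ρ ∙ Combination ρ (negative a)) ∙ Combination ρ (negative b)
        ≈⟨ ∙-congʳ (correct a ρ) ⟩
      Combination ρ (positive a) ∙ Combination ρ (negative b)
        ≈⟨ combination-+ ρ (positive a) (negative b) ⟨
      Combination ρ (Vec.zipWith ℕ._+_ (positive a) (negative b))
        ≡⟨ ≡.cong (Combination ρ) eq ⟩
      Combination ρ (Vec.zipWith ℕ._+_ (positive b) (negative a))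
        ≈⟨ combination-+ ρ (positive b) (negative a) ⟩
      Combination ρ (positive b) ∙ Combination ρ (negative a)
        ≈⟨ ∙-congʳ (correct b ρ) ⟨
      (⟦ b ⟧ ρ ∙ Combination ρ (negative b)) ∙ Combination ρ (negative a)
        ≈⟨ assoc _ _ _ ⟩
      ⟦ b ⟧ ρ ∙ (Combination ρ (negative b) ∙ Combination ρ (negative a))
        ≈⟨ ∙-congˡ (comm _ _) ⟩
      ⟦ b ⟧ ρ ∙ (Combination ρ (negative a) ∙ Combination ρ (negative b)) ∎)

-- Linear algebra: modules, linear maps, primitives of finitely many vectors

module ModuleLemmas {c ℓ : Level} (F : Field c ℓ)
  {m ℓm : Level} (M : LeftModule (Field.ring F) m ℓm)
  where

  private
    module F = Field F
    module S = SumProperties (LeftModule.+ᴹ-commutativeMonoid M)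
  open LeftModule M
  open AbelianGroupProperties +ᴹ-abelianGroup using (inverseʳ-unique)
  open S using (sum; sum-cong-≋) public
  open SetoidReasoning ≈ᴹ-setoid

  *ₗ-neg : ∀ r x → r *ₗ (-ᴹ x) ≈ᴹ -ᴹ (r *ₗ x)
  *ₗ-neg r x = inverseʳ-unique _ _ (begin
    r *ₗ x +ᴹ r *ₗ (-ᴹ x) ≈⟨ *ₗ-distribˡ r x (-ᴹ x) ⟨
    r *ₗ (x +ᴹ -ᴹ x)      ≈⟨ *ₗ-congˡ (-ᴹ‿inverseʳ x) ⟩
    r *ₗ 0ᴹ               ≈⟨ *ₗ-zeroʳ r ⟩
    0ᴹ                    ∎)

  neg-*ₗ : ∀ r x → (F.- r) *ₗ x ≈ᴹ -ᴹ (r *ₗ x)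
  neg-*ₗ r x = inverseʳ-unique _ _ (begin
    r *ₗ x +ᴹ (F.- r) *ₗ x ≈⟨ *ₗ-distribʳ x r (F.- r) ⟨
    (r F.+ F.- r) *ₗ x     ≈⟨ *ₗ-congʳ (F.-‿inverseʳ r) ⟩
    F.0# *ₗ x              ≈⟨ *ₗ-zeroˡ x ⟩
    0ᴹ                     ∎)

  *ₗ-comm : ∀ r s x → r *ₗ (s *ₗ x) ≈ᴹ s *ₗ (r *ₗ x)
  *ₗ-comm r s x = begin
    r *ₗ (s *ₗ x)  ≈⟨ *ₗ-assoc r s x ⟨
    (r F.* s) *ₗ x ≈⟨ *ₗ-congʳ (F.*-comm r s) ⟩
    (s F.* r) *ₗ x ≈⟨ *ₗ-assoc s r x ⟩
    s *ₗ (r *ₗ x)  ∎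

  sum-cong : ∀ {n} {f g : Fin n → Carrierᴹ} → (∀ i → f i ≈ᴹ g i) → sum f ≈ᴹ sum g
  sum-cong = sum-cong-≋

  sum-+ : ∀ {n} (f g : Fin n → Carrierᴹ) → sum (λ i → f i +ᴹ g i) ≈ᴹ sum f +ᴹ sum g
  sum-+ = S.∑-distrib-+

  sum-comm : ∀ {n k} (f : Fin n → Fin k → Carrierᴹ) →
             sum (λ i → sum (f i)) ≈ᴹ sum (λ j → sum (λ i → f i j))
  sum-comm = S.∑-comm

  sum-*ₗ : ∀ {n} r (f : Fin n → Carrierᴹ) → r *ₗ sum f ≈ᴹ sum (λ i → r *ₗ f i)
  sum-*ₗ {zero}  r f = *ₗ-zeroʳ r
  sum-*ₗ {suc n} r f = ≈ᴹ-trans (*ₗ-distribˡ r _ _) (+ᴹ-congˡ (sum-*ₗ r (f ∘ suc)))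

  sum-combine : ∀ {n} (r : Fin n → F.Carrier) q (t : Fin n → F.Carrier)
    (x : Fin n → Carrierᴹ) →
    sum (λ i → (r i F.+ q F.* t i) *ₗ x i) ≈ᴹ
    sum (λ i → r i *ₗ x i) +ᴹ q *ₗ sum (λ i → t i *ₗ x i)
  sum-combine {n} r q t x = begin
    sum (λ i → (r i F.+ q F.* t i) *ₗ x i)
      ≈⟨ sum-cong {n} (λ i → *ₗ-distribʳ (x i) _ _) ⟩
    sum (λ i → r i *ₗ x i +ᴹ (q F.* t i) *ₗ x i)
      ≈⟨ sum-+ {n} _ _ ⟩
    sum (λ i → r i *ₗ x i) +ᴹ sum (λ i → (q F.* t i) *ₗ x i)
      ≈⟨ +ᴹ-congˡ (sum-cong {n} (λ i → *ₗ-assoc q (t i) (x i))) ⟩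
    sum (λ i → r i *ₗ x i) +ᴹ sum (λ i → q *ₗ (t i *ₗ x i))
      ≈⟨ +ᴹ-congˡ (sum-*ₗ {n} q _) ⟨
    sum (λ i → r i *ₗ x i) +ᴹ q *ₗ sum (λ i → t i *ₗ x i) ∎

  sum-0 : ∀ {n} {f : Fin n → Carrierᴹ} → (∀ i → f i ≈ᴹ 0ᴹ) → sum f ≈ᴹ 0ᴹ
  sum-0 {zero}  f≈0 = ≈ᴹ-refl
  sum-0 {suc n} f≈0 =
    ≈ᴹ-trans (+ᴹ-cong (f≈0 zero) (sum-0 (f≈0 ∘ suc))) (+ᴹ-identityˡ 0ᴹ)

module _ {c ℓ : Level} {R : Ring c ℓ} {a ℓa b ℓb : Level}
  (A : LeftModule R a ℓa) (B : LeftModule R b ℓb)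
  where

  private
    module R = Ring R
    module AS = RawMonoidDefinitions (LeftModule.+ᴹ-rawMonoid A)
    module BS = RawMonoidDefinitions (LeftModule.+ᴹ-rawMonoid B)
    module A = LeftModule A
    module B = LeftModule B

  record IsLinear (f : A.Carrierᴹ → B.Carrierᴹ) : Set (c ⊔ a ⊔ ℓa ⊔ b ⊔ ℓb) where
    field
      cong   : ∀ {x y} → x A.≈ᴹ y → f x B.≈ᴹ f y
      +-homo : ∀ x y → f (x A.+ᴹ y) B.≈ᴹ f x B.+ᴹ f y
      *-homo : ∀ r x → f (r A.*ₗ x) B.≈ᴹ r B.*ₗ f x

    0-homo : f A.0ᴹ B.≈ᴹ B.0ᴹ
    0-homo = B.≈ᴹ-trans (cong (A.≈ᴹ-sym (A.*ₗ-zeroˡ A.0ᴹ)))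
      (B.≈ᴹ-trans (*-homo R.0# A.0ᴹ) (B.*ₗ-zeroˡ _))

    ≈0 : ∀ {x} → x A.≈ᴹ A.0ᴹ → f x B.≈ᴹ B.0ᴹ
    ≈0 x≈0 = B.≈ᴹ-trans (cong x≈0) 0-homo

    neg-homo : ∀ x → f (A.-ᴹ x) B.≈ᴹ B.-ᴹ f x
    neg-homo x = AbelianGroupProperties.inverseʳ-unique B.+ᴹ-abelianGroup _ _
      (B.≈ᴹ-trans (B.≈ᴹ-sym (+-homo x (A.-ᴹ x))) (≈0 (A.-ᴹ‿inverseʳ x)))

    sum-homo : ∀ {n} (g : Fin n → A.Carrierᴹ) →
               f (AS.sum {n} g) B.≈ᴹ BS.sum {n} (f ∘ g)
    sum-homo {zero}  g = 0-homo
    sum-homo {suc n} g = B.≈ᴹ-trans (+-homo _ _) (B.+ᴹ-congˡ (sum-homo {n} (g ∘ suc)))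

record IsSubspace {c ℓ : Level} {R : Ring c ℓ} {a ℓa p : Level}
  (A : LeftModule R a ℓa) (P : LeftModule.Carrierᴹ A → Set p) :
  Set (c ⊔ a ⊔ p) where
  open LeftModule A
  open RawMonoidDefinitions +ᴹ-rawMonoid using (sum)
  field
    0-closed : P 0ᴹ
    +-closed : ∀ {x y} → P x → P y → P (x +ᴹ y)
    *-closed : ∀ r {x} → P x → P (r *ₗ x)

  sum-closed : ∀ {n} {g : Fin n → Carrierᴹ} → (∀ i → P (g i)) →
               P (sum {n} g)
  sum-closed {zero}  Pg = 0-closed
  sum-closed {suc n} Pg = +-closed (Pg zero) (sum-closed {n} (Pg ∘ suc))

-- A partial linear section of f over the span of finitely many vectors b, defined
-- only on the cycles of that span. It is built vector by vector: the new b₀ either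
-- completes a combination of the old ones to a cycle, or it occurs in no cycle.
module FiniteSection
  (em : ∀ {a} → ExcludedMiddle a)
  {c ℓ : Level} {F : Field c ℓ} {a ℓa b ℓb d ℓd p q : Level}
  {A : LeftModule (Field.ring F) a ℓa}
  {B : LeftModule (Field.ring F) b ℓb}
  {C : LeftModule (Field.ring F) d ℓd}
  {f : LeftModule.Carrierᴹ A → LeftModule.Carrierᴹ B} (f-linear : IsLinear A B f)
  {g : LeftModule.Carrierᴹ B → LeftModule.Carrierᴹ C} (g-linear : IsLinear B C g)
  {P : LeftModule.Carrierᴹ A → Set p} (P-subspace : IsSubspace A P)
  {Q : LeftModule.Carrierᴹ B → Set q} (Q-subspace : IsSubspace B Q)
  (exact : ∀ y → Q y → LeftModule._≈ᴹ_ C (g y) (LeftModule.0ᴹ C) →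
           ∃[ x ] P x × LeftModule._≈ᴹ_ B (f x) y)
  where

  private
    module F = Field F
    module A = LeftModule A
    module B = LeftModule B
    module C = LeftModule C
    module AL = ModuleLemmas F A
    module BL = ModuleLemmas F B
    module f = IsLinear f-linear
    module g = IsLinear g-linear
    module P = IsSubspace P-subspace
    module Q = IsSubspace Q-subspace

    combᴬ : ∀ {n} → (Fin n → F.Carrier) → (Fin n → A.Carrierᴹ) → A.Carrierᴹ
    combᴬ r x = AL.sum (λ i → r i A.*ₗ x i)

    combᴮ : ∀ {n} → (Fin n → F.Carrier) → (Fin n → B.Carrierᴹ) → B.Carrierᴹ
    combᴮ r x = BL.sum (λ i → r i B.*ₗ x i)

    -- The clause on zero vectors makes the section local: a vanishing vector contributes nothing,
    -- so primitives stay inside the subfamily that carries the vector.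
    Section : ∀ {n} → (Fin n → B.Carrierᴹ) → (Fin n → A.Carrierᴹ) →
              Set (c ⊔ ℓa ⊔ ℓb ⊔ ℓd ⊔ p)
    Section {n} y x = (∀ i → P (x i)) × (∀ i → y i B.≈ᴹ B.0ᴹ → x i A.≈ᴹ A.0ᴹ) ×
      (∀ (r : Fin n → F.Carrier) → g (combᴮ r y) C.≈ᴹ C.0ᴹ →
         f (combᴬ r x) B.≈ᴹ combᴮ r y)

    infixr 5 _◂_
    _◂_ : ∀ {s n} {S : Set s} → S → (Fin n → S) → (Fin (suc n) → S)
    (x ◂ y) zero    = x
    (x ◂ y) (suc i) = y i

    module Extend {n} (y : Fin (suc n) → B.Carrierᴹ) (Qy : ∀ i → Q (y i))
      (x : Fin n → A.Carrierᴹ) (Px : ∀ i → P (x i))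
      (x≈0 : ∀ i → y (suc i) B.≈ᴹ B.0ᴹ → x i A.≈ᴹ A.0ᴹ)
      (lift : ∀ (r : Fin n → F.Carrier) → g (combᴮ r (y ∘ suc)) C.≈ᴹ C.0ᴹ →
              f (combᴬ r x) B.≈ᴹ combᴮ r (y ∘ suc))
      where

      y₀ = y zero
      y₊ = y ∘ suc

      P-extend : ∀ {x₀} → P x₀ → ∀ i → P ((x₀ ◂ x) i)
      P-extend Px₀ zero    = Px₀
      P-extend Px₀ (suc i) = Px i

      ≈0-extend : ∀ {x₀} → (y₀ B.≈ᴹ B.0ᴹ → x₀ A.≈ᴹ A.0ᴹ) →
                  ∀ i → y i B.≈ᴹ B.0ᴹ → (x₀ ◂ x) i A.≈ᴹ A.0ᴹ
      ≈0-extend h zero    = h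
      ≈0-extend h (suc i) = x≈0 i

      -- If `y₀` contributes nothing to any cycle, the old section already lifts all of them.
      by-zero : (∀ r → g (combᴮ r y) C.≈ᴹ C.0ᴹ → r zero B.*ₗ y₀ B.≈ᴹ B.0ᴹ) →
                Section y (A.0ᴹ ◂ x)
      by-zero h = P-extend P.0-closed , ≈0-extend (λ _ → A.≈ᴹ-refl) , λ r cycle →
        let eq = B.≈ᴹ-trans (B.+ᴹ-congʳ (h r cycle)) (B.+ᴹ-identityˡ _) in begin
        f (r zero A.*ₗ A.0ᴹ A.+ᴹ combᴬ (r ∘ suc) x)
          ≈⟨ f.cong (A.≈ᴹ-trans (A.+ᴹ-congʳ (A.*ₗ-zeroʳ _)) (A.+ᴹ-identityˡ _)) ⟩
        f (combᴬ (r ∘ suc) x)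
          ≈⟨ lift (r ∘ suc) (C.≈ᴹ-trans (g.cong (B.≈ᴹ-sym eq)) cycle) ⟩
        combᴮ (r ∘ suc) y₊
          ≈⟨ eq ⟨
        combᴮ r y ∎
        where open SetoidReasoning B.≈ᴹ-setoid

      module _ (t : Fin n → F.Carrier)
        (cycle-t : g (y₀ B.+ᴹ combᴮ t y₊) C.≈ᴹ C.0ᴹ) where

        z = exact (y₀ B.+ᴹ combᴮ t y₊)
          (Q.+-closed (Qy zero) (Q.sum-closed {n} λ i → Q.*-closed (t i) (Qy (suc i))))
          cycle-t

        x′ = proj₁ z
        -- `x′` is a primitive of the cycle `y₀ + Σ tᵢ yᵢ`. Subtracting `Σ tᵢ xᵢ` makes this cycle
        -- lift to `x′`.
        x₀ = x′ A.+ᴹ combᴬ (F.-_ ∘ t) x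

        module _ (r : Fin (suc n) → F.Carrier) (cycle-r : g (combᴮ r y) C.≈ᴹ C.0ᴹ) where

          r₀ = r zero
          r₊ = r ∘ suc

          -- Subtracting `r₀` times the cycle through `y₀` leaves a cycle in the old vectors, which
          -- the old section lifts.
          s : Fin n → F.Carrier
          s i = r₊ i F.+ r₀ F.* F.- t i

          neg-comb : combᴮ (F.-_ ∘ t) y₊ B.≈ᴹ B.-ᴹ combᴮ t y₊
          neg-comb = AbelianGroupProperties.inverseʳ-unique B.+ᴹ-abelianGroup _ _
            (B.≈ᴹ-trans (B.≈ᴹ-sym (BL.sum-+ {n} _ _)) (BL.sum-0 {n} λ i →
              B.≈ᴹ-trans (B.+ᴹ-congˡ (BL.neg-*ₗ (t i) _)) (B.-ᴹ‿inverseʳ _)))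

          open GroupSolver B.+ᴹ-abelianGroup using (solve; var; _:+_; :-_)
          open SetoidReasoning B.≈ᴹ-setoid

          rearrange : combᴮ s y₊ B.≈ᴹ
                      combᴮ r y B.+ᴹ B.-ᴹ (r₀ B.*ₗ (y₀ B.+ᴹ combᴮ t y₊))
          rearrange = begin
            combᴮ s y₊
              ≈⟨ BL.sum-combine r₊ r₀ (F.-_ ∘ t) y₊ ⟩
            combᴮ r₊ y₊ B.+ᴹ r₀ B.*ₗ combᴮ (F.-_ ∘ t) y₊
              ≈⟨ B.+ᴹ-congˡ (B.≈ᴹ-trans (B.*ₗ-congˡ neg-comb) (BL.*ₗ-neg r₀ _)) ⟩
            combᴮ r₊ y₊ B.+ᴹ B.-ᴹ (r₀ B.*ₗ combᴮ t y₊)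
              ≈⟨ solve (r₀ B.*ₗ y₀ ∷ combᴮ r₊ y₊ ∷ r₀ B.*ₗ combᴮ t y₊ ∷ [])
                   (v₁ :+ :- v₂) ((v₀ :+ v₁) :+ :- (v₀ :+ v₂)) ≡.refl ⟩
            combᴮ r y B.+ᴹ B.-ᴹ (r₀ B.*ₗ y₀ B.+ᴹ r₀ B.*ₗ combᴮ t y₊)
              ≈⟨ B.+ᴹ-congˡ (B.-ᴹ‿cong (B.*ₗ-distribˡ r₀ _ _)) ⟨
            combᴮ r y B.+ᴹ B.-ᴹ (r₀ B.*ₗ (y₀ B.+ᴹ combᴮ t y₊)) ∎
            where
            v₀ = var zero
            v₁ = var (suc zero)
            v₂ = var (suc (suc zero))

          cycle-s : g (combᴮ s y₊) C.≈ᴹ C.0ᴹ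
          cycle-s = C.≈ᴹ-trans (g.cong rearrange) (C.≈ᴹ-trans (g.+-homo _ _)
            (C.≈ᴹ-trans (C.+ᴹ-cong cycle-r (C.≈ᴹ-trans (g.neg-homo _)
              (C.≈ᴹ-trans (C.-ᴹ‿cong (C.≈ᴹ-trans (g.*-homo r₀ _)
                (C.≈ᴹ-trans (C.*ₗ-congˡ cycle-t) (C.*ₗ-zeroʳ r₀))))
                (AbelianGroupProperties.ε⁻¹≈ε C.+ᴹ-abelianGroup))))
              (C.+ᴹ-identityˡ _)))

          lift-extend : f (combᴬ r (x₀ ◂ x)) B.≈ᴹ combᴮ r y
          lift-extend = begin
            f (r₀ A.*ₗ (x′ A.+ᴹ combᴬ (F.-_ ∘ t) x) A.+ᴹ combᴬ r₊ x)
              ≈⟨ f.cong (A.≈ᴹ-trans (A.+ᴹ-congʳ (A.*ₗ-distribˡ r₀ _ _))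
                   (A.≈ᴹ-trans (A.+ᴹ-assoc _ _ _) (A.+ᴹ-congˡ (A.≈ᴹ-trans (A.+ᴹ-comm _ _)
                     (A.≈ᴹ-sym (AL.sum-combine r₊ r₀ (F.-_ ∘ t) x)))))) ⟩
            f (r₀ A.*ₗ x′ A.+ᴹ combᴬ s x)
              ≈⟨ B.≈ᴹ-trans (f.+-homo _ _) (B.+ᴹ-congʳ (f.*-homo r₀ x′)) ⟩
            r₀ B.*ₗ f x′ B.+ᴹ f (combᴬ s x)
              ≈⟨ B.+ᴹ-cong (B.*ₗ-congˡ (proj₂ (proj₂ z)))
                   (B.≈ᴹ-trans (lift s cycle-s) rearrange) ⟩
            r₀ B.*ₗ (y₀ B.+ᴹ combᴮ t y₊) B.+ᴹ
              (combᴮ r y B.+ᴹ B.-ᴹ (r₀ B.*ₗ (y₀ B.+ᴹ combᴮ t y₊)))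
              ≈⟨ solve (r₀ B.*ₗ (y₀ B.+ᴹ combᴮ t y₊) ∷ combᴮ r y ∷ [])
                   (var zero :+ (var (suc zero) :+ :- var zero)) (var (suc zero)) ≡.refl ⟩
            combᴮ r y ∎

      by-lift : ∀ t (cycle-t : g (y₀ B.+ᴹ combᴮ t y₊) C.≈ᴹ C.0ᴹ) →
                ¬ (y₀ B.≈ᴹ B.0ᴹ) → Section y (x₀ t cycle-t ◂ x)
      by-lift t cycle-t y₀≉0 =
        P-extend (P.+-closed (proj₁ (proj₂ (z t cycle-t)))
          (P.sum-closed {n} λ i → P.*-closed (F.- t i) (Px i))) ,
        ≈0-extend (λ y₀≈0 → contradiction y₀≈0 y₀≉0) ,
        lift-extend t cycle-t

      -- A cycle with `r₀` nonzero, divided by `r₀`, would complete `y₀` to a cycle.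
      no-cycle : ¬ (∃[ t ] g (y₀ B.+ᴹ combᴮ t y₊) C.≈ᴹ C.0ᴹ) →
                 ∀ r → g (combᴮ r y) C.≈ᴹ C.0ᴹ → r zero B.*ₗ y₀ B.≈ᴹ B.0ᴹ
      no-cycle h r cycle with em {P = r zero F.≈ F.0#}
      ... | yes r₀≈0 = B.≈ᴹ-trans (B.*ₗ-congʳ r₀≈0) (B.*ₗ-zeroˡ y₀)
      ... | no  r₀≉0 = contradiction ((λ i → u F.* r (suc i)) , C.≈ᴹ-trans (g.cong eq)
        (C.≈ᴹ-trans (g.*-homo u _) (C.≈ᴹ-trans (C.*ₗ-congˡ cycle) (C.*ₗ-zeroʳ u)))) h
        where
        u  = proj₁ (F.inverse (r zero) r₀≉0)
        eq : y₀ B.+ᴹ combᴮ (λ i → u F.* r (suc i)) y₊ B.≈ᴹ u B.*ₗ combᴮ r y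
        eq = B.≈ᴹ-sym (B.≈ᴹ-trans (B.*ₗ-distribˡ u _ _) (B.+ᴹ-cong
          (B.≈ᴹ-trans (B.≈ᴹ-sym (B.*ₗ-assoc u _ y₀))
            (B.≈ᴹ-trans (B.*ₗ-congʳ (F.trans (F.*-comm u _) (proj₂ (F.inverse (r zero) r₀≉0))))
              (B.*ₗ-identityˡ y₀)))
          (B.≈ᴹ-trans (BL.sum-*ₗ {n} u _) (BL.sum-cong {n} λ i → B.≈ᴹ-sym (B.*ₗ-assoc u _ _)))))

  finite-section : ∀ n (y : Fin n → B.Carrierᴹ) → (∀ i → Q (y i)) →
    Σ (Fin n → A.Carrierᴹ) λ x →
      (∀ i → P (x i)) × (∀ i → y i B.≈ᴹ B.0ᴹ → x i A.≈ᴹ A.0ᴹ) ×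
      (∀ (r : Fin n → F.Carrier) → g (BL.sum {n} λ i → r i B.*ₗ y i) C.≈ᴹ C.0ᴹ →
         f (AL.sum {n} λ i → r i A.*ₗ x i) B.≈ᴹ (BL.sum {n} λ i → r i B.*ₗ y i))
  finite-section zero    y Qy = (λ ()) , (λ ()) , (λ ()) , λ _ _ → f.0-homo
  finite-section (suc n) y Qy
    with x , Px , x≈0 , lift ← finite-section n (y ∘ suc) (Qy ∘ suc)
    with em {P = y zero B.≈ᴹ B.0ᴹ}
  -- Treated apart because the primitive chosen for a cycle through `y₀` need not be zero when `y₀`
  -- is.
  ... | yes y₀≈0 = (A.0ᴹ ◂ x) , Extend.by-zero y Qy x Px x≈0 lift
          (λ r _ → B.≈ᴹ-trans (B.*ₗ-congˡ y₀≈0) (B.*ₗ-zeroʳ _))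
  ... | no  y₀≉0
    with em {P = ∃[ t ] g (y zero B.+ᴹ combᴮ t (y ∘ suc)) C.≈ᴹ C.0ᴹ}
  ...   | yes (t , cycle) = _ , Extend.by-lift y Qy x Px x≈0 lift t cycle y₀≉0
  ...   | no  h           = _ , Extend.by-zero y Qy x Px x≈0 lift
            (Extend.no-cycle y Qy x Px x≈0 lift h)

-- Exterior algebra, and chains supported on a set of words

-- The exterior algebra on W, presented as the module generated by 𝟙 under the
-- operators of left multiplication by x. The simplicial boundary is the
-- contraction with the functional that is 1 on all vertices.
module Exterior {c ℓ w : Level} (F : Field c ℓ) (W : Set w) (_≟_ : DecidableEquality W)
  where

  private
    module R = Field F
    open R using (Carrier; _≈_; _*_; -_; 0#; 1#)

  infixl 6 _⊕_
  infixr 7 _·_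
  infix  4 _∼_

  data Λ : Set (c ⊔ w) where
    𝟙   : Λ
    e   : W → Λ → Λ
    𝟘   : Λ
    _⊕_ : Λ → Λ → Λ
    _·_ : Carrier → Λ → Λ

  ⊖_ : Λ → Λ
  ⊖ x = (- 1#) · x

  data _∼_ : Λ → Λ → Set (c ⊔ ℓ ⊔ w) where
    ∼-refl      : ∀ {x} → x ∼ x
    ∼-sym       : ∀ {x y} → x ∼ y → y ∼ x
    ∼-trans     : ∀ {x y z} → x ∼ y → y ∼ z → x ∼ z
    ⊕-cong      : ∀ {x x′ y y′} → x ∼ x′ → y ∼ y′ → x ⊕ y ∼ x′ ⊕ y′
    ·-cong      : ∀ {r s x y} → r ≈ s → x ∼ y → r · x ∼ s · y
    ⊕-assoc     : ∀ x y z → (x ⊕ y) ⊕ z ∼ x ⊕ (y ⊕ z)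
    ⊕-comm      : ∀ x y → x ⊕ y ∼ y ⊕ x
    ⊕-identityˡ : ∀ x → 𝟘 ⊕ x ∼ x
    ·-zeroˡ     : ∀ x → 0# · x ∼ 𝟘
    ·-identityˡ : ∀ x → 1# · x ∼ x
    ·-assoc     : ∀ r s x → (r * s) · x ∼ r · (s · x)
    ·-distribʳ  : ∀ x r s → (r R.+ s) · x ∼ r · x ⊕ s · x
    ·-distribˡ  : ∀ r x y → r · (x ⊕ y) ∼ r · x ⊕ r · y
    e-cong      : ∀ {u x y} → x ∼ y → e u x ∼ e u y
    e-⊕         : ∀ u x y → e u (x ⊕ y) ∼ e u x ⊕ e u y
    e-·         : ∀ u r x → e u (r · x) ∼ r · e u x
    e-anti      : ∀ u v x → e u (e v x) ∼ ⊖ e v (e u x)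
    e-square    : ∀ u x → e u (e u x) ∼ 𝟘

  Λ-module : VectorSpace F (c ⊔ w) (c ⊔ ℓ ⊔ w)
  Λ-module = record
    { Carrierᴹ = Λ
    ; _≈ᴹ_     = _∼_
    ; _+ᴹ_     = _⊕_
    ; _*ₗ_     = _·_
    ; 0ᴹ       = 𝟘
    ; -ᴹ_      = ⊖_
    ; isLeftModule = record
      { isLeftSemimodule = record
        { +ᴹ-isCommutativeMonoid = record
          { isMonoid = record
            { isSemigroup = record
              { isMagma = record
                { isEquivalence = record
                  { refl = ∼-refl ; sym = ∼-sym ; trans = ∼-trans }
                ; ∙-cong = ⊕-cong
                }
              ; assoc = ⊕-assoc
              }
            ; identity = ⊕-identityˡ
                       , λ x → ∼-trans (⊕-comm x 𝟘) (⊕-identityˡ x)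
            }
          ; comm = ⊕-comm
          }
        ; isPreleftSemimodule = record
          { *ₗ-cong      = ·-cong
          ; *ₗ-zeroˡ     = ·-zeroˡ
          ; *ₗ-distribʳ  = ·-distribʳ
          ; *ₗ-identityˡ = ·-identityˡ
          ; *ₗ-assoc     = ·-assoc
          ; *ₗ-zeroʳ     = zeroʳ
          ; *ₗ-distribˡ  = ·-distribˡ
          }
        }
      ; -ᴹ‿cong    = ·-cong R.refl
      ; -ᴹ‿inverse = inverseˡ , λ x → ∼-trans (⊕-comm _ _) (inverseˡ x)
      }
    }
    where
    zeroʳ : ∀ r → r · 𝟘 ∼ 𝟘
    zeroʳ r = ∼-trans (·-cong R.refl (∼-sym (·-zeroˡ 𝟘)))
      (∼-trans (∼-sym (·-assoc r 0# 𝟘))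
      (∼-trans (·-cong (R.zeroʳ r) ∼-refl) (·-zeroˡ 𝟘)))

    inverseˡ : ∀ x → (⊖ x) ⊕ x ∼ 𝟘
    inverseˡ x = ∼-trans (⊕-cong ∼-refl (∼-sym (·-identityˡ x)))
      (∼-trans (∼-sym (·-distribʳ x (- 1#) 1#))
      (∼-trans (·-cong (R.-‿inverseˡ 1#) ∼-refl) (·-zeroˡ x)))

  open LeftModule Λ-module public
    using (≈ᴹ-setoid; +ᴹ-abelianGroup)
    renaming ( +ᴹ-congˡ to ⊕-congˡ; +ᴹ-congʳ to ⊕-congʳ
             ; *ₗ-congˡ to ·-congˡ; *ₗ-congʳ to ·-congʳ
             ; *ₗ-zeroʳ to ·-zeroʳ; +ᴹ-identityʳ to ⊕-identityʳ
             ; -ᴹ‿inverseʳ to ⊖-inverseʳ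
             ; -ᴹ‿cong to ⊖-cong )
  open ModuleLemmas F Λ-module public
    renaming (*ₗ-neg to ·-⊖; *ₗ-comm to ·-comm; sum-*ₗ to sum-·;
              sum-+ to sum-⊕)
  open GroupSolver +ᴹ-abelianGroup public using (solve; var; :0; _:+_; :-_)
  open SetoidReasoning ≈ᴹ-setoid

  v₀ : ∀ {n} → GroupSolver.Expr +ᴹ-abelianGroup (suc n)
  v₀ = var zero
  v₁ : ∀ {n} → GroupSolver.Expr +ᴹ-abelianGroup (suc (suc n))
  v₁ = var (suc zero)
  v₂ : ∀ {n} → GroupSolver.Expr +ᴹ-abelianGroup (suc (suc (suc n)))
  v₂ = var (suc (suc zero))
  v₃ : ∀ {n} → GroupSolver.Expr +ᴹ-abelianGroup (suc (suc (suc (suc n))))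
  v₃ = var (suc (suc (suc zero)))

  Endo : (Λ → Λ) → Set (c ⊔ ℓ ⊔ w)
  Endo = IsLinear Λ-module Λ-module

  id-linear : Endo (λ x → x)
  id-linear = record
    { cong = λ p → p ; +-homo = λ _ _ → ∼-refl ; *-homo = λ _ _ → ∼-refl }

  ∘-linear : ∀ {f g} → Endo f → Endo g → Endo (f ∘ g)
  ∘-linear f g = record
    { cong   = f.cong ∘ g.cong
    ; +-homo = λ x y → ∼-trans (f.cong (g.+-homo x y)) (f.+-homo _ _)
    ; *-homo = λ r x → ∼-trans (f.cong (g.*-homo r x)) (f.*-homo _ _)
    }
    where
    module f = IsLinear f
    module g = IsLinear g

  ⊕-linear : ∀ {f g} → Endo f → Endo g → Endo (λ x → f x ⊕ g x)
  ⊕-linear {f} {g} F G = record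
    { cong   = λ p → ⊕-cong (F.cong p) (G.cong p)
    ; +-homo = λ x y → ∼-trans (⊕-cong (F.+-homo x y) (G.+-homo x y))
        (solve (f x ∷ f y ∷ g x ∷ g y ∷ [])
          ((v₀ :+ v₁) :+ (v₂ :+ v₃)) ((v₀ :+ v₂) :+ (v₁ :+ v₃)) ≡.refl)
    ; *-homo = λ r x → ∼-trans (⊕-cong (F.*-homo r x) (G.*-homo r x))
        (∼-sym (·-distribˡ r _ _))
    }
    where
    module F = IsLinear F
    module G = IsLinear G

  ·-linear : ∀ r {f} → Endo f → Endo (λ x → r · f x)
  ·-linear r F = record
    { cong   = λ p → ·-congˡ (F.cong p)
    ; +-homo = λ x y → ∼-trans (·-congˡ (F.+-homo x y)) (·-distribˡ r _ _)
    ; *-homo = λ s x → ∼-trans (·-congˡ (F.*-homo s x)) (·-comm r s _)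
    }
    where module F = IsLinear F

  e-linear : ∀ u → Endo (e u)
  e-linear u = record { cong = e-cong ; +-homo = e-⊕ u ; *-homo = e-· u }

  e-𝟘 : ∀ u → e u 𝟘 ∼ 𝟘
  e-𝟘 u = IsLinear.0-homo (e-linear u)

  mono : List W → Λ
  mono = foldr e 𝟙

  e⋆ : List W → Λ → Λ
  e⋆ ρ x = foldr e x ρ

  e⋆-linear : ∀ ρ → Endo (e⋆ ρ)
  e⋆-linear []      = id-linear
  e⋆-linear (u ∷ ρ) = ∘-linear (e-linear u) (e⋆-linear ρ)

  ι : (W → Carrier) → Λ → Λ
  ι f 𝟙       = 𝟘
  ι f (e u x) = f u · x ⊕ ⊖ e u (ι f x)
  ι f 𝟘       = 𝟘
  ι f (x ⊕ y) = ι f x ⊕ ι f y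
  ι f (r · x) = r · ι f x

  ι-cong : ∀ f {x y} → x ∼ y → ι f x ∼ ι f y
  ι-cong f ∼-refl             = ∼-refl
  ι-cong f (∼-sym p)          = ∼-sym (ι-cong f p)
  ι-cong f (∼-trans p q)      = ∼-trans (ι-cong f p) (ι-cong f q)
  ι-cong f (⊕-cong p q)       = ⊕-cong (ι-cong f p) (ι-cong f q)
  ι-cong f (·-cong r≈s p)     = ·-cong r≈s (ι-cong f p)
  ι-cong f (⊕-assoc x y z)    = ⊕-assoc _ _ _
  ι-cong f (⊕-comm x y)       = ⊕-comm _ _
  ι-cong f (⊕-identityˡ x)    = ⊕-identityˡ _
  ι-cong f (·-zeroˡ x)        = ·-zeroˡ _
  ι-cong f (·-identityˡ x)    = ·-identityˡ _
  ι-cong f (·-assoc r s x)    = ·-assoc r s _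
  ι-cong f (·-distribʳ x r s) = ·-distribʳ _ r s
  ι-cong f (·-distribˡ r x y) = ·-distribˡ r _ _
  ι-cong f (e-cong p)         = ⊕-cong (·-congˡ p) (⊖-cong (e-cong (ι-cong f p)))
  ι-cong f (e-⊕ u x y)        = ∼-trans
    (⊕-cong (·-distribˡ (f u) x y) (⊖-cong (e-⊕ u _ _)))
    (solve (f u · x ∷ f u · y ∷ e u (ι f x) ∷ e u (ι f y) ∷ [])
      ((v₀ :+ v₁) :+ :- (v₂ :+ v₃)) ((v₀ :+ :- v₂) :+ (v₁ :+ :- v₃)) ≡.refl)
  ι-cong f (e-· u r x)        = ∼-trans
    (⊕-cong (·-comm (f u) r x) (∼-trans (⊖-cong (e-· u r _)) (·-comm (- 1#) r _)))
    (∼-sym (·-distribˡ r _ _))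
  ι-cong f (e-anti u v x)     = begin
    f u · e v x ⊕ ⊖ e u (f v · x ⊕ ⊖ e v (ι f x))
      ≈⟨ ⊕-congˡ (⊖-cong (expand u v)) ⟩
    f u · e v x ⊕ ⊖ (f v · e u x ⊕ ⊖ e u (e v (ι f x)))
      ≈⟨ ⊕-congˡ (⊖-cong (⊕-congˡ (⊖-cong (e-anti u v _)))) ⟩
    f u · e v x ⊕ ⊖ (f v · e u x ⊕ ⊖ (⊖ e v (e u (ι f x))))
      ≈⟨ solve (f u · e v x ∷ f v · e u x ∷ e v (e u (ι f x)) ∷ [])
           (v₀ :+ :- (v₁ :+ :- (:- v₂))) (:- (v₁ :+ :- (v₀ :+ :- v₂))) ≡.refl ⟩
    ⊖ (f v · e u x ⊕ ⊖ (f u · e v x ⊕ ⊖ e v (e u (ι f x))))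
      ≈⟨ ⊖-cong (⊕-congˡ (⊖-cong (expand v u))) ⟨
    ⊖ (f v · e u x ⊕ ⊖ e v (f u · x ⊕ ⊖ e u (ι f x))) ∎
    where
    expand : ∀ u v → e u (f v · x ⊕ ⊖ e v (ι f x)) ∼
                     f v · e u x ⊕ ⊖ e u (e v (ι f x))
    expand u v = ∼-trans (e-⊕ u _ _) (⊕-cong (e-· u _ _) (e-· u _ _))
  ι-cong f (e-square u x)     = begin
    f u · e u x ⊕ ⊖ e u (f u · x ⊕ ⊖ e u (ι f x))
      ≈⟨ ⊕-congˡ (⊖-cong (∼-trans (e-⊕ u _ _) (⊕-cong (e-· u _ _)
           (∼-trans (e-· u _ _) (∼-trans (⊖-cong (e-square u _)) (·-zeroʳ _)))))) ⟩
    f u · e u x ⊕ ⊖ (f u · e u x ⊕ 𝟘)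
      ≈⟨ solve (f u · e u x ∷ []) (v₀ :+ :- (v₀ :+ :0)) :0 ≡.refl ⟩
    𝟘 ∎

  ι-linear : ∀ f → Endo (ι f)
  ι-linear f = record
    { cong = ι-cong f ; +-homo = λ _ _ → ∼-refl ; *-homo = λ _ _ → ∼-refl }

  -- Both contractions are antiderivations of odd degree. Applied to `∂` and `δ u`, this says that
  -- stripping an index preserves cycles.
  ι-anti : ∀ f g x → ι f (ι g x) ∼ ⊖ ι g (ι f x)
  ι-anti f g 𝟙       = ∼-sym (·-zeroʳ _)
  ι-anti f g 𝟘       = ∼-sym (·-zeroʳ _)
  ι-anti f g (x ⊕ y) = ∼-trans (⊕-cong (ι-anti f g x) (ι-anti f g y))
    (∼-sym (·-distribˡ _ _ _))
  ι-anti f g (r · x) = ∼-trans (·-congˡ (ι-anti f g x)) (·-comm r _ _)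
  ι-anti f g (e u x) = begin
    g u · ι f x ⊕ ⊖ (f u · ι g x ⊕ ⊖ e u (ι f (ι g x)))
      ≈⟨ ⊕-congˡ (⊖-cong (⊕-congˡ (⊖-cong
           (∼-trans (e-cong (ι-anti f g x)) (e-· u _ _))))) ⟩
    g u · ι f x ⊕ ⊖ (f u · ι g x ⊕ ⊖ (⊖ e u (ι g (ι f x))))
      ≈⟨ solve (g u · ι f x ∷ f u · ι g x ∷ e u (ι g (ι f x)) ∷ [])
           (v₀ :+ :- (v₁ :+ :- (:- v₂))) (:- (v₁ :+ :- (v₀ :+ :- v₂))) ≡.refl ⟩
    ⊖ (f u · ι g x ⊕ ⊖ (g u · ι f x ⊕ ⊖ e u (ι g (ι f x)))) ∎

  -- Proved separately, since `ι-anti` for `f = g` only shows that twice the element is zero, which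
  -- is void in characteristic 2.
  ι-square : ∀ f x → ι f (ι f x) ∼ 𝟘
  ι-square f 𝟙       = ∼-refl
  ι-square f 𝟘       = ∼-refl
  ι-square f (x ⊕ y) = ∼-trans (⊕-cong (ι-square f x) (ι-square f y)) (⊕-identityˡ _)
  ι-square f (r · x) = ∼-trans (·-congˡ (ι-square f x)) (·-zeroʳ r)
  ι-square f (e u x) = begin
    f u · ι f x ⊕ ⊖ (f u · ι f x ⊕ ⊖ e u (ι f (ι f x)))
      ≈⟨ ⊕-congˡ (⊖-cong (⊕-congˡ (⊖-cong (∼-trans (e-cong (ι-square f x)) (e-𝟘 u))))) ⟩
    f u · ι f x ⊕ ⊖ (f u · ι f x ⊕ ⊖ 𝟘)
      ≈⟨ solve (f u · ι f x ∷ []) (v₀ :+ :- (v₀ :+ :- :0)) :0 ≡.refl ⟩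
    𝟘 ∎

  ∂ : Λ → Λ
  ∂ = ι (λ _ → 1#)

  ∂-linear : Endo ∂
  ∂-linear = ι-linear _

  ∂-e : ∀ u x → ∂ (e u x) ∼ x ⊕ ⊖ e u (∂ x)
  ∂-e u x = ⊕-congʳ (·-identityˡ x)

  δ : W → W → Carrier
  δ u v with v ≟ u
  ... | yes _ = 1#
  ... | no  _ = 0#

  kill : W → Λ → Λ
  kill u 𝟙       = 𝟙
  kill u (e v x) with v ≟ u
  ... | yes _ = 𝟘
  ... | no  _ = e v (kill u x)
  kill u 𝟘       = 𝟘
  kill u (x ⊕ y) = kill u x ⊕ kill u y
  kill u (r · x) = r · kill u x

  kill-cong : ∀ u {x y} → x ∼ y → kill u x ∼ kill u y
  kill-cong u ∼-refl             = ∼-refl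
  kill-cong u (∼-sym p)          = ∼-sym (kill-cong u p)
  kill-cong u (∼-trans p q)      = ∼-trans (kill-cong u p) (kill-cong u q)
  kill-cong u (⊕-cong p q)       = ⊕-cong (kill-cong u p) (kill-cong u q)
  kill-cong u (·-cong r≈s p)     = ·-cong r≈s (kill-cong u p)
  kill-cong u (⊕-assoc x y z)    = ⊕-assoc _ _ _
  kill-cong u (⊕-comm x y)       = ⊕-comm _ _
  kill-cong u (⊕-identityˡ x)    = ⊕-identityˡ _
  kill-cong u (·-zeroˡ x)        = ·-zeroˡ _
  kill-cong u (·-identityˡ x)    = ·-identityˡ _
  kill-cong u (·-assoc r s x)    = ·-assoc r s _
  kill-cong u (·-distribʳ x r s) = ·-distribʳ _ r s
  kill-cong u (·-distribˡ r x y) = ·-distribˡ r _ _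
  kill-cong u (e-cong {v} p) with v ≟ u
  ... | yes _ = ∼-refl
  ... | no  _ = e-cong (kill-cong u p)
  kill-cong u (e-⊕ v x y) with v ≟ u
  ... | yes _ = ∼-sym (⊕-identityˡ 𝟘)
  ... | no  _ = e-⊕ v _ _
  kill-cong u (e-· v r x) with v ≟ u
  ... | yes _ = ∼-sym (·-zeroʳ r)
  ... | no  _ = e-· v r _
  kill-cong u (e-anti v v′ x) with v ≟ u
  kill-cong u (e-anti v v′ x) | yes p with v′ ≟ u
  ... | yes _ = ∼-sym (·-zeroʳ _)
  ... | no  _ with v ≟ u
  ...   | yes _ = ∼-sym (∼-trans (⊖-cong (e-𝟘 v′)) (·-zeroʳ _))
  ...   | no ¬p = contradiction p ¬p
  kill-cong u (e-anti v v′ x) | no ¬p with v′ ≟ u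
  ... | yes _ = ∼-trans (e-𝟘 v) (∼-sym (·-zeroʳ _))
  ... | no  _ with v ≟ u
  ...   | yes p = contradiction p ¬p
  ...   | no  _ = e-anti v v′ _
  kill-cong u (e-square v x) with v ≟ u
  ... | yes _ = ∼-refl
  ... | no ¬p with v ≟ u
  ...   | yes p = contradiction p ¬p
  ...   | no  _ = e-square v _

  kill-linear : ∀ u → Endo (kill u)
  kill-linear u = record
    { cong = kill-cong u ; +-homo = λ _ _ → ∼-refl ; *-homo = λ _ _ → ∼-refl }

  kill-e : ∀ u v x → v ≢ u → kill u (e v x) ∼ e v (kill u x)
  kill-e u v x v≢u with v ≟ u
  ... | yes v≡u = contradiction v≡u v≢u
  ... | no  _   = ∼-refl

  -- Write x = a + u ∧ b with a and b free of u. Then `kill u x` is a, and the contraction with the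
  -- dual functional of u is b.
  kill-split : ∀ u x → x ∼ kill u x ⊕ e u (ι (δ u) x)
  kill-split u 𝟙       = ∼-sym (∼-trans (⊕-congˡ (e-𝟘 u)) (⊕-identityʳ 𝟙))
  kill-split u 𝟘       = ∼-sym (∼-trans (⊕-congˡ (e-𝟘 u)) (⊕-identityʳ 𝟘))
  kill-split u (x ⊕ y) = ∼-trans (⊕-cong (kill-split u x) (kill-split u y))
    (∼-sym (IsLinear.+-homo
      (⊕-linear (kill-linear u) (∘-linear (e-linear u) (ι-linear (δ u)))) x y))
  kill-split u (r · x) = ∼-trans (·-congˡ (kill-split u x))
    (∼-sym (IsLinear.*-homo
      (⊕-linear (kill-linear u) (∘-linear (e-linear u) (ι-linear (δ u)))) r x))
  kill-split u (e v x) with v ≟ u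
  ... | yes ≡.refl = ∼-sym (begin
    𝟘 ⊕ e u (1# · x ⊕ ⊖ e u (ι (δ u) x))
      ≈⟨ ⊕-identityˡ _ ⟩
    e u (1# · x ⊕ ⊖ e u (ι (δ u) x))
      ≈⟨ ∼-trans (e-⊕ u _ _) (⊕-cong (e-cong (·-identityˡ x)) (e-· u _ _)) ⟩
    e u x ⊕ ⊖ e u (e u (ι (δ u) x))
      ≈⟨ ⊕-congˡ (∼-trans (⊖-cong (e-square u _)) (·-zeroʳ _)) ⟩
    e u x ⊕ 𝟘
      ≈⟨ ⊕-identityʳ _ ⟩
    e u x ∎)
  ... | no _ = begin
    e v x
      ≈⟨ e-cong (kill-split u x) ⟩
    e v (kill u x ⊕ e u (ι (δ u) x))
      ≈⟨ ∼-trans (e-⊕ v _ _) (⊕-congˡ (e-anti v u _)) ⟩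
    e v (kill u x) ⊕ ⊖ e u (e v (ι (δ u) x))
      ≈⟨ ⊕-congˡ (e-· u _ _) ⟨
    e v (kill u x) ⊕ e u (⊖ e v (ι (δ u) x))
      ≈⟨ ⊕-congˡ (e-cong (∼-trans (⊕-congʳ (·-zeroˡ x)) (⊕-identityˡ _))) ⟨
    e v (kill u x) ⊕ e u (0# · x ⊕ ⊖ e v (ι (δ u) x)) ∎

  -- The augmentation. On a component that is a multiple of `𝟙` it reads off the scalar.
  ε : Λ → Carrier
  ε 𝟙       = 1#
  ε (e u x) = 0#
  ε 𝟘       = 0#
  ε (x ⊕ y) = ε x R.+ ε y
  ε (r · x) = r * ε x

  ε-cong : ∀ {x y} → x ∼ y → ε x ≈ ε y
  ε-cong ∼-refl             = R.refl
  ε-cong (∼-sym p)          = R.sym (ε-cong p)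
  ε-cong (∼-trans p q)      = R.trans (ε-cong p) (ε-cong q)
  ε-cong (⊕-cong p q)       = R.+-cong (ε-cong p) (ε-cong q)
  ε-cong (·-cong r≈s p)     = R.*-cong r≈s (ε-cong p)
  ε-cong (⊕-assoc x y z)    = R.+-assoc _ _ _
  ε-cong (⊕-comm x y)       = R.+-comm _ _
  ε-cong (⊕-identityˡ x)    = R.+-identityˡ _
  ε-cong (·-zeroˡ x)        = R.zeroˡ _
  ε-cong (·-identityˡ x)    = R.*-identityˡ _
  ε-cong (·-assoc r s x)    = R.*-assoc r s _
  ε-cong (·-distribʳ x r s) = R.distribʳ _ r s
  ε-cong (·-distribˡ r x y) = R.distribˡ r _ _
  ε-cong (e-cong p)         = R.refl
  ε-cong (e-⊕ u x y)        = R.sym (R.+-identityˡ 0#)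
  ε-cong (e-· u r x)        = R.sym (R.zeroʳ r)
  ε-cong (e-anti u v x)     = R.sym (R.zeroʳ _)
  ε-cong (e-square u x)     = R.refl

  module _ {m ℓm : Level} (M : VectorSpace F m ℓm) where

    open LeftModule M hiding (≈ᴹ-setoid)

    record Alternating (g : List W → Carrierᴹ) : Set (w ⊔ ℓm) where
      field
        swaps   : ∀ ρ {u v τ} →
                  g (ρ ++ u ∷ v ∷ τ) ≈ᴹ (- 1#) *ₗ g (ρ ++ v ∷ u ∷ τ)
        repeats : ∀ ρ {u τ} → g (ρ ++ u ∷ u ∷ τ) ≈ᴹ 0ᴹ

    -- The universal property of the exterior algebra. Leading letters are absorbed into `g`, hence
    -- the arbitrary prefix `ρ` in `Alternating`.
    extend : (List W → Carrierᴹ) → Λ → Carrierᴹ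
    extend g 𝟙       = g []
    extend g (e u x) = extend (g ∘ (u ∷_)) x
    extend g 𝟘       = 0ᴹ
    extend g (x ⊕ y) = extend g x +ᴹ extend g y
    extend g (r · x) = r *ₗ extend g x

    private
      module L = ModuleLemmas F M

      prefix : ∀ {g} u → Alternating g → Alternating (g ∘ (u ∷_))
      prefix u alt = record
        { swaps   = λ ρ → Alternating.swaps alt (u ∷ ρ)
        ; repeats = λ ρ → Alternating.repeats alt (u ∷ ρ)
        }

      extend-neg : ∀ {g h} → (∀ τ → g τ ≈ᴹ (- 1#) *ₗ h τ) →
                   ∀ x → extend g x ≈ᴹ (- 1#) *ₗ extend h x
      extend-neg p 𝟙       = p []
      extend-neg p (e u x) = extend-neg (p ∘ (u ∷_)) x
      extend-neg p 𝟘       = ≈ᴹ-sym (*ₗ-zeroʳ _)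
      extend-neg p (x ⊕ y) = ≈ᴹ-trans (+ᴹ-cong (extend-neg p x) (extend-neg p y))
        (≈ᴹ-sym (*ₗ-distribˡ _ _ _))
      extend-neg p (r · x) = ≈ᴹ-trans (*ₗ-congˡ (extend-neg p x)) (L.*ₗ-comm r _ _)

      extend-0 : ∀ {g} → (∀ τ → g τ ≈ᴹ 0ᴹ) → ∀ x → extend g x ≈ᴹ 0ᴹ
      extend-0 p 𝟙       = p []
      extend-0 p (e u x) = extend-0 (p ∘ (u ∷_)) x
      extend-0 p 𝟘       = ≈ᴹ-refl
      extend-0 p (x ⊕ y) = ≈ᴹ-trans (+ᴹ-cong (extend-0 p x) (extend-0 p y))
        (+ᴹ-identityˡ _)
      extend-0 p (r · x) = ≈ᴹ-trans (*ₗ-congˡ (extend-0 p x)) (*ₗ-zeroʳ r)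

    extend-cong : ∀ {g x y} → Alternating g → x ∼ y → extend g x ≈ᴹ extend g y
    extend-cong alt ∼-refl             = ≈ᴹ-refl
    extend-cong alt (∼-sym p)          = ≈ᴹ-sym (extend-cong alt p)
    extend-cong alt (∼-trans p q)      = ≈ᴹ-trans (extend-cong alt p) (extend-cong alt q)
    extend-cong alt (⊕-cong p q)       = +ᴹ-cong (extend-cong alt p) (extend-cong alt q)
    extend-cong alt (·-cong r≈s p)     = *ₗ-cong r≈s (extend-cong alt p)
    extend-cong alt (⊕-assoc x y z)    = +ᴹ-assoc _ _ _
    extend-cong alt (⊕-comm x y)       = +ᴹ-comm _ _
    extend-cong alt (⊕-identityˡ x)    = +ᴹ-identityˡ _
    extend-cong alt (·-zeroˡ x)        = *ₗ-zeroˡ _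
    extend-cong alt (·-identityˡ x)    = *ₗ-identityˡ _
    extend-cong alt (·-assoc r s x)    = *ₗ-assoc r s _
    extend-cong alt (·-distribʳ x r s) = *ₗ-distribʳ _ r s
    extend-cong alt (·-distribˡ r x y) = *ₗ-distribˡ r _ _
    extend-cong alt (e-cong {u} p)     = extend-cong (prefix u alt) p
    extend-cong alt (e-⊕ u x y)        = ≈ᴹ-refl
    extend-cong alt (e-· u r x)        = ≈ᴹ-refl
    extend-cong alt (e-anti u v x)     =
      extend-neg (λ τ → Alternating.swaps alt []) x
    extend-cong alt (e-square u x)     =
      extend-0 (λ τ → Alternating.repeats alt []) x

    extend-linear : ∀ {g} → Alternating g → IsLinear Λ-module M (extend g)
    extend-linear alt = record
      { cong   = extend-cong alt
      ; +-homo = λ _ _ → ≈ᴹ-refl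
      ; *-homo = λ _ _ → ≈ᴹ-refl
      }

    extend-mono : ∀ g τ → extend g (mono τ) ≡ g τ
    extend-mono g []      = ≡.refl
    extend-mono g (u ∷ τ) = extend-mono (g ∘ (u ∷_)) τ

  mono-alternating : Alternating Λ-module mono
  mono-alternating = record { swaps = swaps ; repeats = repeats }
    where
    swaps : ∀ ρ {u v τ} → mono (ρ ++ u ∷ v ∷ τ) ∼ ⊖ mono (ρ ++ v ∷ u ∷ τ)
    swaps []      = e-anti _ _ _
    swaps (x ∷ ρ) = ∼-trans (e-cong (swaps ρ)) (e-· x _ _)

    repeats : ∀ ρ {u τ} → mono (ρ ++ u ∷ u ∷ τ) ∼ 𝟘
    repeats []      = e-square _ _
    repeats (x ∷ ρ) = ∼-trans (e-cong (repeats ρ)) (e-𝟘 x)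

  -- The span of the words in `Q`, which serves as the chain space of a subcomplex. Elements of `Λ`
  -- are representatives only, hence `resp`.
  data Supp {q : Level} (Q : List W → Set q) : Λ → Set (q ⊔ c ⊔ ℓ ⊔ w) where
    basis : ∀ τ → Q τ → Supp Q (mono τ)
    𝟘     : Supp Q 𝟘
    _⊕_   : ∀ {x y} → Supp Q x → Supp Q y → Supp Q (x ⊕ y)
    _·_   : ∀ r {x} → Supp Q x → Supp Q (r · x)
    resp  : ∀ {x y} → x ∼ y → Supp Q x → Supp Q y

  module _ {q : Level} {Q : List W → Set q} where

    supp-subspace : IsSubspace Λ-module (Supp Q)
    supp-subspace = record { 0-closed = 𝟘 ; +-closed = _⊕_ ; *-closed = _·_ }

    supp-sum : ∀ {n} {f : Fin n → Λ} → (∀ i → Supp Q (f i)) → Supp Q (sum {n} f)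
    supp-sum {n} = IsSubspace.sum-closed supp-subspace {n}

    supp-map : ∀ {q′} {Q′ : List W → Set q′} {f} → Endo f →
               (∀ τ → Q τ → Supp Q′ (f (mono τ))) → ∀ {x} → Supp Q x → Supp Q′ (f x)
    supp-map F h (basis τ Qτ)  = h _ Qτ
    supp-map F h 𝟘          = resp (∼-sym (IsLinear.0-homo F)) 𝟘
    supp-map F h (x ⊕ y)    =
      resp (∼-sym (IsLinear.+-homo F _ _)) (supp-map F h x ⊕ supp-map F h y)
    supp-map F h (r · x)    = resp (∼-sym (IsLinear.*-homo F r _)) (r · supp-map F h x)
    supp-map F h (resp p x) = resp (IsLinear.cong F p) (supp-map F h x)

    supp-⊆ : ∀ {q′} {Q′ : List W → Set q′} → (∀ τ → Q τ → Q′ τ) →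
             ∀ {x} → Supp Q x → Supp Q′ x
    supp-⊆ h = supp-map id-linear (λ τ → basis _ ∘ h τ)

    supp-equal : ∀ {m ℓm} {M : VectorSpace F m ℓm} (let open LeftModule M) {f g} →
                 IsLinear Λ-module M f → IsLinear Λ-module M g →
                 (∀ τ → Q τ → f (mono τ) ≈ᴹ g (mono τ)) →
                 ∀ {x} → Supp Q x → f x ≈ᴹ g x
    supp-equal {M = M} F G h = go
      where
      open LeftModule M
      go : ∀ {x} → Supp Q x → _ ≈ᴹ _
      go (basis τ Qτ)  = h _ Qτ
      go 𝟘          = ≈ᴹ-trans (IsLinear.0-homo F) (≈ᴹ-sym (IsLinear.0-homo G))
      go (x ⊕ y)    = ≈ᴹ-trans (IsLinear.+-homo F _ _)
        (≈ᴹ-trans (+ᴹ-cong (go x) (go y)) (≈ᴹ-sym (IsLinear.+-homo G _ _)))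
      go (r · x)    = ≈ᴹ-trans (IsLinear.*-homo F r _)
        (≈ᴹ-trans (*ₗ-congˡ (go x)) (≈ᴹ-sym (IsLinear.*-homo G r _)))
      go (resp p x) = ≈ᴹ-trans (IsLinear.cong F (∼-sym p))
        (≈ᴹ-trans (go x) (IsLinear.cong G p))

    supp-empty : (∀ τ → ¬ Q τ) → ∀ {x} → Supp Q x → x ∼ 𝟘
    supp-empty ¬Q (basis τ Qτ)  = contradiction Qτ (¬Q _)
    supp-empty ¬Q 𝟘          = ∼-refl
    supp-empty ¬Q (x ⊕ y)    =
      ∼-trans (⊕-cong (supp-empty ¬Q x) (supp-empty ¬Q y)) (⊕-identityˡ 𝟘)
    supp-empty ¬Q (r · x)    = ∼-trans (·-congˡ (supp-empty ¬Q x)) (·-zeroʳ r)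
    supp-empty ¬Q (resp p x) = ∼-trans (∼-sym p) (supp-empty ¬Q x)

    supp-e : ∀ {q′} {Q′ : List W → Set q′} u → (∀ τ → Q τ → Q′ (u ∷ τ)) →
             ∀ {x} → Supp Q x → Supp Q′ (e u x)
    supp-e u h = supp-map (e-linear u) (λ τ → basis _ ∘ h τ)

  -- A contraction deletes one letter with a sign. Recording the face up to permutation makes the
  -- position irrelevant. `P` collects the letters on which `f` may be nonzero: all of them for `∂`,
  -- only `u` for `δ u`.
  ι-mono : ∀ {p} {P : W → Set p} f → (∀ u → P u ⊎ (f u ≈ 0#)) →
           ∀ τ → Supp (λ τ′ → ∃[ u ] P u × u ∷ τ′ ↭ τ) (ι f (mono τ))
  ι-mono f P? []      = 𝟘
  ι-mono {P = P} f P? (u ∷ τ) = head (P? u) ⊕ (- 1#) ·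
    supp-e u (λ _ (v , Pv , p) → v , Pv , ↭-trans (swap v u ↭-refl) (prep u p))
      (ι-mono f P? τ)
    where
    head : P u ⊎ (f u ≈ 0#) → Supp (λ τ′ → ∃[ v ] P v × v ∷ τ′ ↭ u ∷ τ) (f u · mono τ)
    head (inj₁ Pu)  = f u · basis τ (u , Pu , ↭-refl)
    head (inj₂ f≈0) = resp (∼-sym (∼-trans (·-congʳ f≈0) (·-zeroˡ _))) 𝟘

  module _ {q : Level} {Q : List W → Set q} where

    supp-∂ : ∀ {q′} {Q′ : List W → Set q′} →
             (∀ u τ τ′ → Q τ → u ∷ τ′ ↭ τ → Q′ τ′) →
             ∀ {x} → Supp Q x → Supp Q′ (∂ x)
    supp-∂ h = supp-map ∂-linear λ τ Qτ →
      supp-⊆ (λ τ′ (u , _ , p) → h u τ τ′ Qτ p) (ι-mono {P = λ _ → ⊤ {w}} _ (λ _ → inj₁ tt) τ)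

    supp-ι : ∀ {q′} {Q′ : List W → Set q′} u →
             (∀ τ τ′ → Q τ → u ∷ τ′ ↭ τ → Q′ τ′) →
             ∀ {x} → Supp Q x → Supp Q′ (ι (δ u) x)
    supp-ι u h = supp-map (ι-linear _) λ τ Qτ →
      supp-⊆ (λ { τ′ (_ , ≡.refl , p) → h τ τ′ Qτ p }) (ι-mono _ dec τ)
      where
      dec : ∀ v → v ≡ u ⊎ (δ u v ≈ 0#)
      dec v with v ≟ u
      ... | yes v≡u = inj₁ v≡u
      ... | no  _   = inj₂ R.refl

    supp-kill : ∀ u {x} → Supp Q x → Supp (λ τ → Q τ × u ∉ τ) (kill u x)
    supp-kill u = supp-map (kill-linear u) λ τ Qτ →
      supp-⊆ (λ { _ (≡.refl , u∉τ) → Qτ , u∉τ }) (kill-mono τ)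
      where
      kill-mono : ∀ τ → Supp (λ τ′ → τ′ ≡ τ × u ∉ τ′) (kill u (mono τ))
      kill-mono []      = basis [] (≡.refl , λ ())
      kill-mono (v ∷ τ) with v ≟ u
      ... | yes _   = 𝟘
      ... | no  v≢u = supp-e v
        (λ { _ (≡.refl , u∉τ) → ≡.refl , λ { (here p) → v≢u (≡.sym p) ; (there q) → u∉τ q } })
        (kill-mono τ)

    kill-id : ∀ u → (∀ τ → Q τ → u ∉ τ) → ∀ {x} → Supp Q x → kill u x ∼ x
    kill-id u h = supp-equal (kill-linear u) id-linear (λ τ Qτ → go τ (h τ Qτ))
      where
      go : ∀ τ → u ∉ τ → kill u (mono τ) ∼ mono τ
      go []      u∉τ = ∼-refl
      go (v ∷ τ) u∉τ = ∼-trans (kill-e u v _ (λ p → u∉τ (here (≡.sym p))))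
        (e-cong (go τ (u∉τ ∘ there)))

-- Oriented chains inside the exterior algebra

-- The chains of a complex on U embed into the exterior algebra on any W ⊇ U.
module Embedding
  (em : ∀ {a} → ExcludedMiddle a)
  {c ℓ w : Level} (F : Field c ℓ) (W : Set w) (_≟_ : DecidableEquality W)
  {u p : Level} {U : Set u} (j : U → W) (j⁻¹ : W → Maybe U) (j⁻¹∘j : ∀ x → j⁻¹ (j x) ≡ just x)
  (K : SimplicialComplex U p)
  where

  open Exterior F W _≟_
  private
    module K = ChainComplex F K
    open K using (Chain; gen; 𝟘; _⊕_; _·_; Spans; chains)
    module K-module {n} = LeftModule (chains n)

  flatten : ∀ {n} → Vec U n → List W
  flatten τ = map j (toList τ)

  embed : ∀ {n} → Chain n → Λ
  embed (gen τ _) = mono (flatten τ)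
  embed 𝟘         = 𝟘
  embed (x ⊕ y)   = embed x ⊕ embed y
  embed (r · x)   = r · embed x

  private
    mono-swap : ∀ {n} {τ τ′ : Vec U n} → AdjacentSwap τ τ′ →
                mono (flatten τ) ∼ ⊖ mono (flatten τ′)
    mono-swap here      = e-anti _ _ _
    mono-swap (there s) = ∼-trans (e-cong (mono-swap s)) (e-· _ _ _)

    mono-repeat : ∀ {n} {τ : Vec U n} → AdjacentRepeat τ → mono (flatten τ) ∼ 𝟘
    mono-repeat here      = e-square _ _
    mono-repeat (there r) = ∼-trans (e-cong (mono-repeat r)) (e-𝟘 _)

  embed-cong : ∀ {n} {x y : Chain n} → x K.∼ y → embed x ∼ embed y
  embed-cong K.∼-refl             = ∼-refl
  embed-cong (K.∼-sym p)          = ∼-sym (embed-cong p)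
  embed-cong (K.∼-trans p q)      = ∼-trans (embed-cong p) (embed-cong q)
  embed-cong (K.⊕-cong p q)       = ⊕-cong (embed-cong p) (embed-cong q)
  embed-cong (K.·-cong r≈s p)     = ·-cong r≈s (embed-cong p)
  embed-cong (K.⊕-assoc x y z)    = ⊕-assoc _ _ _
  embed-cong (K.⊕-comm x y)       = ⊕-comm _ _
  embed-cong (K.⊕-identityˡ x)    = ⊕-identityˡ _
  embed-cong (K.·-zeroˡ x)        = ·-zeroˡ _
  embed-cong (K.·-identityˡ x)    = ·-identityˡ _
  embed-cong (K.·-assoc r s x)    = ·-assoc r s _
  embed-cong (K.·-distribʳ x r s) = ·-distribʳ _ r s
  embed-cong (K.·-distribˡ r x y) = ·-distribˡ r _ _
  embed-cong (K.gen-cong s t)     = ∼-refl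
  embed-cong (K.gen-swap w s t)   = mono-swap w
  embed-cong (K.gen-repeat r s)   = mono-repeat r

  private
    -- `A` stands for multiplication by the vertices already read, which all remaining faces have in
    -- common.
    embed-altSum : ∀ {n n′} {A} → Endo A → (τ : Vec U (suc n)) (f : Fin (suc n) → Chain n′) →
                   (∀ i → embed (f i) ∼ A (mono (flatten (removeAt τ i)))) →
                   embed (K.altSum f) ∼ A (∂ (mono (flatten τ)))
    embed-altSum {A = A} lin (x ∷ []) f h = begin
      embed (f zero) ⊕ ⊖ 𝟘
        ≈⟨ ∼-trans (⊕-congˡ (·-zeroʳ _)) (⊕-identityʳ _) ⟩
      embed (f zero)
        ≈⟨ h zero ⟩
      A 𝟙
        ≈⟨ IsLinear.cong lin (∼-trans (∂-e (j x) 𝟙)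
             (∼-trans (⊕-congˡ (∼-trans (⊖-cong (e-𝟘 _)) (·-zeroʳ _))) (⊕-identityʳ _))) ⟨
      A (∂ (e (j x) 𝟙)) ∎
      where open SetoidReasoning ≈ᴹ-setoid
    embed-altSum {A = A} lin (x ∷ τ@(_ ∷ _)) f h = begin
      embed (f zero) ⊕ ⊖ embed (K.altSum (f ∘ suc))
        ≈⟨ ⊕-cong (h zero) (⊖-cong
             (embed-altSum (∘-linear lin (e-linear (j x))) τ (f ∘ suc) (h ∘ suc))) ⟩
      A (mono (flatten τ)) ⊕ ⊖ A (e (j x) (∂ (mono (flatten τ))))
        ≈⟨ ⊕-congˡ (IsLinear.neg-homo lin _) ⟨
      A (mono (flatten τ)) ⊕ A (⊖ e (j x) (∂ (mono (flatten τ))))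
        ≈⟨ IsLinear.+-homo lin _ _ ⟨
      A (mono (flatten τ) ⊕ ⊖ e (j x) (∂ (mono (flatten τ))))
        ≈⟨ IsLinear.cong lin (∂-e (j x) _) ⟨
      A (∂ (mono (flatten (x ∷ τ)))) ∎
      where open SetoidReasoning ≈ᴹ-setoid

  embed-∂ : ∀ {n} (x : Chain n) → embed (K.∂ x) ∼ ∂ (embed x)
  embed-∂ {zero}  (gen [] s) = ∼-refl
  embed-∂ {suc n} (gen τ s)  = embed-altSum id-linear τ
    (λ i → gen (removeAt τ i) (K.removeAt-Spans τ i s)) (λ _ → ∼-refl)
  embed-∂ 𝟘         = ∼-refl
  embed-∂ (x ⊕ y)   = ⊕-cong (embed-∂ x) (embed-∂ y)
  embed-∂ (r · x)   = ·-congˡ (embed-∂ x)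

  Image : ℕ → List W → Set (u ⊔ w ⊔ p)
  Image n τ = Σ (Vec U n) λ σ → Spans σ × flatten σ ≡ τ

  embed-supp : ∀ {n} (x : Chain n) → Supp (Image n) (embed x)
  embed-supp (gen τ s) = basis (flatten τ) (τ , s , ≡.refl)
  embed-supp 𝟘         = 𝟘
  embed-supp (x ⊕ y)   = embed-supp x ⊕ embed-supp y
  embed-supp (r · x)   = r · embed-supp x

  embed-surjective : ∀ {n x} → Supp (Image n) x → ∃[ y ] embed {n} y ∼ x
  embed-surjective (basis _ (τ , s , ≡.refl)) = gen τ s , ∼-refl
  embed-surjective 𝟘                        = 𝟘 , ∼-refl
  embed-surjective (X ⊕ Y)                  =
    let x , p = embed-surjective X ; y , q = embed-surjective Y in x ⊕ y , ⊕-cong p q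
  embed-surjective (r · X)                  =
    let x , p = embed-surjective X in r · x , ·-congˡ p
  embed-surjective (resp p X)               =
    let x , q = embed-surjective X in x , ∼-trans q p

  private
    -- A left inverse of `flatten`, defined also on words of the wrong length or with letters
    -- outside `U`, as `extend` requires.
    parse : ∀ n → List W → Maybe (Vec U n)
    parse zero    []      = just []
    parse zero    (_ ∷ _) = nothing
    parse (suc n) []      = nothing
    parse (suc n) (x ∷ τ) = Maybe.zipWith _∷_ (j⁻¹ x) (parse n τ)

    parse-flatten : ∀ {n} (τ : Vec U n) → parse n (flatten τ) ≡ just τ
    parse-flatten []      = ≡.refl
    parse-flatten (x ∷ τ) = ≡.cong₂ (Maybe.zipWith _∷_) (j⁻¹∘j x) (parse-flatten τ)

    parse-swap : ∀ n ρ {x y τ} → Pointwise AdjacentSwap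
                   (parse n (ρ ++ x ∷ y ∷ τ)) (parse n (ρ ++ y ∷ x ∷ τ))
    parse-swap zero          []      = nothing
    parse-swap zero          (_ ∷ _) = nothing
    parse-swap (suc zero)    [] {x} {y} with j⁻¹ x | j⁻¹ y
    ... | nothing | nothing = nothing
    ... | nothing | just _  = nothing
    ... | just _  | nothing = nothing
    ... | just _  | just _  = nothing
    parse-swap (suc (suc n)) [] {x} {y} {τ} with j⁻¹ x | j⁻¹ y | parse n τ
    ... | nothing | nothing | _       = nothing
    ... | nothing | just _  | nothing = nothing
    ... | nothing | just _  | just _  = nothing
    ... | just _  | nothing | nothing = nothing
    ... | just _  | nothing | just _  = nothing
    ... | just _  | just _  | nothing = nothing
    ... | just _  | just _  | just _  = just here
    parse-swap (suc n)       (z ∷ ρ) {x} {y} {τ}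
      with j⁻¹ z | parse n (ρ ++ x ∷ y ∷ τ) | parse n (ρ ++ y ∷ x ∷ τ)
         | parse-swap n ρ {x} {y} {τ}
    ... | nothing | _       | _       | _      = nothing
    ... | just _  | nothing | nothing | _      = nothing
    ... | just _  | just _  | just _  | just s = just (there s)

    parse-repeat : ∀ n ρ {x τ} → AllMaybe AdjacentRepeat (parse n (ρ ++ x ∷ x ∷ τ))
    parse-repeat zero          []      = nothing
    parse-repeat zero          (_ ∷ _) = nothing
    parse-repeat (suc zero)    [] {x} with j⁻¹ x
    ... | nothing = nothing
    ... | just _  = nothing
    parse-repeat (suc (suc n)) [] {x} {τ} with j⁻¹ x | parse n τ
    ... | nothing | _       = nothing
    ... | just _  | nothing = nothing
    ... | just _  | just _  = just here
    parse-repeat (suc n)       (z ∷ ρ) {x} {τ}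
      with j⁻¹ z | parse n (ρ ++ x ∷ x ∷ τ) | parse-repeat n ρ {x} {τ}
    ... | nothing | _       | _      = nothing
    ... | just _  | nothing | _      = nothing
    ... | just _  | just _  | just r = just (there r)

    swap-sym : ∀ {n} {τ τ′ : Vec U n} → AdjacentSwap τ τ′ → AdjacentSwap τ′ τ
    swap-sym here      = here
    swap-sym (there s) = there (swap-sym s)

    swap-⊆ : ∀ {n} {τ τ′ : Vec U n} → AdjacentSwap τ τ′ → toList τ ⊆ toList τ′
    swap-⊆ here      (here p)          = there (here p)
    swap-⊆ here      (there (here p))  = here p
    swap-⊆ here      (there (there q)) = there (there q)
    swap-⊆ (there s) (here p)          = here p
    swap-⊆ (there s) (there q)         = there (swap-⊆ s q)

    swap-Spans : ∀ {n} {τ τ′ : Vec U n} → AdjacentSwap τ τ′ → Spans τ → Spans τ′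
    swap-Spans {τ = _ ∷ _} {τ′ = _ ∷ _} s =
      SimplicialComplex.down-closed K (swap-⊆ (swap-sym s)) (λ ())

    -- Zero outside the complex. This stays alternating because whether a tuple spans a simplex does
    -- not depend on its order.
    gen? : ∀ {n} → Maybe (Vec U n) → Chain n
    gen? nothing  = 𝟘
    gen? (just τ) with em {P = Spans τ}
    ... | yes s = gen τ s
    ... | no  _ = 𝟘

    gen?-swap : ∀ {n} {τ τ′ : Maybe (Vec U n)} → Pointwise AdjacentSwap τ τ′ →
                gen? τ K.∼ K.⊖ gen? τ′
    gen?-swap nothing = K.∼-sym (K-module.*ₗ-zeroʳ _)
    gen?-swap (just {τ} {τ′} w) with em {P = Spans τ} | em {P = Spans τ′}
    ... | yes s | yes t = K.gen-swap w s t
    ... | yes s | no ¬t = contradiction (swap-Spans w s) ¬t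
    ... | no ¬s | yes t = contradiction (swap-Spans (swap-sym w) t) ¬s
    ... | no _  | no _  = K.∼-sym (K-module.*ₗ-zeroʳ _)

    gen?-repeat : ∀ {n} {τ : Maybe (Vec U n)} → AllMaybe AdjacentRepeat τ → gen? τ K.∼ 𝟘
    gen?-repeat nothing = K.∼-refl
    gen?-repeat (just {τ} r) with em {P = Spans τ}
    ... | yes s = K.gen-repeat r s
    ... | no  _ = K.∼-refl

    alternating : ∀ n → Alternating (chains n) (gen? ∘ parse n)
    alternating n = record
      { swaps   = λ ρ → gen?-swap (parse-swap n ρ)
      ; repeats = λ ρ → gen?-repeat (parse-repeat n ρ)
      }

    retract : ∀ n → Λ → Chain n
    retract n = extend (chains n) (gen? ∘ parse n)

    retract-embed : ∀ {n} (x : Chain n) → retract n (embed x) K.∼ x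
    retract-embed {n} (gen τ s)
      rewrite extend-mono (chains n) (gen? ∘ parse n) (flatten τ) | parse-flatten τ
      with em {P = Spans τ}
    ... | yes t = K.gen-cong t s
    ... | no ¬s = contradiction s ¬s
    retract-embed 𝟘       = K.∼-refl
    retract-embed (x ⊕ y) = K.⊕-cong (retract-embed x) (retract-embed y)
    retract-embed (r · x) = K-module.*ₗ-congˡ (retract-embed x)

  -- `Λ` has more words, hence more relations, than the chains of `K`. The retraction shows that
  -- they identify nothing further.
  embed-injective : ∀ {n} {x y : Chain n} → embed x ∼ embed y → x K.∼ y
  embed-injective {n} {x} {y} p = K.∼-trans (K.∼-sym (retract-embed x))
    (K.∼-trans (extend-cong (chains n) (alternating n) p) (retract-embed y))

  Spans-list : ∀ {n} {τ : Vec U n} → Spans τ → toList τ ≡ [] ⊎ Simplex K (toList τ)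
  Spans-list {τ = []}    s = inj₁ ≡.refl
  Spans-list {τ = _ ∷ _} s = inj₂ s

  image-intro : ∀ {n} (τ : List U) → length τ ≡ n → τ ≡ [] ⊎ Simplex K τ →
                Image n (map j τ)
  image-intro τ ≡.refl s = fromList τ , spans τ s , ≡.cong (map j) (toList∘fromList τ)
    where
    spans : ∀ τ → τ ≡ [] ⊎ Simplex K τ → Spans (fromList τ)
    spans []      s        = tt
    spans (x ∷ τ) (inj₂ s) =
      ≡.subst (Simplex K) (≡.cong (x ∷_) (≡.sym (toList∘fromList τ))) s

  image-elim : ∀ {n τ} → Image n τ →
               Σ (List U) λ ρ → τ ≡ map j ρ × length ρ ≡ n × (ρ ≡ [] ⊎ Simplex K ρ)
  image-elim (σ , s , eq) = toList σ , ≡.sym eq , length-toList σ , Spans-list s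

  -- The only way in which the homological hypotheses enter the exterior algebra.
  embed-exact : ∀ {n} → IsZero (K.homologyAt n) → ∀ {y} → Supp (Image n) y → ∂ y ∼ 𝟘 →
                ∃[ x ] Supp (Image (suc n)) x × ∂ x ∼ y
  embed-exact {n} zero-homology {y} Y ∂y∼0 =
    let z , z∼y = embed-surjective Y
        x , eq  = zero-homology (z , embed-injective {pred n} {K.∂ z} {𝟘} (∼-trans (embed-∂ z)
                    (∼-trans (IsLinear.cong ∂-linear z∼y) ∂y∼0)))
    in embed x , embed-supp x , (begin
      ∂ (embed x)             ≈⟨ embed-∂ x ⟨
      embed (K.∂ x)           ≈⟨ embed-cong eq ⟨
      embed z ⊕ ⊖ 𝟘           ≈⟨ ∼-trans (⊕-congˡ (·-zeroʳ _)) (⊕-identityʳ _) ⟩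
      embed z                 ≈⟨ z∼y ⟩
      y                       ∎)
    where
    open SetoidReasoning ≈ᴹ-setoid

-- The mapping cylinder and its retraction onto the nerve

-- The double mapping cylinder of X ← blow-up → nerve, as a complex on V ⊎ Fin m: a
-- simplex is the join of a simplex of X and a set α of indices such that the simplex
-- lies in every member of α. Cyl σ is the cylinder of the subfamily σ.
module Cylinder
  (em : ∀ {a} → ExcludedMiddle a)
  {c ℓ v p : Level} (F : Field c ℓ) {V : Set v} (X : SimplicialComplex V p)
  {m : ℕ} (Γ : Fin m → Subcomplex X)
  where

  W : Set v
  W = V ⊎ Fin m

  open Exterior F W (λ _ _ → em) public
  private
    module R = Field F
    open SetoidReasoning ≈ᴹ-setoid

  lefts : List W → List V
  lefts = mapMaybe isInj₁

  rights : List W → List (Fin m)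
  rights = mapMaybe isInj₂

  _∈Γ_ : List V → Fin m → Set p
  τ ∈Γ i = Simplex (complex (Γ i)) τ

  Face : List (Fin m) → Set (v ⊔ p)
  Face α = α ≡ [] ⊎ Simplex (nerve Γ) α

  -- The empty list lies in no member of the family, hence the first case. In the second, `Any`
  -- matters when `α` is empty: the left part must still be a simplex of the union over `σ`.
  Join : List (Fin m) → List V → List (Fin m) → Set (v ⊔ p)
  Join σ τ α = (τ ≡ [] × Face α) ⊎ (Any (τ ∈Γ_) σ × All (τ ∈Γ_) α)

  Cyl : List (Fin m) → List W → Set (v ⊔ p)
  Cyl σ τ = rights τ ⊆ σ × Join σ (lefts τ) (rights τ)

  infix 5 _at_
  _at_ : ∀ {q} → (List W → Set q) → ℕ → List W → Set q
  (Q at n) τ = Q τ × length τ ≡ n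

  LeftFree : List W → Set v
  LeftFree τ = lefts τ ≡ []

  RightFree : List W → Set
  RightFree τ = rights τ ≡ []

  ∈Γ-≢[] : ∀ {τ i} → τ ∈Γ i → τ ≢ []
  ∈Γ-≢[] {i = i} τ∈i ≡.refl = SimplicialComplex.nonempty (complex (Γ i)) τ∈i

  ∈Γ-⊆ : ∀ {ρ τ i} → ρ ⊆ τ → ρ ≢ [] → τ ∈Γ i → ρ ∈Γ i
  ∈Γ-⊆ {i = i} = SimplicialComplex.down-closed (complex (Γ i))

  ∈Γ-↭ : ∀ {ρ τ i} → ρ ↭ τ → ρ ∈Γ i → τ ∈Γ i
  ∈Γ-↭ {i = i} ρ↭τ ρ∈i = ∈Γ-⊆ {i = i} (⊆-reflexive-↭ (↭-sym ρ↭τ))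
    (λ { ≡.refl → ∈Γ-≢[] {i = i} ρ∈i (↭-empty-inv ρ↭τ) }) ρ∈i

  Face-⊆ : ∀ {α β} → α ⊆ β → Face β → Face α
  Face-⊆ {[]}    α⊆β face          = inj₁ ≡.refl
  Face-⊆ {_ ∷ _} α⊆β (inj₁ ≡.refl) with () ← α⊆β (here ≡.refl)
  Face-⊆ {_ ∷ _} α⊆β (inj₂ s)      =
    inj₂ (SimplicialComplex.down-closed (nerve Γ) α⊆β (λ ()) s)

  All⇒Face : ∀ {τ α} → All (τ ∈Γ_) α → Face α
  All⇒Face {α = []}    _              = inj₁ ≡.refl
  All⇒Face {α = i ∷ _} (τ∈i ∷ τ∈α) = inj₂ ((λ ()) , _ , included (Γ i) τ∈i , τ∈i ∷ τ∈α)

  Cyl-↭ : ∀ {σ} ρ τ → ρ ↭ τ → Cyl σ ρ → Cyl σ τ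
  Cyl-↭ ρ τ ρ↭τ (⊆σ , s) = ⊆σ ∘ ⊆-reflexive-↭ (↭-sym rights↭) , go s
    where
    lefts↭  = mapMaybe-↭ isInj₁ ρ↭τ
    rights↭ = mapMaybe-↭ isInj₂ ρ↭τ
    go : _ → _
    go (inj₁ (free , face)) =
      inj₁ (↭-empty-inv (≡.subst (lefts τ ↭_) free (↭-sym lefts↭)) ,
            Face-⊆ (⊆-reflexive-↭ (↭-sym rights↭)) face)
    go (inj₂ (any , all))   =
      inj₂ (Any.map (λ {i} → ∈Γ-↭ {i = i} lefts↭) any ,
            All.map (λ {i} → ∈Γ-↭ {i = i} lefts↭) (All-resp-↭ rights↭ all))

  Cyl-∷ : ∀ {σ} u τ → Cyl σ (u ∷ τ) → Cyl σ τ
  Cyl-∷ (inj₂ i) τ (⊆σ , inj₁ (free , face)) =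
    ⊆σ ∘ there , inj₁ (free , Face-⊆ there face)
  Cyl-∷ (inj₂ i) τ (⊆σ , inj₂ (any , _ ∷ all)) = ⊆σ ∘ there , inj₂ (any , all)
  Cyl-∷ (inj₁ x) τ (⊆σ , inj₂ (any , all)) with lefts τ
  -- The last vertex of X is gone, but the simplex it formed still witnesses that the members in `α`
  -- meet.
  ... | []    = ⊆σ , inj₁ (≡.refl , All⇒Face all)
  ... | _ ∷ _ = ⊆σ , inj₂ (Any.map (λ {i} → ∈Γ-⊆ {i = i} there (λ ())) any ,
                           All.map (λ {i} → ∈Γ-⊆ {i = i} there (λ ())) all)

  Cyl-face : ∀ {σ} u τ ρ → Cyl σ τ → u ∷ ρ ↭ τ → Cyl σ ρ
  Cyl-face u τ ρ cyl ρ↭τ = Cyl-∷ u ρ (Cyl-↭ τ (u ∷ ρ) (↭-sym ρ↭τ) cyl)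

  Cyl-⊆ : ∀ {σ σ′} τ → σ ⊆ σ′ → Cyl σ τ → Cyl σ′ τ
  Cyl-⊆ τ σ⊆ (⊆σ , inj₁ s)           = σ⊆ ∘ ⊆σ , inj₁ s
  Cyl-⊆ τ σ⊆ (⊆σ , inj₂ (any , all)) = σ⊆ ∘ ⊆σ , inj₂ (Any-resp-⊆ σ⊆ any , all)

  Cyl-cone : ∀ {σ i} τ → i ∈ σ → lefts τ ∈Γ i → Cyl σ τ → Cyl σ (inj₂ i ∷ τ)
  Cyl-cone {i = i} τ i∈σ τ∈i (⊆σ , inj₁ (free , _)) =
    contradiction free (∈Γ-≢[] {i = i} τ∈i)
  Cyl-cone τ i∈σ τ∈i (⊆σ , inj₂ (any , all)) =
    (λ { (here ≡.refl) → i∈σ ; (there q) → ⊆σ q }) , inj₂ (any , τ∈i ∷ all)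

  face-length : ∀ {u : W} {τ ρ n} → length τ ≡ suc n → u ∷ ρ ↭ τ → length ρ ≡ n
  face-length len ρ↭τ = ℕ.suc-injective (≡.trans (↭-length ρ↭τ) len)

  lefts-free-∷ : ∀ u τ ρ → LeftFree τ → u ∷ ρ ↭ τ → LeftFree ρ
  lefts-free-∷ (inj₂ i) τ ρ free ρ↭τ =
    ↭-empty-inv (≡.subst (lefts ρ ↭_) free (mapMaybe-↭ isInj₁ ρ↭τ))
  lefts-free-∷ (inj₁ x) τ ρ free ρ↭τ
    with () ← ↭-empty-inv (≡.subst (x ∷ lefts ρ ↭_) free (mapMaybe-↭ isInj₁ ρ↭τ))

  module _ (σ : List (Fin m)) where

    -- The first member of σ containing τ: it depends on the vertex set of τ only, so
    -- that coning off along it is well defined on oriented chains.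
    pick : List V → List (Fin m) → Maybe (Fin m)
    pick τ []      = nothing
    pick τ (i ∷ α) with em {P = τ ∈Γ i}
    ... | yes _ = just i
    ... | no  _ = pick τ α

    pick-↭ : ∀ {ρ τ} α → ρ ↭ τ → pick ρ α ≡ pick τ α
    pick-↭ []      ρ↭τ = ≡.refl
    pick-↭ {ρ} {τ} (i ∷ α) ρ↭τ with em {P = ρ ∈Γ i} | em {P = τ ∈Γ i}
    ... | yes _   | yes _   = ≡.refl
    ... | yes ρ∈i | no  τ∉i = contradiction (∈Γ-↭ {i = i} ρ↭τ ρ∈i) τ∉i
    ... | no  ρ∉i | yes τ∈i = contradiction (∈Γ-↭ {i = i} (↭-sym ρ↭τ) τ∈i) ρ∉i
    ... | no  _   | no  _   = pick-↭ α ρ↭τ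

    pick-just : ∀ {τ i} α → pick τ α ≡ just i → i ∈ α × τ ∈Γ i
    pick-just {τ} (i ∷ α) eq with em {P = τ ∈Γ i}
    pick-just (i ∷ α) ≡.refl | yes τ∈i = here ≡.refl , τ∈i
    pick-just (i ∷ α) eq     | no  _   =
      let i∈α , τ∈i = pick-just α eq in there i∈α , τ∈i

    pick-nothing : ∀ {τ} α → pick τ α ≡ nothing → ¬ Any (τ ∈Γ_) α
    pick-nothing {τ} (i ∷ α) eq any with em {P = τ ∈Γ i}
    pick-nothing (i ∷ α) ()   any        | yes _
    pick-nothing (i ∷ α) eq (here τ∈i) | no τ∉i = τ∉i τ∈i
    pick-nothing (i ∷ α) eq (there any)  | no _   = pick-nothing α eq any

    cone : Maybe (Fin m) → Λ → Λ
    cone nothing  x = 𝟘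
    cone (just i) x = e (inj₂ i) x

    cone-linear : ∀ i → Endo (cone i)
    cone-linear (just i) = e-linear (inj₂ i)
    cone-linear nothing  = record
      { cong   = λ _ → ∼-refl
      ; +-homo = λ _ _ → ∼-sym (⊕-identityˡ 𝟘)
      ; *-homo = λ r _ → ∼-sym (·-zeroʳ r)
      }

    d : List W → Λ
    d τ = cone (pick (lefts τ) σ) (mono τ)

    d-alternating : Alternating Λ-module d
    d-alternating = record
      { swaps   = λ ρ {u} {v} {τ} → ∼-trans
          (IsLinear.cong (cone-linear (pick (lefts (ρ ++ u ∷ v ∷ τ)) σ))
            (Alternating.swaps mono-alternating ρ))
          (∼-trans (IsLinear.*-homo (cone-linear (pick (lefts (ρ ++ u ∷ v ∷ τ)) σ)) _ _)
            (≡.subst (λ i → ⊖ cone (pick (lefts (ρ ++ u ∷ v ∷ τ)) σ) (mono (ρ ++ v ∷ u ∷ τ)) ∼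
                            ⊖ cone i (mono (ρ ++ v ∷ u ∷ τ)))
              (pick-↭ σ (mapMaybe-↭ isInj₁ (++⁺ˡ ρ (swap u v ↭-refl)))) ∼-refl))
      ; repeats = λ ρ {u} {τ} → IsLinear.≈0
          (cone-linear (pick (lefts (ρ ++ u ∷ u ∷ τ)) σ))
          (Alternating.repeats mono-alternating ρ)
      }

    D : Λ → Λ
    D = extend Λ-module d

    D-linear : Endo D
    D-linear = extend-linear Λ-module d-alternating

    D-mono : ∀ τ → D (mono τ) ≡ d τ
    D-mono = extend-mono Λ-module d

    D-Cyl : ∀ {n x} → Supp (Cyl σ at n) x → Supp (Cyl σ at suc n) (D x)
    D-Cyl = supp-map D-linear λ τ s → ≡.subst (Supp _) (≡.sym (D-mono τ)) (go τ s)
      where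
      go : ∀ {n} τ → (Cyl σ at n) τ → Supp (Cyl σ at suc n) (d τ)
      go τ (cyl , len) with pick (lefts τ) σ in eq
      ... | nothing = 𝟘
      ... | just i  = let i∈σ , τ∈i = pick-just σ eq in
        basis (inj₂ i ∷ τ) (Cyl-cone τ i∈σ τ∈i cyl , ≡.cong suc len)

    D-free : ∀ {x} → Supp LeftFree x → D x ∼ 𝟘
    D-free = supp-equal D-linear (cone-linear nothing) λ τ free →
      ≡.subst (_∼ 𝟘) (≡.sym (D-mono τ)) (go τ free)
      where
      go : ∀ τ → LeftFree τ → d τ ∼ 𝟘
      go τ free with pick (lefts τ) σ in eq
      ... | nothing = ∼-refl
      ... | just i  = contradiction free (∈Γ-≢[] {i = i} (proj₂ (pick-just σ eq)))

    Low : ℕ → List W → Set (v ⊔ p)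
    Low q τ = Cyl σ τ × length (lefts τ) ℕ.≤ q

    -- Chain homotopic to the identity, with homotopy `D`.
    push : Λ → Λ
    push x = (x ⊕ ⊖ ∂ (D x)) ⊕ ⊖ D (∂ x)

    push-linear : Endo push
    push-linear = ⊕-linear (⊕-linear id-linear (·-linear _ (∘-linear ∂-linear D-linear)))
      (·-linear _ (∘-linear D-linear ∂-linear))

    -- If `i` is picked for `τ`, then `push` gives the signed sum of i * ρ - D ρ over the faces ρ of
    -- `τ`. Deleting an index leaves the pick unchanged, and the two terms cancel; deleting a vertex
    -- of X lowers the count.
    push-low : ∀ {n q x} → Supp (Low (suc q) at n) x → Supp (Low q at n) (push x)
    push-low = supp-map push-linear go
      where
      go : ∀ {n q} τ → (Low (suc q) at n) τ → Supp (Low q at n) (push (mono τ))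
      go {n} {q} τ ((cyl , ≤q) , len) with pick (lefts τ) σ in eq
      go τ ((cyl@(_ , inj₂ (any , _)) , ≤q) , len) | nothing =
        contradiction any (pick-nothing σ eq)
      go {n} {q} τ ((cyl@(_ , inj₁ (free , _)) , ≤q) , len) | nothing =
        resp (∼-sym eq′) (basis τ ((cyl ,
          ℕ.≤-trans (ℕ.≤-reflexive (≡.cong length free)) z≤n) , len))
        where
        eq′ : push (mono τ) ∼ mono τ
        eq′ = begin
          (mono τ ⊕ ⊖ ∂ (D (mono τ))) ⊕ ⊖ D (∂ (mono τ))
            ≈⟨ ⊕-cong (⊕-congˡ (⊖-cong (IsLinear.≈0 ∂-linear (D-free (basis τ free)))))
                 (⊖-cong (D-free (supp-∂ lefts-free-∷ (basis τ free)))) ⟩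
          (mono τ ⊕ ⊖ 𝟘) ⊕ ⊖ 𝟘
            ≈⟨ solve (mono τ ∷ []) ((v₀ :+ :- :0) :+ :- :0) v₀ ≡.refl ⟩
          mono τ ∎
      go {n} {q} τ ((cyl , ≤q) , len) | just i =
        resp (∼-sym eq′) (supp-map E-linear (λ ρ (u , _ , ρ↭τ) → face u ρ ρ↭τ)
          (ι-mono {P = λ _ → ⊤ {v}} _ (λ _ → inj₁ tt) τ))
        where
        i∈σ = proj₁ (pick-just σ eq)
        τ∈i = proj₂ (pick-just σ eq)

        E : Λ → Λ
        E x = e (inj₂ i) x ⊕ ⊖ D x

        E-linear : Endo E
        E-linear = ⊕-linear (e-linear _) (·-linear _ D-linear)

        D-τ : D (mono τ) ≡ e (inj₂ i) (mono τ)
        D-τ = ≡.trans (D-mono τ) (≡.cong (λ k → cone k (mono τ)) eq)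

        eq′ : push (mono τ) ∼ E (∂ (mono τ))
        eq′ = begin
          (mono τ ⊕ ⊖ ∂ (D (mono τ))) ⊕ ⊖ D (∂ (mono τ))
            ≡⟨ ≡.cong (λ y → (mono τ ⊕ ⊖ ∂ y) ⊕ ⊖ D (∂ (mono τ))) D-τ ⟩
          (mono τ ⊕ ⊖ ∂ (e (inj₂ i) (mono τ))) ⊕ ⊖ D (∂ (mono τ))
            ≈⟨ ⊕-congʳ (⊕-congˡ (⊖-cong (∂-e _ _))) ⟩
          (mono τ ⊕ ⊖ (mono τ ⊕ ⊖ e (inj₂ i) (∂ (mono τ)))) ⊕ ⊖ D (∂ (mono τ))
            ≈⟨ solve (mono τ ∷ e (inj₂ i) (∂ (mono τ)) ∷ D (∂ (mono τ)) ∷ [])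
                 ((v₀ :+ :- (v₀ :+ :- v₁)) :+ :- v₂) (v₁ :+ :- v₂) ≡.refl ⟩
          e (inj₂ i) (∂ (mono τ)) ⊕ ⊖ D (∂ (mono τ)) ∎

        face : ∀ u ρ → u ∷ ρ ↭ τ → Supp (Low q at n) (E (mono ρ))
        face (inj₂ k) ρ ρ↭τ = resp (∼-sym (begin
          e (inj₂ i) (mono ρ) ⊕ ⊖ D (mono ρ)
            ≡⟨ ≡.cong (λ y → e (inj₂ i) (mono ρ) ⊕ ⊖ y) (≡.trans (D-mono ρ)
                 (≡.cong (λ k → cone k (mono ρ))
                   (≡.trans (pick-↭ σ (mapMaybe-↭ isInj₁ ρ↭τ)) eq))) ⟩
          e (inj₂ i) (mono ρ) ⊕ ⊖ e (inj₂ i) (mono ρ)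
            ≈⟨ ⊖-inverseʳ _ ⟩
          𝟘 ∎)) 𝟘
        face (inj₁ x) ρ ρ↭τ =
          basis (inj₂ i ∷ ρ) ((Cyl-face (inj₁ x) (inj₂ i ∷ τ) (inj₂ i ∷ ρ)
              (Cyl-cone τ i∈σ τ∈i cyl) (↭-trans (swap _ _ ↭-refl) (prep _ ρ↭τ)) , low) , lenρ) ⊕
          (- 1#) · ≡.subst (Supp _) (≡.sym (D-mono ρ)) cone-ρ
          where
          open R using (-_; 1#)
          cylρ = Cyl-face (inj₁ x) τ ρ cyl ρ↭τ
          lenρ : suc (length ρ) ≡ n
          lenρ = ≡.trans (↭-length ρ↭τ) len
          low : length (lefts ρ) ℕ.≤ q
          low with s≤s q ← ℕ.≤-trans (ℕ.≤-reflexive (↭-length (mapMaybe-↭ isInj₁ ρ↭τ))) ≤q = q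
          cone-ρ : Supp (Low q at n) (d ρ)
          cone-ρ with pick (lefts ρ) σ in eqρ
          ... | nothing = 𝟘
          ... | just k  = let k∈σ , ρ∈k = pick-just σ eqρ in
            basis (inj₂ k ∷ ρ) ((Cyl-cone ρ k∈σ ρ∈k cylρ , low) , lenρ)

    -- `D` vanishes on the left-free chain `∂ x`, so `push x` is `x` minus the boundary of `D x`.
    -- Each push lowers the bound on the number of vertices of X by one.
    retraction-low : ∀ q {n x} → Supp (Low q at n) x → Supp LeftFree (∂ x) →
      ∃[ y ] Supp (Cyl σ at suc n) y × Supp ((λ τ → Cyl σ τ × LeftFree τ) at n) (x ⊕ ⊖ ∂ y)
    retraction-low zero {x = x} X ∂X = 𝟘 , 𝟘 , resp
      (solve (x ∷ []) v₀ (v₀ :+ :- :0) ≡.refl)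
      (supp-⊆ (λ { τ ((cyl , ≤0) , len) → (cyl , empty (lefts τ) ≤0) , len }) X)
      where
      empty : ∀ (ρ : List V) → length ρ ℕ.≤ 0 → ρ ≡ []
      empty [] _ = ≡.refl
    retraction-low (suc q) {n} {x} X ∂X =
      let y , Y , free = retraction-low q (resp x′≈push (push-low X)) (resp ∂x′ ∂X) in
      D x ⊕ y , D-Cyl (supp-⊆ (λ _ ((cyl , _) , len) → cyl , len) X) ⊕ Y ,
      resp (solve (x ∷ ∂ (D x) ∷ ∂ y ∷ [])
        ((v₀ :+ :- v₁) :+ :- v₂) (v₀ :+ :- (v₁ :+ v₂)) ≡.refl) free
      where
      x′≈push : push x ∼ x ⊕ ⊖ ∂ (D x)
      x′≈push = ∼-trans (⊕-congˡ (⊖-cong (D-free ∂X)))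
        (solve (x ⊕ ⊖ ∂ (D x) ∷ []) (v₀ :+ :- :0) v₀ ≡.refl)
      ∂x′ : ∂ x ∼ ∂ (x ⊕ ⊖ ∂ (D x))
      ∂x′ = ∼-sym (∼-trans (⊕-congˡ (⊖-cong (ι-square _ _)))
        (solve (∂ x ∷ []) (v₀ :+ :- :0) v₀ ≡.refl))

    retraction : ∀ {n x} → Supp (Cyl σ at n) x → Supp LeftFree (∂ x) →
      ∃[ y ] Supp (Cyl σ at suc n) y × Supp ((λ τ → Cyl σ τ × LeftFree τ) at n) (x ⊕ ⊖ ∂ y)
    retraction {n} X = retraction-low n (supp-⊆ (λ { τ (cyl , len) →
      (cyl , ℕ.≤-trans (length-mapMaybe isInj₁ τ) (ℕ.≤-reflexive len)) , len }) X)

  Cyl-acyclic : ∀ σ → Simplex (nerve Γ) σ → ∀ {n x} → Supp (Cyl σ at n) x → ∂ x ∼ 𝟘 →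
                ∃[ y ] Supp (Cyl σ at suc n) y × ∂ y ∼ x
  Cyl-acyclic []        s = contradiction s (SimplicialComplex.nonempty (nerve Γ))
  Cyl-acyclic (i ∷ σ) s {n} {x} X ∂x≈0 =
    -- The retracted cycle `x′` lives on the full simplex with vertex set `i ∷ σ`, a cone with apex
    -- `i`.
    y ⊕ e (inj₂ i) x′ , Y ⊕ supp-e (inj₂ i) cone-face free , (begin
      ∂ y ⊕ ∂ (e (inj₂ i) x′)
        ≈⟨ ⊕-congˡ (∂-e (inj₂ i) x′) ⟩
      ∂ y ⊕ (x′ ⊕ ⊖ e (inj₂ i) (∂ x′))
        ≈⟨ ⊕-congˡ (⊕-congˡ (⊖-cong (∼-trans (e-cong ∂x′≈0) (e-𝟘 _)))) ⟩
      ∂ y ⊕ ((x ⊕ ⊖ ∂ y) ⊕ ⊖ 𝟘)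
        ≈⟨ solve (x ∷ ∂ y ∷ []) (v₁ :+ ((v₀ :+ :- v₁) :+ :- :0)) v₀ ≡.refl ⟩
      x ∎)
    where
    r    = retraction (i ∷ σ) X (resp (∼-sym ∂x≈0) 𝟘)
    y    = proj₁ r
    Y    = proj₁ (proj₂ r)
    free = proj₂ (proj₂ r)
    x′   = x ⊕ ⊖ ∂ y

    ∂x′≈0 : ∂ x′ ∼ 𝟘
    ∂x′≈0 = ∼-trans (⊕-cong ∂x≈0 (⊖-cong (ι-square _ y)))
      (solve [] (:0 :+ :- :0) :0 ≡.refl)

    cone-face : ∀ τ → ((λ τ → Cyl (i ∷ σ) τ × LeftFree τ) at n) τ →
           (Cyl (i ∷ σ) at suc n) (inj₂ i ∷ τ)
    cone-face τ (((⊆σ , _) , free) , len) =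
      (⊆σ′ , inj₁ (free , Face-⊆ ⊆σ′ (inj₂ s))) , ≡.cong suc len
      where
      ⊆σ′ : _ ⊆ _
      ⊆σ′ (here ≡.refl) = here ≡.refl
      ⊆σ′ (there q)     = ⊆σ q

-- Decomposition of chains by their sets of indices

sublists : ∀ {a} {A : Set a} → List A → List (List A)
sublists []       = [] ∷ []
sublists (x ∷ xs) = sublists xs ++ map (x ∷_) (sublists xs)

sublists-⊆ : ∀ {a} {A : Set a} (xs : List A) → All (_⊆ xs) (sublists xs)
sublists-⊆ []       = id ∷ []
sublists-⊆ (x ∷ xs) = All.++⁺
  (All.map {Q = _⊆ x ∷ xs} (λ ⊆xs q → there (⊆xs q)) (sublists-⊆ xs))
  (All.map⁺ (All.map {Q = λ ρ → x ∷ ρ ⊆ x ∷ xs}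
    (λ { ⊆xs (here eq) → here eq ; ⊆xs (there q) → there (⊆xs q) }) (sublists-⊆ xs)))

sublists-unique : ∀ {a} {A : Set a} {xs : List A} → Unique xs → All Unique (sublists xs)
sublists-unique []               = [] ∷ []
sublists-unique {xs = x ∷ xs} (x∉xs ∷ u) = All.++⁺ (sublists-unique u)
  (All.map⁺ (All.zipWith (λ (⊆xs , uρ) → All-resp-⊇ ⊆xs x∉xs ∷ uρ)
    (sublists-⊆ xs , sublists-unique u)))

module Decomposition
  (em : ∀ {a} → ExcludedMiddle a)
  {c ℓ v p : Level} (F : Field c ℓ) {V : Set v} (X : SimplicialComplex V p)
  {m : ℕ} (Γ : Fin m → Subcomplex X)
  where

  open Cylinder em F X Γ public
  private
    module R = Field F
    open SetoidReasoning ≈ᴹ-setoid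

  eᵣ : List (Fin m) → Λ → Λ
  eᵣ ρ = e⋆ (map inj₂ ρ)

  eᵣ-linear : ∀ ρ → Endo (eᵣ ρ)
  eᵣ-linear ρ = e⋆-linear (map inj₂ ρ)

  -- The head is contracted first, undoing the outermost factor of `eᵣ (i ∷ ρ)`.
  ιᵣ : List (Fin m) → Λ → Λ
  ιᵣ []      x = x
  ιᵣ (i ∷ ρ) x = ιᵣ ρ (ι (δ (inj₂ i)) x)

  ιᵣ-linear : ∀ ρ → Endo (ιᵣ ρ)
  ιᵣ-linear []      = id-linear
  ιᵣ-linear (i ∷ ρ) = ∘-linear (ιᵣ-linear ρ) (ι-linear _)

  killᵣ : List (Fin m) → Λ → Λ
  killᵣ []      x = x
  killᵣ (i ∷ α) x = kill (inj₂ i) (killᵣ α x)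

  killᵣ-linear : ∀ α → Endo (killᵣ α)
  killᵣ-linear []      = id-linear
  killᵣ-linear (i ∷ α) = ∘-linear (kill-linear _) (killᵣ-linear α)

  private
    total : (List (Fin m) → Λ) → List (List (Fin m)) → Λ
    total f []      = 𝟘
    total f (ρ ∷ L) = f ρ ⊕ total f L

    total-++ : ∀ f L L′ → total f (L ++ L′) ∼ total f L ⊕ total f L′
    total-++ f []      L′ = ∼-sym (⊕-identityˡ _)
    total-++ f (ρ ∷ L) L′ = ∼-trans (⊕-congˡ (total-++ f L L′)) (∼-sym (⊕-assoc _ _ _))

    total-map : ∀ f g L → total f (map g L) ≡ total (f ∘ g) L
    total-map f g []      = ≡.refl
    total-map f g (ρ ∷ L) = ≡.cong (f (g ρ) ⊕_) (total-map f g L)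

    total-cong : ∀ {f g L} → All (λ ρ → f ρ ∼ g ρ) L → total f L ∼ total g L
    total-cong []      = ∼-refl
    total-cong (p ∷ h) = ⊕-cong p (total-cong h)

    total-linear : ∀ {A} → Endo A → ∀ f L → A (total f L) ∼ total (A ∘ f) L
    total-linear lin f []      = IsLinear.0-homo lin
    total-linear lin f (ρ ∷ L) =
      ∼-trans (IsLinear.+-homo lin _ _) (⊕-congˡ (total-linear lin f L))

    total-sum : ∀ f L → total f L ≡ sum {length L} (f ∘ lookup L)
    total-sum f []      = ≡.refl
    total-sum f (ρ ∷ L) = ≡.cong (f ρ ⊕_) (total-sum f L)

    kill-eᵣ : ∀ {i} ρ x → i ∉ ρ → kill (inj₂ i) (eᵣ ρ x) ∼ eᵣ ρ (kill (inj₂ i) x)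
    kill-eᵣ []      x i∉ρ = ∼-refl
    kill-eᵣ (j ∷ ρ) x i∉ρ = ∼-trans
      (kill-e _ (inj₂ j) _ (λ { ≡.refl → i∉ρ (here ≡.refl) }))
      (e-cong (kill-eᵣ ρ x (i∉ρ ∘ there)))

    e-kill : ∀ u x → e u (kill u x) ∼ e u x
    e-kill u x = begin
      e u (kill u x)
        ≈⟨ ∼-trans (⊕-congˡ (e-square u _)) (⊕-identityʳ _) ⟨
      e u (kill u x) ⊕ e u (e u (ι (δ u) x))
        ≈⟨ e-⊕ u _ _ ⟨
      e u (kill u x ⊕ e u (ι (δ u) x))
        ≈⟨ e-cong (kill-split u x) ⟨
      e u x ∎

    -- Induction by `kill-split`: the sublists without `i` yield the part free of `i`, the others
    -- the part divisible by it, where `e-kill` absorbs the additional `kill`.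
    decompose : ∀ {α} → Unique α → ∀ x →
                total (λ ρ → eᵣ ρ (killᵣ α (ιᵣ ρ x))) (sublists α) ∼ x
    decompose []       x = ⊕-identityʳ x
    decompose {i ∷ α} (i∉α ∷ uα) x = begin
      total term (sublists α ++ map (i ∷_) (sublists α))
        ≈⟨ total-++ term (sublists α) _ ⟩
      total term (sublists α) ⊕ total term (map (i ∷_) (sublists α))
        ≡⟨ ≡.cong (total term (sublists α) ⊕_) (total-map term (i ∷_) (sublists α)) ⟩
      total term (sublists α) ⊕ total (term ∘ (i ∷_)) (sublists α)
        ≈⟨ ⊕-cong (inner x) (∼-trans (∼-sym (total-linear (e-linear (inj₂ i)) _ (sublists α)))
             (e-cong (inner (ι (δ (inj₂ i)) x)))) ⟩
      kill (inj₂ i) x ⊕ e (inj₂ i) (kill (inj₂ i) (ι (δ (inj₂ i)) x))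
        ≈⟨ ⊕-congˡ (e-kill (inj₂ i) _) ⟩
      kill (inj₂ i) x ⊕ e (inj₂ i) (ι (δ (inj₂ i)) x)
        ≈⟨ kill-split (inj₂ i) x ⟨
      x ∎
      where
      term : List (Fin m) → Λ
      term ρ = eᵣ ρ (killᵣ (i ∷ α) (ιᵣ ρ x))

      inner : ∀ x → total (λ ρ → eᵣ ρ (killᵣ (i ∷ α) (ιᵣ ρ x))) (sublists α) ∼
                    kill (inj₂ i) x
      inner x = begin
        total (λ ρ → eᵣ ρ (killᵣ (i ∷ α) (ιᵣ ρ x))) (sublists α)
          ≈⟨ total-cong (All.map (λ {ρ} ρ⊆α → kill-eᵣ ρ _
               (λ i∈ρ → All.lookup i∉α (ρ⊆α i∈ρ) ≡.refl)) (sublists-⊆ α)) ⟨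
        total (λ ρ → kill (inj₂ i) (eᵣ ρ (killᵣ α (ιᵣ ρ x)))) (sublists α)
          ≈⟨ total-linear (kill-linear (inj₂ i)) _ (sublists α) ⟨
        kill (inj₂ i) (total (λ ρ → eᵣ ρ (killᵣ α (ιᵣ ρ x))) (sublists α))
          ≈⟨ kill-cong (inj₂ i) (decompose uα x) ⟩
        kill (inj₂ i) x ∎

  -- One entry for each subset of the indices, in one fixed order; the corresponding words give a
  -- basis of the exterior algebra on the indices.
  N : ℕ
  N = length (sublists (allFin m))

  σ : Fin N → List (Fin m)
  σ = lookup (sublists (allFin m))

  σ-unique : ∀ s → Unique (σ s)
  σ-unique s = All.lookup (sublists-unique (allFin⁺ m)) (∈-lookup s)

  -- The coefficient of the word `ρ`, a chain on the vertices of X. Contraction alone would also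
  -- keep the words with indices beyond `ρ`.
  component : List (Fin m) → Λ → Λ
  component ρ x = killᵣ (allFin m) (ιᵣ ρ x)

  component-linear : ∀ ρ → Endo (component ρ)
  component-linear ρ = ∘-linear (killᵣ-linear (allFin m)) (ιᵣ-linear ρ)

  decomposition : ∀ x → x ∼ sum {N} (λ s → eᵣ (σ s) (component (σ s) x))
  decomposition x = ∼-trans (∼-sym (decompose (allFin⁺ m) x))
    (≡.subst (total term (sublists (allFin m)) ∼_) (total-sum term _) ∼-refl)
    where
    term : List (Fin m) → Λ
    term ρ = eᵣ ρ (component ρ x)

  _Respects↭ : ∀ {q} → (List W → Set q) → Set (v ⊔ q)
  Q Respects↭ = ∀ ρ τ → ρ ↭ τ → Q ρ → Q τ

  supp-ιᵣ : ∀ {q} {Q : List W → Set q} → Q Respects↭ → ∀ ρ {x} →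
            Supp Q x → Supp (λ τ → Q (map inj₂ ρ ++ τ)) (ιᵣ ρ x)
  supp-ιᵣ resp↭ []      X = X
  supp-ιᵣ resp↭ (i ∷ ρ) X = supp-ιᵣ (λ ρ τ ρ↭τ → resp↭ _ _ (prep _ ρ↭τ)) ρ
    (supp-ι (inj₂ i) (λ τ τ′ Qτ p → resp↭ τ _ (↭-sym p) Qτ) X)

  supp-killᵣ : ∀ {q} {Q : List W → Set q} α {x} → Supp Q x →
               Supp (λ τ → Q τ × All (λ i → inj₂ i ∉ τ) α) (killᵣ α x)
  supp-killᵣ []      X = supp-⊆ (λ _ Qτ → Qτ , []) X
  supp-killᵣ (i ∷ α) X = supp-⊆ (λ _ ((Qτ , all) , i∉τ) → Qτ , i∉τ ∷ all)
    (supp-kill (inj₂ i) (supp-killᵣ α X))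

  private
    no-rights : ∀ τ → (∀ i → inj₂ i ∉ τ) → RightFree τ
    no-rights []            h = ≡.refl
    no-rights (inj₁ x ∷ τ) h = no-rights τ (λ i → h i ∘ there)
    no-rights (inj₂ i ∷ τ) h = contradiction (here ≡.refl) (h i)

    RightFree-∉ : ∀ τ i → RightFree τ → inj₂ i ∉ τ
    RightFree-∉ (inj₁ x ∷ τ) i free (there q) = RightFree-∉ τ i free q

    free-[] : ∀ τ → LeftFree τ → RightFree τ → τ ≡ []
    free-[] []           _  _  = ≡.refl
    free-[] (inj₁ _ ∷ _) () _
    free-[] (inj₂ _ ∷ _) _  ()

  supp-component : ∀ {q} {Q : List W → Set q} → Q Respects↭ → ∀ ρ {x} → Supp Q x →
    Supp (λ τ → Q (map inj₂ ρ ++ τ) × RightFree τ) (component ρ x)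
  supp-component resp↭ ρ X = supp-⊆
    (λ τ (Qτ , all) → Qτ , no-rights τ (λ i → All.lookup all (∈-allFin i)))
    (supp-killᵣ (allFin m) (supp-ιᵣ resp↭ ρ X))

  -- `kill` does not commute with `∂`, whereas contractions do up to sign. A component thus inherits
  -- the cycle condition where nothing remains to be killed, as for `ρ` of maximal size.
  component-ιᵣ : ∀ ρ {x} → Supp RightFree (ιᵣ ρ x) → component ρ x ∼ ιᵣ ρ x
  component-ιᵣ ρ {x} X = go (allFin m)
    where
    go : ∀ α → killᵣ α (ιᵣ ρ x) ∼ ιᵣ ρ x
    go []      = ∼-refl
    go (i ∷ α) = ∼-trans (kill-cong _ (go α))
      (kill-id (inj₂ i) (λ τ → RightFree-∉ τ i) X)

  ιᵣ-cycle : ∀ ρ {x} → ∂ x ∼ 𝟘 → ∂ (ιᵣ ρ x) ∼ 𝟘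
  ιᵣ-cycle []      p = p
  ιᵣ-cycle (i ∷ ρ) p = ιᵣ-cycle ρ
    (∼-trans (ι-anti _ _ _) (∼-trans (⊖-cong (IsLinear.≈0 (ι-linear _) p)) (·-zeroʳ _)))

  lefts-++ : ∀ ρ τ → lefts (map inj₂ ρ ++ τ) ≡ lefts τ
  lefts-++ []      τ = ≡.refl
  lefts-++ (i ∷ ρ) τ = lefts-++ ρ τ

  rights-++ : ∀ ρ τ → rights (map inj₂ ρ ++ τ) ≡ ρ ++ rights τ
  rights-++ []      τ = ≡.refl
  rights-++ (i ∷ ρ) τ = ≡.cong (i ∷_) (rights-++ ρ τ)

  lefts-map : ∀ ρ → lefts (map inj₂ ρ) ≡ []
  lefts-map []      = ≡.refl
  lefts-map (i ∷ ρ) = lefts-map ρ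

  rights-map : ∀ ρ → rights (map inj₂ ρ) ≡ ρ
  rights-map []      = ≡.refl
  rights-map (i ∷ ρ) = ≡.cong (i ∷_) (rights-map ρ)

  simplex : Fin N → Λ
  simplex s = mono (map inj₂ (σ s))

  coefficient : Fin N → Λ → R.Carrier
  coefficient s x = ε (component (σ s) x)

  -- The linear operator on chains of the nerve with values f s on the simplices σ s.
  ⟨_⟩ : (Fin N → Λ) → Λ → Λ
  ⟨ f ⟩ x = sum {N} (λ s → coefficient s x · f s)

  coefficient-⊕ : ∀ s x y → coefficient s (x ⊕ y) R.≈ coefficient s x R.+ coefficient s y
  coefficient-⊕ s x y = ε-cong (IsLinear.+-homo (component-linear (σ s)) x y)

  coefficient-· : ∀ s r x → coefficient s (r · x) R.≈ r R.* coefficient s x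
  coefficient-· s r x = ε-cong (IsLinear.*-homo (component-linear (σ s)) r x)

  ⟨⟩-linear : ∀ f → Endo ⟨ f ⟩
  ⟨⟩-linear f = record
    { cong   = λ x∼y → sum-cong {N} λ s →
        ·-congʳ (ε-cong (IsLinear.cong (component-linear (σ s)) x∼y))
    ; +-homo = λ x y → ∼-trans
        (sum-cong {N} λ s → ∼-trans (·-congʳ (coefficient-⊕ s x y)) (·-distribʳ (f s) _ _))
        (sum-⊕ {N} _ _)
    ; *-homo = λ r x → ∼-trans
        (sum-cong {N} λ s → ∼-trans (·-congʳ (coefficient-· s r x)) (·-assoc r _ (f s)))
        (∼-sym (sum-· {N} r _))
    }

  ⟨⟩-∘ : ∀ {A} → Endo A → ∀ f x → A (⟨ f ⟩ x) ∼ ⟨ A ∘ f ⟩ x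
  ⟨⟩-∘ lin f x = ∼-trans (IsLinear.sum-homo lin {N} _)
    (sum-cong {N} λ s → IsLinear.*-homo lin _ (f s))

  ⟨⟩-⊕ : ∀ f g x → ⟨ (λ s → f s ⊕ g s) ⟩ x ∼ ⟨ f ⟩ x ⊕ ⟨ g ⟩ x
  ⟨⟩-⊕ f g x = ∼-trans (sum-cong {N} λ s → ·-distribˡ _ (f s) (g s)) (sum-⊕ {N} _ _)

  ⟨⟩-sum : ∀ {n} (f : Fin n → Fin N → Λ) x →
           ⟨ (λ s → sum {n} (λ t → f t s)) ⟩ x ∼ sum {n} (λ t → ⟨ f t ⟩ x)
  ⟨⟩-sum {n} f x = ∼-trans (sum-cong {N} λ s → sum-· {n} _ _) (sum-comm {N} {n} _)

  ⟨⟩-supp : ∀ {q} {Q : List W → Set q} {f} → (∀ s → Supp Q (f s)) →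
            ∀ x → Supp Q (⟨ f ⟩ x)
  ⟨⟩-supp h x = supp-sum {n = N} (λ s → coefficient s x · h s)

  module _ {q : Level} {Q : List W → Set q} (resp↭ : Q Respects↭)
    (free : ∀ τ → Q τ → LeftFree τ) {x : Λ} (X : Supp Q x) where

    private
      component-supp : ∀ s → Supp (λ τ → τ ≡ [] × Q (map inj₂ (σ s))) (component (σ s) x)
      component-supp s = supp-⊆ (λ τ (Qτ , right) →
          let τ≡[] = free-[] τ (≡.trans (≡.sym (lefts-++ (σ s) τ)) (free _ Qτ)) right in
          τ≡[] , ≡.subst Q (≡.trans (≡.cong (map inj₂ (σ s) ++_) τ≡[]) (++-identityʳ _)) Qτ)
        (supp-component resp↭ (σ s) X)

    -- Words outside `Q` have coefficient zero in `x`, so the values there are arbitrary.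
    ⟨⟩-cong-on : ∀ {f g} → (∀ s → Q (map inj₂ (σ s)) → f s ∼ g s) → ⟨ f ⟩ x ∼ ⟨ g ⟩ x
    ⟨⟩-cong-on {f} {g} h = sum-cong {N} λ s → go s
      where
      go : ∀ s → coefficient s x · f s ∼ coefficient s x · g s
      go s with em {P = Q (map inj₂ (σ s))}
      ... | yes Qs = ·-congˡ (h s Qs)
      ... | no ¬Qs = ∼-trans (vanish (f s)) (∼-sym (vanish (g s)))
        where
        vanish : ∀ y → coefficient s x · y ∼ 𝟘
        vanish y = ∼-trans
          (·-congʳ (ε-cong (supp-empty (λ _ (_ , Qs) → ¬Qs Qs) (component-supp s))))
          (·-zeroˡ y)

    ⟨⟩-supp-on : ∀ {q′} {Q′ : List W → Set q′} {f} →
                 (∀ s → Q (map inj₂ (σ s)) → Supp Q′ (f s)) → Supp Q′ (⟨ f ⟩ x)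
    ⟨⟩-supp-on {Q′ = Q′} {f} h = supp-sum {n = N} go
      where
      go : ∀ s → Supp Q′ (coefficient s x · f s)
      go s with em {P = Q (map inj₂ (σ s))}
      ... | yes Qs = coefficient s x · h s Qs
      ... | no ¬Qs = resp (∼-sym (∼-trans
        (·-congʳ (ε-cong (supp-empty (λ _ (_ , Qs) → ¬Qs Qs) (component-supp s))))
        (·-zeroˡ (f s)))) 𝟘

    -- In a left-free chain the components are scalars, and the decomposition is the expansion in
    -- words of indices.
    ⟨⟩-simplex : ⟨ simplex ⟩ x ∼ x
    ⟨⟩-simplex = ∼-trans (sum-cong {N} λ s → ∼-sym (go s)) (∼-sym (decomposition x))
      where
      go : ∀ s → eᵣ (σ s) (component (σ s) x) ∼ coefficient s x · simplex s
      go s = ∼-trans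
        (IsLinear.cong (eᵣ-linear (σ s)) (scalar (component-supp s)))
        (IsLinear.*-homo (eᵣ-linear (σ s)) _ 𝟙)
        where
        scalar : ∀ {q} {P : Set q} {y} → Supp (λ τ → τ ≡ [] × P) y → y ∼ ε y · 𝟙
        scalar (basis _ (≡.refl , _)) = ∼-sym (·-identityˡ 𝟙)
        scalar 𝟘                      = ∼-sym (·-zeroˡ 𝟙)
        scalar (Y ⊕ Z)                =
          ∼-trans (⊕-cong (scalar Y) (scalar Z)) (∼-sym (·-distribʳ 𝟙 _ _))
        scalar (r · Y)                =
          ∼-trans (·-congˡ (scalar Y)) (∼-sym (·-assoc r _ 𝟙))
        scalar (resp p Y)             =
          ∼-trans (∼-sym p) (∼-trans (scalar Y) (·-congʳ (ε-cong p)))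

-- Construction of the homotopy, by degree and by number of indices

module Lifting
  (em : ∀ {a} → ExcludedMiddle a)
  {c ℓ v p : Level} (F : Field c ℓ) {V : Set v} (X : SimplicialComplex V p)
  {m : ℕ} (Γ : Fin m → Subcomplex X)
  where

  open Decomposition em F X Γ public
  private
    module R = Field F
    open SetoidReasoning ≈ᴹ-setoid

  -- The nerve and the union of a subfamily, as subcomplexes of the cylinder, and the
  -- link of ρ in X, which is the intersection ⋂ ρ.
  Ner Uni Int : List (Fin m) → List W → Set (v ⊔ p)
  Ner α τ = Cyl α τ × LeftFree τ
  Uni α τ = Cyl α τ × RightFree τ
  Int ρ τ = Cyl (allFin m) (map inj₂ ρ ++ τ) × RightFree τ

  Acyclic : (List W → Set (v ⊔ p)) → ℕ → Set (c ⊔ ℓ ⊔ v ⊔ p)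
  Acyclic Q n = ∀ {y} → Supp (Q at n) y → ∂ y ∼ 𝟘 → ∃[ x ] Supp (Q at suc n) x × ∂ x ∼ y

  -- A linear map z ↦ ⟨ w ⟩ z from nerve cycles to cycles of X that is homologous to
  -- the inclusion of the nerve in the cylinder, both w and the homotopy T being
  -- carried by subfamilies.
  record Lift (n : ℕ) : Set (c ⊔ ℓ ⊔ v ⊔ p) where
    field
      T w    : Fin N → Λ
      T-supp : ∀ s → Supp (Cyl (σ s) at suc n) (T s)
      w-supp : ∀ s → Supp (Uni (σ s) at n) (w s)
      lift   : ∀ {z} → Supp (Ner (allFin m) at n) z → ∂ z ∼ 𝟘 →
               ∂ (⟨ T ⟩ z) ∼ z ⊕ ⊖ ⟨ w ⟩ z

  LeftFree-↭ : LeftFree Respects↭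
  LeftFree-↭ ρ τ ρ↭τ free =
    ↭-empty-inv (≡.subst (lefts τ ↭_) free (mapMaybe-↭ isInj₁ (↭-sym ρ↭τ)))

  Ner-↭ : ∀ α n → (Ner α at n) Respects↭
  Ner-↭ α n ρ τ ρ↭τ ((cyl , free) , len) =
    (Cyl-↭ ρ τ ρ↭τ cyl , LeftFree-↭ ρ τ ρ↭τ free) , ≡.trans (≡.sym (↭-length ρ↭τ)) len

  ⊆-allFin : ∀ {α : List (Fin m)} → α ⊆ allFin m
  ⊆-allFin {x = i} _ = ∈-allFin i

  Cyl⇒Face : ∀ {α} τ → Cyl α τ → Face (rights τ)
  Cyl⇒Face τ (_ , inj₁ (_ , face)) = face
  Cyl⇒Face τ (_ , inj₂ (_ , all))  = All⇒Face all

  Face⇒Simplex : ∀ {α n} → Face α → length α ≡ suc n → Simplex (nerve Γ) α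
  Face⇒Simplex (inj₂ face)   len = face
  Face⇒Simplex (inj₁ ≡.refl) ()

  Ner-allFin : ∀ {α n x} → Supp (Ner α at n) x → Supp (Ner (allFin m) at n) x
  Ner-allFin = supp-⊆ λ τ ((cyl , free) , len) → (Cyl-⊆ τ ⊆-allFin cyl , free) , len

  simplex-supp : ∀ s → Face (σ s) → Supp (Ner (σ s) at length (σ s)) (simplex s)
  simplex-supp s face = basis (map inj₂ (σ s))
    ((((λ {_} q → ≡.subst (_ ∈_) (rights-map (σ s)) q) ,
       inj₁ (lefts-map (σ s) , ≡.subst Face (≡.sym (rights-map (σ s))) face)) ,
      lefts-map (σ s)) , length-map inj₂ (σ s))

  ⟨⟩-Cyl : ∀ {α n k f z} → (∀ s → Supp (Cyl (σ s) at k) (f s)) →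
           Supp (Ner α at n) z → Supp (Cyl α at k) (⟨ f ⟩ z)
  ⟨⟩-Cyl {α} {n} h Z = ⟨⟩-supp-on (Ner-↭ α n) (λ _ → proj₂ ∘ proj₁) Z
    λ s (((⊆α , _) , _) , _) → supp-⊆
      (λ τ (cyl , len) →
        Cyl-⊆ τ (λ {_} q → ⊆α (≡.subst (_ ∈_) (≡.sym (rights-map (σ s))) q)) cyl , len)
      (h s)

  ⟨⟩-Uni : ∀ {α n k f z} → (∀ s → Supp (Uni (σ s) at k) (f s)) →
           Supp (Ner α at n) z → Supp (Uni α at k) (⟨ f ⟩ z)
  ⟨⟩-Uni {α} {n} h Z = ⟨⟩-supp-on (Ner-↭ α n) (λ _ → proj₂ ∘ proj₁) Z
    λ s (((⊆α , _) , _) , _) → supp-⊆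
      (λ τ ((cyl , free) , len) →
        (Cyl-⊆ τ (λ {_} q → ⊆α (≡.subst (_ ∈_) (≡.sym (rights-map (σ s))) q)) cyl , free) ,
        len)
      (h s)

  ∂-Ner : ∀ {α n z} → Supp (Ner α at suc n) z → Supp (Ner α at n) (∂ z)
  ∂-Ner = supp-∂ λ u τ ρ ((cyl , free) , len) ρ↭τ →
    (Cyl-face u τ ρ cyl ρ↭τ , lefts-free-∷ u τ ρ free ρ↭τ) , face-length len ρ↭τ

  Uni⇒Cyl : ∀ {α n x} → Supp (Uni α at n) x → Supp (Cyl α at n) x
  Uni⇒Cyl = supp-⊆ λ _ ((cyl , _) , len) → cyl , len

  Ner⇒Cyl : ∀ {α n x} → Supp (Ner α at n) x → Supp (Cyl α at n) x
  Ner⇒Cyl = supp-⊆ λ _ ((cyl , _) , len) → cyl , len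

  transpose : ∀ {a b d} → a ∼ b ⊕ ⊖ d → d ∼ b ⊕ ⊖ a
  transpose {a} {b} {d} p = ∼-trans
    (solve (b ∷ d ∷ []) v₁ (v₀ :+ :- (v₀ :+ :- v₁)) ≡.refl) (⊕-congˡ (⊖-cong (∼-sym p)))

  cycle-w : ∀ {t y z} → ∂ t ∼ z ⊕ ⊖ y → ∂ z ∼ 𝟘 → ∂ y ∼ 𝟘
  cycle-w {t} {y} {z} p ∂z∼0 = begin
    ∂ y              ≈⟨ IsLinear.cong ∂-linear (transpose p) ⟩
    ∂ z ⊕ ⊖ ∂ (∂ t)  ≈⟨ ⊕-cong ∂z∼0 (⊖-cong (ι-square _ t)) ⟩
    𝟘 ⊕ ⊖ 𝟘          ≈⟨ ⊖-inverseʳ 𝟘 ⟩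
    𝟘                ∎

  -- Chains on n vertices have degree n - 1, so for |σ| = n + 1 the premise is the vanishing in
  -- degree |σ| - 2 of condition (2).
  Lift-suc : ∀ {n} →
    (∀ s → Simplex (nerve Γ) (σ s) → length (σ s) ≡ suc n → Acyclic (Uni (σ s)) n) →
    Lift n → Lift (suc n)
  Lift-suc {n} acyclic L = record
    { T = T′ ; w = w′
    ; T-supp = λ s → proj₁ (proj₂ (proj₂ (new s)))
    ; w-supp = λ s → proj₁ (proj₂ (proj₂ (proj₂ (new s))))
    ; lift = lift′
    }
    where
    open Lift L

    b : Fin N → Λ
    b s = ∂ (simplex s)

    Good : Fin N → Set (v ⊔ p)
    Good s = Face (σ s) × length (σ s) ≡ suc n

    New : Fin N → Set (c ⊔ ℓ ⊔ v ⊔ p)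
    New s = Σ Λ λ t → Σ Λ λ y →
      Supp (Cyl (σ s) at suc (suc n)) t × Supp (Uni (σ s) at suc n) y ×
      (Good s → ∂ t ∼ (simplex s ⊕ ⊖ ⟨ T ⟩ (b s)) ⊕ ⊖ y)

    module _ (s : Fin N) (face : Simplex (nerve Γ) (σ s)) (len : length (σ s) ≡ suc n)
      where

      S : Supp (Ner (σ s) at suc n) (simplex s)
      S = ≡.subst (λ k → Supp (Ner (σ s) at k) (simplex s)) len (simplex-supp s (inj₂ face))

      B : Supp (Ner (σ s) at n) (b s)
      B = ∂-Ner S

      eq : ∂ (⟨ T ⟩ (b s)) ∼ b s ⊕ ⊖ ⟨ w ⟩ (b s)
      eq = lift (Ner-allFin B) (ι-square _ (simplex s))

      primitive-w : ∃[ y ] Supp (Uni (σ s) at suc n) y × ∂ y ∼ ⟨ w ⟩ (b s)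
      primitive-w = acyclic s face len (⟨⟩-Uni w-supp B)
        (cycle-w {⟨ T ⟩ (b s)} eq (ι-square _ (simplex s)))

      y = proj₁ primitive-w
      Y = proj₁ (proj₂ primitive-w)

      x = (simplex s ⊕ ⊖ ⟨ T ⟩ (b s)) ⊕ ⊖ y

      cycle-x : ∂ x ∼ 𝟘
      cycle-x = begin
        (b s ⊕ ⊖ ∂ (⟨ T ⟩ (b s))) ⊕ ⊖ ∂ y
          ≈⟨ ⊕-cong (⊕-congˡ (⊖-cong eq)) (⊖-cong (proj₂ (proj₂ primitive-w))) ⟩
        (b s ⊕ ⊖ (b s ⊕ ⊖ ⟨ w ⟩ (b s))) ⊕ ⊖ ⟨ w ⟩ (b s)
          ≈⟨ solve (b s ∷ ⟨ w ⟩ (b s) ∷ [])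
               ((v₀ :+ :- (v₀ :+ :- v₁)) :+ :- v₁) :0 ≡.refl ⟩
        𝟘 ∎

      build : New s
      build =
        let t , T′ , ∂t = Cyl-acyclic (σ s) face
              ((Ner⇒Cyl S ⊕ (R.- R.1#) · ⟨⟩-Cyl T-supp B) ⊕ (R.- R.1#) · Uni⇒Cyl Y)
              cycle-x
        in t , y , T′ , Y , λ _ → ∂t

    new : ∀ s → New s
    new s with em {P = Simplex (nerve Γ) (σ s) × length (σ s) ≡ suc n}
    ... | yes (face , len) = build s face len
    -- Zero is a safe value off the simplices of the right size: their coefficients vanish in nerve
    -- chains of this degree.
    ... | no  bad          = 𝟘 , 𝟘 , 𝟘 , 𝟘 , λ (face , len) →
      contradiction (Face⇒Simplex face len , len) bad

    T′ w′ : Fin N → Λ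
    T′ s = proj₁ (new s)
    w′ s = proj₁ (proj₂ (new s))

    lift′ : ∀ {z} → Supp (Ner (allFin m) at suc n) z → ∂ z ∼ 𝟘 →
            ∂ (⟨ T′ ⟩ z) ∼ z ⊕ ⊖ ⟨ w′ ⟩ z
    lift′ {z} Z ∂z∼0 = begin
      ∂ (⟨ T′ ⟩ z)
        ≈⟨ ⟨⟩-∘ ∂-linear T′ z ⟩
      ⟨ ∂ ∘ T′ ⟩ z
        ≈⟨ ⟨⟩-cong-on (Ner-↭ (allFin m) (suc n)) (λ _ → proj₂ ∘ proj₁) Z
             (λ s ((cyl , _) , len) → proj₂ (proj₂ (proj₂ (proj₂ (new s))))
               (≡.subst Face (rights-map (σ s)) (Cyl⇒Face (map inj₂ (σ s)) cyl) ,
                ≡.trans (≡.sym (length-map inj₂ (σ s))) len)) ⟩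
      ⟨ (λ s → (simplex s ⊕ ⊖ ⟨ T ⟩ (b s)) ⊕ ⊖ w′ s) ⟩ z
        ≈⟨ ∼-trans (⟨⟩-⊕ _ _ z) (⊕-cong (⟨⟩-⊕ _ _ z) (∼-sym (⟨⟩-∘ ⊖-linear w′ z))) ⟩
      (⟨ simplex ⟩ z ⊕ ⟨ (λ s → ⊖ ⟨ T ⟩ (b s)) ⟩ z) ⊕ ⊖ ⟨ w′ ⟩ z
        ≈⟨ ⊕-congʳ (⊕-congˡ (⟨⟩-∘ (∘-linear ⊖-linear (∘-linear (⟨⟩-linear T) ∂-linear))
             simplex z)) ⟨
      (⟨ simplex ⟩ z ⊕ ⊖ ⟨ T ⟩ (∂ (⟨ simplex ⟩ z))) ⊕ ⊖ ⟨ w′ ⟩ z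
        -- The old homotopy enters only through its value on `∂ z`, which is zero.
        ≈⟨ ⊕-congʳ (⊕-cong z∼ (⊖-cong (IsLinear.≈0 (⟨⟩-linear T)
             (∼-trans (IsLinear.cong ∂-linear z∼) ∂z∼0)))) ⟩
      (z ⊕ ⊖ 𝟘) ⊕ ⊖ ⟨ w′ ⟩ z
        ≈⟨ solve (z ∷ ⟨ w′ ⟩ z ∷ []) ((v₀ :+ :- :0) :+ :- v₁) (v₀ :+ :- v₁) ≡.refl ⟩
      z ⊕ ⊖ ⟨ w′ ⟩ z ∎
      where
      ⊖-linear : Endo ⊖_
      ⊖-linear = ·-linear _ id-linear
      z∼ : ⟨ simplex ⟩ z ∼ z
      z∼ = ⟨⟩-simplex (Ner-↭ (allFin m) (suc n)) (λ _ → proj₂ ∘ proj₁) Z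

  -- The base degree: removal of the indices

  -- Lift K with w replaced by a family still having up to q indices per simplex.
  record Partial (K q : ℕ) : Set (c ⊔ ℓ ⊔ v ⊔ p) where
    field
      T E    : Fin N → Λ
      T-supp : ∀ s → Supp (Cyl (σ s) at suc K) (T s)
      E-supp : ∀ s → Supp ((λ τ → Cyl (σ s) τ × length (rights τ) ℕ.≤ q) at K) (E s)
      lift   : ∀ {z} → Supp (Ner (allFin m) at K) z → ∂ z ∼ 𝟘 →
               ∂ (⟨ T ⟩ z) ∼ z ⊕ ⊖ ⟨ E ⟩ z

  -- The inclusion of the nerve is homotopic to itself by zero. Values off the simplices of size `K`
  -- are set to zero so that the support conditions hold for every `s`.
  partial-start : ∀ K → Partial K K
  partial-start K = record
    { T      = λ _ → 𝟘
    ; E      = E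
    ; T-supp = λ _ → 𝟘
    ; E-supp = E-supp
    ; lift   = λ {z} Z _ → begin
        ∂ (⟨ (λ _ → 𝟘) ⟩ z)
          ≈⟨ IsLinear.≈0 ∂-linear (sum-0 {N} λ s → ·-zeroʳ _) ⟩
        𝟘
          ≈⟨ ⊖-inverseʳ z ⟨
        z ⊕ ⊖ z
          ≈⟨ ⊕-congˡ (⊖-cong (∼-trans (⟨⟩-cong-on (Ner-↭ (allFin m) K) (λ _ → proj₂ ∘ proj₁)
               Z (λ s ((cyl , _) , len) → E-good s
                 (≡.subst Face (rights-map (σ s)) (Cyl⇒Face (map inj₂ (σ s)) cyl))
                 (≡.trans (≡.sym (length-map inj₂ (σ s))) len)))
               (⟨⟩-simplex (Ner-↭ (allFin m) K) (λ _ → proj₂ ∘ proj₁) Z))) ⟨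
        z ⊕ ⊖ ⟨ E ⟩ z ∎
    }
    where
    E : Fin N → Λ
    E s with em {P = Face (σ s) × length (σ s) ≡ K}
    ... | yes _ = simplex s
    ... | no  _ = 𝟘

    E-good : ∀ s → Face (σ s) → length (σ s) ≡ K → E s ∼ simplex s
    E-good s face len with em {P = Face (σ s) × length (σ s) ≡ K}
    ... | yes _   = ∼-refl
    ... | no  bad = contradiction (face , len) bad

    E-supp : ∀ s → Supp ((λ τ → Cyl (σ s) τ × length (rights τ) ℕ.≤ K) at K) (E s)
    E-supp s with em {P = Face (σ s) × length (σ s) ≡ K}
    ... | no  _            = 𝟘
    ... | yes (face , len) = supp-⊆
      (λ τ ((cyl , _) , len′) → (cyl ,
          ℕ.≤-trans (length-mapMaybe isInj₂ τ) (ℕ.≤-reflexive (≡.trans len′ len))) ,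
        ≡.trans len′ len)
      (simplex-supp s face)

  partial-end : ∀ {K} → Partial K 0 → Lift K
  partial-end P = record
    { T = T ; w = E ; T-supp = T-supp ; lift = lift
    ; w-supp = λ s → supp-⊆
        (λ { τ ((cyl , ≤0) , len) → (cyl , empty (rights τ) ≤0) , len }) (E-supp s)
    }
    where
    open Partial P
    empty : ∀ (ρ : List (Fin m)) → length ρ ℕ.≤ 0 → ρ ≡ []
    empty [] _ = ≡.refl

  -- The power of -1 with exponent |ρ|, the sign that `∂` picks up in passing `ρ`.
  sign : List (Fin m) → R.Carrier
  sign []      = R.1#
  sign (i ∷ ρ) = (R.- R.1#) R.* sign ρ

  -- Up to sign, the part of the boundary of the join ρ * x that removes an element of ρ.
  shave : List (Fin m) → Λ → Λ
  shave ρ x = sign ρ · ∂ (eᵣ ρ x) ⊕ ⊖ eᵣ ρ (∂ x)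

  shave-linear : ∀ ρ → Endo (shave ρ)
  shave-linear ρ = ⊕-linear (·-linear _ (∘-linear ∂-linear (eᵣ-linear ρ)))
    (·-linear _ (∘-linear (eᵣ-linear ρ) ∂-linear))

  shave-[] : ∀ x → shave [] x ∼ 𝟘
  shave-[] x = ∼-trans (⊕-congʳ (·-identityˡ _)) (⊖-inverseʳ (∂ x))

  shave-∷ : ∀ i ρ x → shave (i ∷ ρ) x ∼ ⊖ (sign ρ · eᵣ ρ x) ⊕ e (inj₂ i) (shave ρ x)
  shave-∷ i ρ x = begin
    ((R.- R.1#) R.* sign ρ) · ∂ (e (inj₂ i) y) ⊕ ⊖ e (inj₂ i) (eᵣ ρ (∂ x))
      ≈⟨ ⊕-congʳ (∼-trans (·-assoc _ (sign ρ) _) (⊖-cong (·-congˡ (∂-e (inj₂ i) y)))) ⟩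
    ⊖ (sign ρ · (y ⊕ ⊖ e (inj₂ i) (∂ y))) ⊕ ⊖ e (inj₂ i) (eᵣ ρ (∂ x))
      ≈⟨ ⊕-congʳ (⊖-cong (∼-trans (·-distribˡ _ _ _) (⊕-congˡ (·-⊖ (sign ρ) _)))) ⟩
    ⊖ (sign ρ · y ⊕ ⊖ (sign ρ · e (inj₂ i) (∂ y))) ⊕ ⊖ e (inj₂ i) (eᵣ ρ (∂ x))
      ≈⟨ solve (sign ρ · y ∷ sign ρ · e (inj₂ i) (∂ y) ∷ e (inj₂ i) (eᵣ ρ (∂ x)) ∷ [])
           (:- (v₀ :+ :- v₁) :+ :- v₂) (:- v₀ :+ (v₁ :+ :- v₂)) ≡.refl ⟩
    ⊖ (sign ρ · y) ⊕ (sign ρ · e (inj₂ i) (∂ y) ⊕ ⊖ e (inj₂ i) (eᵣ ρ (∂ x)))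
      ≈⟨ ⊕-congˡ (∼-trans (e-⊕ _ _ _) (⊕-cong (e-· _ _ _) (e-· _ _ _))) ⟨
    ⊖ (sign ρ · y) ⊕ e (inj₂ i) (shave ρ x) ∎
    where y = eᵣ ρ x

  eᵣ-supp : ∀ {q} {Q : List W → Set q} ρ {x} → Supp Q x →
            Supp (λ τ → Σ (List W) λ τ′ → Q τ′ × τ ≡ map inj₂ ρ ++ τ′) (eᵣ ρ x)
  eᵣ-supp []      X = supp-⊆ (λ τ Qτ → τ , Qτ , ≡.refl) X
  eᵣ-supp (i ∷ ρ) X = supp-e (inj₂ i)
    (λ { _ (τ′ , Qτ′ , ≡.refl) → τ′ , Qτ′ , ≡.refl }) (eᵣ-supp ρ X)

  shave-supp : ∀ {q} {Q : List W → Set q} ρ {x} → Supp Q x →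
    Supp (λ τ → Σ (List W) λ τ′ → Σ (Fin m) λ i → Q τ′ × inj₂ i ∷ τ ↭ map inj₂ ρ ++ τ′)
         (shave ρ x)
  shave-supp []      {x} X = resp (∼-sym (shave-[] x)) 𝟘
  shave-supp (i ∷ ρ) {x} X = resp (∼-sym (shave-∷ i ρ x))
    ((R.- R.1#) · sign ρ · supp-⊆ (λ { _ (τ′ , Qτ′ , ≡.refl) → τ′ , i , Qτ′ , ↭-refl })
       (eᵣ-supp ρ X) ⊕
     supp-e (inj₂ i) (λ τ (τ′ , k , Qτ′ , perm) → τ′ , k , Qτ′ ,
       ↭-trans (swap _ _ ↭-refl) (prep _ perm)) (shave-supp ρ X))

  Int-face : ∀ ρ τ → Int ρ τ → Face ρ
  Int-face ρ τ (cyl , _) = Face-⊆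
    (λ {_} q → ≡.subst (_ ∈_) (≡.sym (rights-++ ρ τ)) (xs⊆xs++ys ρ (rights τ) q))
    (Cyl⇒Face (map inj₂ ρ ++ τ) cyl)

  -- `Int` is phrased with all indices available. For nonempty `ρ`, a member with index in `ρ`
  -- already contains a nonempty left part, so any `α` containing `ρ` suffices.
  Int-Cyl : ∀ {α} ρ τ → ρ ≢ [] → ρ ⊆ α → Int ρ τ → Cyl α (map inj₂ ρ ++ τ)
  Int-Cyl {α} ρ τ ρ≢[] ρ⊆α ((_ , s) , free) = ⊆α , go s
    where
    rights≡ : rights (map inj₂ ρ ++ τ) ≡ ρ
    rights≡ = ≡.trans (rights-++ ρ τ) (≡.trans (≡.cong (ρ ++_) free) (++-identityʳ ρ))

    ⊆α : rights (map inj₂ ρ ++ τ) ⊆ α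
    ⊆α {i} q = ρ⊆α (≡.subst (i ∈_) rights≡ q)

    any : ∀ {P : Fin m → Set p} {ρ} → ρ ≢ [] → All P ρ → Any P ρ
    any ρ≢[] []       = contradiction ≡.refl ρ≢[]
    any ρ≢[] (px ∷ _) = here px

    go : _ → _
    go (inj₁ s)         = inj₁ s
    go (inj₂ (_ , all)) =
      inj₂ (Any-resp-⊆ ρ⊆α (any ρ≢[] (≡.subst (All _) rights≡ all)) , all)

  length-++-map : ∀ ρ (τ : List W) → length (map inj₂ ρ ++ τ) ≡ length ρ ℕ.+ length τ
  length-++-map ρ τ = ≡.trans (length-++ (map inj₂ ρ)) (≡.cong (ℕ._+ length τ) (length-map inj₂ ρ))

  module _ {q r : ℕ}
    (acyclic : ∀ t → Simplex (nerve Γ) (σ t) → length (σ t) ≡ suc q → Acyclic (Int (σ t)) r)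
    (P : Partial (suc q ℕ.+ r) (suc q))
    where

    private
      open Partial P

      K : ℕ
      K = suc q ℕ.+ r

      Low′ : ℕ → Fin N → List W → Set (v ⊔ p)
      Low′ k s τ = Cyl (σ s) τ × length (rights τ) ℕ.≤ k

      Low′-↭ : ∀ k s → (Low′ k s at K) Respects↭
      Low′-↭ k s ρ τ ρ↭τ ((cyl , ≤k) , len) =
        (Cyl-↭ ρ τ ρ↭τ cyl ,
         ℕ.≤-trans (ℕ.≤-reflexive (↭-length (mapMaybe-↭ isInj₂ (↭-sym ρ↭τ)))) ≤k) ,
        ≡.trans (↭-length (↭-sym ρ↭τ)) len

      Cycle′ : Λ → Set (c ⊔ ℓ ⊔ v ⊔ p)
      Cycle′ z = Supp (Ner (allFin m) at K) z × ∂ z ∼ 𝟘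

      -- Modulo a boundary, the component along `σ t` is replaced by words with at most `q` indices.
      -- This holds for cycles `z` only, although `G` and `H` are tables of values on single
      -- simplices.
      record Correction (t : Fin N) : Set (c ⊔ ℓ ⊔ v ⊔ p) where
        field
          G H    : Fin N → Λ
          G-supp : ∀ s → Supp (Cyl (σ s) at suc K) (G s)
          H-supp : ∀ s → Supp (Low′ q s at K) (H s)
          eq     : ∀ {z} → Cycle′ z →
                   eᵣ (σ t) (component (σ t) (⟨ E ⟩ z)) ∼ ⟨ H ⟩ z ⊕ ∂ (⟨ G ⟩ z)

      length-rights : ∀ ρ τ → RightFree τ → length (rights (map inj₂ ρ ++ τ)) ≡ length ρ
      length-rights ρ τ free = ≡.cong length
        (≡.trans (rights-++ ρ τ) (≡.trans (≡.cong (ρ ++_) free) (++-identityʳ ρ)))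

      -- Words of `E s` have at most `q + 1` indices, so along a `σ t` of any other size the
      -- component either vanishes or already belongs to at most `q` indices.
      trivial : ∀ t → length (σ t) ≢ suc q → Correction t
      trivial t len≢ = record
        { G = λ _ → 𝟘
        ; H = λ s → eᵣ (σ t) (component (σ t) (E s))
        ; G-supp = λ _ → 𝟘
        ; H-supp = λ s → supp-⊆
            (λ { _ (τ′ , (((cyl , ≤q) , len) , free) , ≡.refl) →
              let |ρ| = length-rights (σ t) τ′ free in
              (cyl , ℕ.≤-trans (ℕ.≤-reflexive |ρ|)
                (s≤s⁻¹ (ℕ.≤∧≢⇒< (ℕ.≤-trans (ℕ.≤-reflexive (≡.sym |ρ|)) ≤q) len≢))) , len })
            (eᵣ-supp (σ t) (supp-component (Low′-↭ (suc q) s) (σ t) (E-supp s)))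
        ; eq = λ {z} _ → ∼-trans
            (⟨⟩-∘ (∘-linear (eᵣ-linear (σ t)) (component-linear (σ t))) E z)
            (∼-sym (∼-trans
              (⊕-congˡ (IsLinear.≈0 ∂-linear (sum-0 {N} λ s → ·-zeroʳ _)))
              (⊕-identityʳ _)))
        }

      module _ (t : Fin N) (len : length (σ t) ≡ suc q) where

        component-Int : ∀ s → Supp (λ τ → (Int (σ t) at r) τ × σ t ⊆ σ s)
                                   (component (σ t) (E s))
        component-Int s = supp-⊆
          (λ τ (((cyl , _) , lenτ) , free) →
            ((Cyl-⊆ (map inj₂ (σ t) ++ τ) ⊆-allFin cyl , free) ,
             ℕ.+-cancelˡ-≡ (suc q) _ _
               (≡.trans (≡.cong (ℕ._+ length τ) (≡.sym len))
                 (≡.trans (≡.sym (length-++-map (σ t) τ)) lenτ))) ,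
            λ {_} i∈ → proj₁ cyl (≡.subst (_ ∈_) (≡.sym (rights-++ (σ t) τ))
              (xs⊆xs++ys (σ t) (rights τ) i∈)))
          (supp-component (Low′-↭ (suc q) s) (σ t) (E-supp s))

        Section : Set (c ⊔ ℓ ⊔ v ⊔ p)
        Section = Σ (Fin N → Λ) λ a →
          (∀ s → Supp (Int (σ t) at suc r) (a s)) ×
          (∀ s → component (σ t) (E s) ∼ 𝟘 → a s ∼ 𝟘) ×
          (∀ {z} → ∂ (⟨ component (σ t) ∘ E ⟩ z) ∼ 𝟘 →
             ∂ (⟨ a ⟩ z) ∼ ⟨ component (σ t) ∘ E ⟩ z)

        section : Section
        section with em {P = Face (σ t)}
        ... | yes face =
          let a , a-supp , a≈0 , lifts = FiniteSection.finite-section em {F = F}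
                ∂-linear ∂-linear
                (supp-subspace {Q = Int (σ t) at suc r}) (supp-subspace {Q = Int (σ t) at r})
                (λ _ → acyclic t (Face⇒Simplex face len) len)
                N (component (σ t) ∘ E) (λ s → supp-⊆ (λ _ → proj₁) (component-Int s))
          in a , a-supp , a≈0 , λ {z} → lifts (λ s → coefficient s z)
        -- Outside the nerve there is no acyclicity to use, but the components vanish there.
        ... | no ¬face = (λ _ → 𝟘) , (λ _ → 𝟘) , (λ _ _ → ∼-refl) , λ {z} _ →
          ∼-trans (IsLinear.≈0 ∂-linear (sum-0 {N} λ s → ·-zeroʳ _))
            (∼-sym (sum-0 {N} λ s → ∼-trans (·-congˡ (supp-empty
              (λ τ ((int , _) , _) → ¬face (Int-face (σ t) τ int)) (component-Int s)))
              (·-zeroʳ _)))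

        a : Fin N → Λ
        a = proj₁ section

        -- If `σ t` is not contained in `σ s`, then `E s` has no component along `σ t`, and the
        -- section sends zero to zero.
        a-supp : ∀ s → Supp (λ τ → (Int (σ t) at suc r) τ × σ t ⊆ σ s) (a s)
        a-supp s with em {P = σ t ⊆ σ s}
        ... | yes ⊆s = supp-⊆ (λ τ int → int , λ {_} → ⊆s) (proj₁ (proj₂ section) s)
        ... | no ¬⊆s = resp (∼-sym (proj₁ (proj₂ (proj₂ section)) s
          (supp-empty (λ τ (_ , ⊆s) → ¬⊆s ⊆s) (component-Int s)))) 𝟘

        -- Words of `⟨ E ⟩ z` have at most `q + 1` indices, so contracting all of `σ t` leaves none.
        -- Hence the component is a plain contraction of the cycle `⟨ E ⟩ z` and is itself a cycle.
        ∂-a : ∀ {z} → Cycle′ z → ∂ (⟨ a ⟩ z) ∼ component (σ t) (⟨ E ⟩ z)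
        ∂-a {z} (Z , ∂z∼0) = ∼-trans
          (proj₂ (proj₂ (proj₂ section)) (∼-trans (IsLinear.cong ∂-linear (∼-sym comp))
            (∼-trans (IsLinear.cong ∂-linear (component-ιᵣ (σ t) right-free))
              (ιᵣ-cycle (σ t) (cycle-w {⟨ T ⟩ z} (lift Z ∂z∼0) ∂z∼0)))))
          (∼-sym comp)
          where
          comp : component (σ t) (⟨ E ⟩ z) ∼ ⟨ component (σ t) ∘ E ⟩ z
          comp = ⟨⟩-∘ (component-linear (σ t)) E z

          few-rights : (λ τ → length (rights τ) ℕ.≤ suc q) Respects↭
          few-rights ρ τ ρ↭τ ≤q =
            ℕ.≤-trans (ℕ.≤-reflexive (↭-length (mapMaybe-↭ isInj₂ (↭-sym ρ↭τ)))) ≤q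

          empty : ∀ {A : Set} k (τ : List A) → k ℕ.+ length τ ℕ.≤ k → τ ≡ []
          empty zero    []      _       = ≡.refl
          empty (suc k) τ       (s≤s h) = empty k τ h

          right-free : Supp RightFree (ιᵣ (σ t) (⟨ E ⟩ z))
          right-free = supp-⊆
            (λ τ ≤q → empty (suc q) (rights τ) (ℕ.≤-trans (ℕ.≤-reflexive
              (≡.trans (≡.cong (ℕ._+ length (rights τ)) (≡.sym len))
                (≡.trans (≡.sym (length-++ (σ t)))
                  (≡.cong length (≡.sym (rights-++ (σ t) τ)))))) ≤q))
            (supp-ιᵣ few-rights (σ t)
              (⟨⟩-supp (λ s → supp-⊆ (λ _ ((_ , ≤q) , _) → ≤q) (E-supp s)) z))

        σ≢[] : σ t ≢ []
        σ≢[] eq with () ← ≡.trans (≡.sym len) (≡.cong length eq)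

        length-join : ∀ τ → length τ ≡ suc r → length (map inj₂ (σ t) ++ τ) ≡ suc K
        length-join τ lenτ = ≡.trans (length-++-map (σ t) τ)
          (≡.trans (≡.cong₂ ℕ._+_ len lenτ) (ℕ.+-suc (suc q) r))

        -- The Leibniz rule: `eᵣ ρ (∂ a)` is the boundary of `sign ρ · eᵣ ρ a` up to `shave ρ a`,
        -- whose words have one index fewer.
        correct : Correction t
        correct = record
          { G = λ s → sign (σ t) · eᵣ (σ t) (a s)
          ; H = λ s → ⊖ shave (σ t) (a s)
          ; G-supp = λ s → sign (σ t) · supp-⊆
              (λ { _ (τ , ((int , lenτ) , ⊆s) , ≡.refl) →
                Int-Cyl (σ t) τ σ≢[] ⊆s int , length-join τ lenτ })
              (eᵣ-supp (σ t) (a-supp s))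
          ; H-supp = λ s → (R.- R.1#) · supp-⊆
              (λ τ′ (τ , i , ((int , lenτ) , ⊆s) , perm) →
                (Cyl-face (inj₂ i) (map inj₂ (σ t) ++ τ) τ′
                   (Int-Cyl (σ t) τ σ≢[] ⊆s int) perm ,
                 ℕ.≤-reflexive (ℕ.suc-injective (≡.trans (↭-length (mapMaybe-↭ isInj₂ perm))
                   (≡.trans (length-rights (σ t) τ (proj₂ int)) len)))) ,
                face-length (length-join τ lenτ) perm)
              (shave-supp (σ t) (a-supp s))
          ; eq = λ {z} Z → begin
              eᵣ (σ t) (component (σ t) (⟨ E ⟩ z))
                ≈⟨ IsLinear.cong (eᵣ-linear (σ t)) (∂-a Z) ⟨
              eᵣ (σ t) (∂ (⟨ a ⟩ z))
                ≈⟨ solve (sign (σ t) · ∂ (eᵣ (σ t) (⟨ a ⟩ z)) ∷ eᵣ (σ t) (∂ (⟨ a ⟩ z)) ∷ [])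
                     v₁ (:- (v₀ :+ :- v₁) :+ v₀) ≡.refl ⟩
              ⊖ shave (σ t) (⟨ a ⟩ z) ⊕ sign (σ t) · ∂ (eᵣ (σ t) (⟨ a ⟩ z))
                ≈⟨ ⊕-cong (⟨⟩-∘ (·-linear _ (shave-linear (σ t))) a z)
                     (IsLinear.cong ∂-linear
                       (⟨⟩-∘ (·-linear (sign (σ t)) (eᵣ-linear (σ t))) a z)) ⟩
              ⟨ (λ s → ⊖ shave (σ t) (a s)) ⟩ z ⊕
                ∂ (⟨ (λ s → sign (σ t) · eᵣ (σ t) (a s)) ⟩ z) ∎
          }

      correction : ∀ t → Correction t
      correction t with length (σ t) ℕ.≟ suc q
      ... | yes len  = correct t len
      ... | no  len≢ = trivial t len≢

      module Corr t = Correction (correction t)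

    -- All components are corrected simultaneously. Those of size `q + 1` lose an index, by
    -- acyclicity in degree r - 1, and the chains `G` join the homotopy.
    partial-step : Partial (suc q ℕ.+ r) q
    partial-step = record
      { T = λ s → T s ⊕ sum {N} (λ t → Corr.G t s)
      ; E = λ s → sum {N} (λ t → Corr.H t s)
      ; T-supp = λ s → T-supp s ⊕ supp-sum {n = N} (λ t → Corr.G-supp t s)
      ; E-supp = λ s → supp-sum {n = N} (λ t → Corr.H-supp t s)
      ; lift = λ {z} Z ∂z∼0 →
          let ΣG  = sum {N} (λ t → ∂ (⟨ Corr.G t ⟩ z))
              ΣH  = sum {N} (λ t → ⟨ Corr.H t ⟩ z) in begin
          ∂ (⟨ (λ s → T s ⊕ sum {N} (λ t → Corr.G t s)) ⟩ z)
            ≈⟨ IsLinear.cong ∂-linear (∼-trans (⟨⟩-⊕ T _ z) (⊕-congˡ (⟨⟩-sum {N} Corr.G z))) ⟩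
          ∂ (⟨ T ⟩ z) ⊕ ∂ (sum {N} (λ t → ⟨ Corr.G t ⟩ z))
            ≈⟨ ⊕-cong (lift Z ∂z∼0) (IsLinear.sum-homo ∂-linear {N} _) ⟩
          (z ⊕ ⊖ ⟨ E ⟩ z) ⊕ ΣG
            ≈⟨ ⊕-congʳ (⊕-congˡ (⊖-cong (∼-trans (decomposition (⟨ E ⟩ z))
                 (∼-trans (sum-cong {N} λ t → Corr.eq t (Z , ∂z∼0)) (sum-⊕ {N} _ _))))) ⟩
          (z ⊕ ⊖ (ΣH ⊕ ΣG)) ⊕ ΣG
            ≈⟨ solve (z ∷ ΣH ∷ ΣG ∷ []) ((v₀ :+ :- (v₁ :+ v₂)) :+ v₂) (v₀ :+ :- v₁) ≡.refl ⟩
          z ⊕ ⊖ ΣH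
            ≈⟨ ⊕-congˡ (⊖-cong (⟨⟩-sum {N} Corr.H z)) ⟨
          z ⊕ ⊖ ⟨ (λ s → sum {N} (λ t → Corr.H t s)) ⟩ z ∎
      }

-- Return to homology

module Comparison
  (em : ∀ {a} → ExcludedMiddle a)
  {c ℓ v p : Level} (F : Field c ℓ) {V : Set v} (X : SimplicialComplex V p)
  {m : ℕ} (Γ : Fin m → Subcomplex X) (cover : ⋃ Γ (allFin m) ≐ X)
  where

  open Lifting em F X Γ

  module OnV (K : SimplicialComplex V p) =
    Embedding em F W (λ _ _ → em) inj₁ isInj₁ (λ _ → ≡.refl) K
  module OnNerve =
    Embedding em F W (λ _ _ → em) inj₂ isInj₂ (λ _ → ≡.refl) (nerve Γ)

  homologyAt : ℕ → ∀ {u q} {U : Set u} (K : SimplicialComplex U q) → VectorSpace F _ _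
  homologyAt n K = ChainComplex.homologyAt F K n

  private
    module X = OnV X
    module CX = ChainComplex F X
    module CN = ChainComplex F (nerve Γ)

    rightFree-map : ∀ τ → RightFree τ → map inj₁ (lefts τ) ≡ τ
    rightFree-map []            _    = ≡.refl
    rightFree-map (inj₁ x ∷ τ) free = ≡.cong (inj₁ x ∷_) (rightFree-map τ free)

    leftFree-map : ∀ τ → LeftFree τ → map inj₂ (rights τ) ≡ τ
    leftFree-map []            _    = ≡.refl
    leftFree-map (inj₂ i ∷ τ) free = ≡.cong (inj₂ i ∷_) (leftFree-map τ free)

    lefts-inj₁ : ∀ τ → lefts (map inj₁ τ) ≡ τ
    lefts-inj₁ = mapMaybeIsInj₁∘mapInj₁

    rights-inj₁ : ∀ τ → rights (map inj₁ τ) ≡ []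
    rights-inj₁ = mapMaybeIsInj₂∘mapInj₁

    to-image : ∀ {K n} τ → RightFree τ → length τ ≡ n →
               (lefts τ ≡ [] ⊎ Simplex K (lefts τ)) → OnV.Image K n τ
    to-image {K} {n} τ free len s = ≡.subst (OnV.Image K n) eq (OnV.image-intro K (lefts τ)
      (≡.trans (≡.sym (length-map inj₁ (lefts τ))) (≡.trans (≡.cong length eq) len)) s)
      where eq = rightFree-map τ free

    exact-from-image : ∀ {K n} {Q : List W → Set (v ⊔ p)} →
      (∀ n τ → (Q at n) τ → OnV.Image K n τ) → (∀ n τ → OnV.Image K n τ → (Q at n) τ) →
      IsZero (homologyAt n K) → Acyclic Q n
    exact-from-image {K} {n} to from zero-homology Y ∂y∼0 =
      let x , supp-x , ∂x = OnV.embed-exact K zero-homology (supp-⊆ (to n) Y) ∂y∼0 in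
      x , supp-⊆ (from (suc n)) supp-x , ∂x

    -- `K` is the union of a subfamily for condition (2), and X itself for the whole family, where
    -- `cover` supplies `h`.
    Uni-to : ∀ {K} α → (∀ {τ} → Simplex (⋃ Γ α) τ → Simplex K τ) →
             ∀ n τ → (Uni α at n) τ → OnV.Image K n τ
    Uni-to {K} α h n τ (((_ , s) , free) , len) = to-image {K} τ free len (go s)
      where
      go : _ → lefts τ ≡ [] ⊎ Simplex K (lefts τ)
      go (inj₁ (eq , _))  = inj₁ eq
      go (inj₂ (any , _)) = inj₂ (h any)

    Uni-from : ∀ {K} α → (∀ {τ} → Simplex K τ → Simplex (⋃ Γ α) τ) →
               ∀ n τ → OnV.Image K n τ → (Uni α at n) τ
    Uni-from {K} α h n τ image
      with ρ , ≡.refl , len , s ← OnV.image-elim K image =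
      (((λ {_} q → ⊆-[] (≡.subst (_ ∈_) (rights-inj₁ ρ) q)) , go s) , rights-inj₁ ρ) ,
      ≡.trans (length-map inj₁ ρ) len
      where
      ⊆-[] : ∀ {i} → i ∈ [] → i ∈ α
      ⊆-[] ()
      go : ρ ≡ [] ⊎ Simplex K ρ → Join α (lefts (map inj₁ ρ)) (rights (map inj₁ ρ))
      go s = ≡.subst₂ (Join α) (≡.sym (lefts-inj₁ ρ)) (≡.sym (rights-inj₁ ρ)) (join s)
        where
        join : ρ ≡ [] ⊎ Simplex K ρ → Join α ρ []
        join (inj₁ eq) = inj₁ (eq , inj₁ ≡.refl)
        join (inj₂ s)  = inj₂ (h s , [])

    Int-to : ∀ {ρ} → Simplex (nerve Γ) ρ → ∀ n τ → (Int ρ at n) τ → OnV.Image (⋂ Γ ρ) n τ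
    Int-to {ρ} ρ∈N n τ (((_ , s) , free) , len) = to-image {⋂ Γ ρ} τ free len (go s)
      where
      go : _ → lefts τ ≡ [] ⊎ Simplex (⋂ Γ ρ) (lefts τ)
      go (inj₁ (eq , _))    = inj₁ (≡.trans (≡.sym (lefts-++ ρ τ)) eq)
      go (inj₂ (any , all)) = inj₂
        (included (Γ (proj₁ i)) (≡.subst (_∈Γ proj₁ i) (lefts-++ ρ τ) (proj₂ i)) ,
         All.map (λ {i} → ≡.subst (_∈Γ i) (lefts-++ ρ τ))
           (All-resp-⊇ (λ {_} q → ≡.subst (_ ∈_) (≡.sym (rights-++ ρ τ)) (xs⊆xs++ys ρ _ q))
             all))
        where i = Any.satisfied any

    Int-from : ∀ {ρ} → Simplex (nerve Γ) ρ → ∀ n τ → OnV.Image (⋂ Γ ρ) n τ → (Int ρ at n) τ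
    Int-from {ρ} ρ∈N n τ image
      with χ , ≡.refl , len , s ← OnV.image-elim (⋂ Γ ρ) image =
      (((λ {i} _ → ∈-allFin i) ,
        ≡.subst₂ (Join (allFin m)) (≡.sym lefts≡) (≡.sym rights≡) (go s)) ,
       rights-inj₁ χ) , ≡.trans (length-map inj₁ χ) len
      where
      lefts≡ : lefts (map inj₂ ρ ++ map inj₁ χ) ≡ χ
      lefts≡ = ≡.trans (lefts-++ ρ _) (lefts-inj₁ χ)

      rights≡ : rights (map inj₂ ρ ++ map inj₁ χ) ≡ ρ
      rights≡ = ≡.trans (rights-++ ρ _)
        (≡.trans (≡.cong (ρ ++_) (rights-inj₁ χ)) (++-identityʳ ρ))

      any : ∀ {ρ} → ρ ≢ [] → All (χ ∈Γ_) ρ → Any (χ ∈Γ_) (allFin m)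
      any {[]}    ρ≢[] _         = contradiction ≡.refl ρ≢[]
      any {i ∷ _} ρ≢[] (χ∈i ∷ _) = Any.map (λ { ≡.refl → χ∈i }) (∈-allFin i)

      go : χ ≡ [] ⊎ Simplex (⋂ Γ ρ) χ → Join (allFin m) χ ρ
      -- The empty simplex of the intersection corresponds to the word `ρ`, which must itself be a
      -- face.
      go (inj₁ eq)        = inj₁ (eq , inj₂ ρ∈N)
      go (inj₂ (_ , all)) = inj₂ (any (proj₁ ρ∈N) all , all)

    Ner-to : ∀ n τ → (Ner (allFin m) at n) τ → OnNerve.Image n τ
    Ner-to n τ ((cyl , free) , len) = ≡.subst (OnNerve.Image n) eq (OnNerve.image-intro
      (rights τ)
      (≡.trans (≡.sym (length-map inj₂ (rights τ))) (≡.trans (≡.cong length eq) len))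
      (Cyl⇒Face τ cyl))
      where eq = leftFree-map τ free

    Ner-from : ∀ n τ → OnNerve.Image n τ → (Ner (allFin m) at n) τ
    Ner-from n τ image with ρ , ≡.refl , len , s ← OnNerve.image-elim image =
      (((λ {i} _ → ∈-allFin i) ,
        inj₁ (lefts-map ρ , ≡.subst Face (≡.sym (rights-map ρ)) s)) , lefts-map ρ) ,
      ≡.trans (length-map inj₂ ρ) len

  module _ (K : ℕ)
    (intersections : (σ : SimplexOf (nerve Γ)) → ∀ r → card σ ℕ.+ r ≡ K →
                     IsZero (homologyAt r (⋂ Γ (vertices σ))))
    where

    -- With K = k + 1 and r = K - |σ|, the premise is the vanishing in degree k - |σ|. The invariant
    -- `q + r ≡ K` of `go` supplies this `r` for the sets of size `q`.
    lift-base : Lift K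
    lift-base = go K 0 (ℕ.+-identityʳ K) (partial-start K)
      where
      acyclic : ∀ t → Simplex (nerve Γ) (σ t) → ∀ r → length (σ t) ℕ.+ r ≡ K →
                Acyclic (Int (σ t)) r
      acyclic t σ∈N r eq = exact-from-image {⋂ Γ (σ t)} (Int-to σ∈N) (Int-from σ∈N)
        (intersections record { vertices = σ t ; unique = σ-unique t ; isSimplex = σ∈N } r eq)

      go : ∀ q r → q ℕ.+ r ≡ K → Partial K q → Lift K
      go zero    r eq P = partial-end P
      go (suc q) r eq P = go q (suc r) (≡.trans (ℕ.+-suc q r) eq)
        (≡.subst (λ k → Partial k q) eq (partial-step
          (λ t σ∈N len → acyclic t σ∈N r (≡.trans (≡.cong (ℕ._+ r) len) eq))
          (≡.subst (λ k → Partial k (suc q)) (≡.sym eq) P)))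

    lift-from : ∀ d →
      ((σ : SimplexOf (nerve Γ)) → ∀ n → card σ ≡ suc n → K ℕ.≤ n → n ℕ.< d ℕ.+ K →
       IsZero (homologyAt n (⋃ Γ (vertices σ)))) →
      Lift (d ℕ.+ K)
    lift-from zero    unions = lift-base
    lift-from (suc d) unions = Lift-suc
      (λ s σ∈N len → exact-from-image {⋃ Γ (σ s)} (Uni-to (σ s) id) (Uni-from (σ s) id)
        (unions record { vertices = σ s ; unique = σ-unique s ; isSimplex = σ∈N }
          (d ℕ.+ K) len (ℕ.m≤n+m K d) ℕ.≤-refl))
      (lift-from d λ σ n len K≤n n<d → unions σ n len K≤n (ℕ.m≤n⇒m≤1+n n<d))

  module _ {n : ℕ} (L : Lift n) where

    open Lift L
    private
      open SetoidReasoning ≈ᴹ-setoid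
      module HN = LeftModule (homologyAt n (nerve Γ))
      module HX = LeftModule (homologyAt n X)

      Cycleᴺ Cycleˣ : Set _
      Cycleᴺ = HN.Carrierᴹ
      Cycleˣ = HX.Carrierᴹ

      chain : Cycleᴺ → Λ
      chain z = OnNerve.embed (proj₁ z)

      chain-supp : ∀ z → Supp (Ner (allFin m) at n) (chain z)
      chain-supp z = supp-⊆ (Ner-from n) (OnNerve.embed-supp (proj₁ z))

      chain-cycle : ∀ z → ∂ (chain z) ∼ 𝟘
      chain-cycle z = ∼-trans (∼-sym (OnNerve.embed-∂ (proj₁ z)))
        (OnNerve.embed-cong (proj₂ z))

      image : ∀ z → ∃[ x ] X.embed {n} x ∼ ⟨ w ⟩ (chain z)
      image z = X.embed-surjective
        (supp-⊆ (Uni-to (allFin m) (λ {τ} → proj₁ (cover τ)) n) (⟨⟩-Uni w-supp (chain-supp z)))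

      transfer : Cycleᴺ → Cycleˣ
      transfer z = proj₁ (image z) , X.embed-injective {pred n} {CX.∂ (proj₁ (image z))} {CX.𝟘}
        (∼-trans (X.embed-∂ (proj₁ (image z)))
          (∼-trans (IsLinear.cong ∂-linear (proj₂ (image z)))
            (cycle-w {⟨ T ⟩ (chain z)} (lift (chain-supp z) (chain-cycle z)) (chain-cycle z))))

      sumᴺ : ∀ {k} → (Fin k → Cycleᴺ) → Cycleᴺ
      sumᴺ = RawMonoidDefinitions.sum HN.+ᴹ-rawMonoid

      sumˣ : ∀ {k} → (Fin k → Cycleˣ) → Cycleˣ
      sumˣ = RawMonoidDefinitions.sum HX.+ᴹ-rawMonoid

      -- Preimages in X are chosen cycle by cycle. Linearity is therefore checked after embedding,
      -- where the choice is invisible and `⟨ w ⟩` is linear.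
      transfer-sum : ∀ {k} (a : Fin k → Field.Carrier F) (z : Fin k → Cycleᴺ) →
        X.embed (proj₁ (sumˣ {k} (λ i → a i HX.*ₗ transfer (z i)))) ∼
        ⟨ w ⟩ (chain (sumᴺ {k} (λ i → a i HN.*ₗ z i)))
      transfer-sum {zero}  a z = ∼-sym (IsLinear.0-homo (⟨⟩-linear w))
      transfer-sum {suc k} a z = ∼-sym (∼-trans (IsLinear.+-homo (⟨⟩-linear w) _ _)
        (⊕-cong (∼-trans (IsLinear.*-homo (⟨⟩-linear w) _ _)
                  (·-congˡ (∼-sym (proj₂ (image (z zero))))))
                (∼-sym (transfer-sum {k} (a ∘ suc) (z ∘ suc)))))

      drop-⊖𝟘 : ∀ x → x ⊕ ⊖ 𝟘 ∼ x
      drop-⊖𝟘 x = solve (x ∷ []) (v₀ :+ :- :0) v₀ ≡.refl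

      reflects-boundary : ∀ z u → ⟨ w ⟩ (chain z) ∼ ∂ (X.embed {suc n} u) → z HN.≈ᴹ HN.0ᴹ
      reflects-boundary z u eq = proj₁ preimage ,
        OnNerve.embed-injective {n} {proj₁ z CN.⊕ CN.⊖ CN.𝟘} {CN.∂ (proj₁ preimage)} (begin
          chain z ⊕ ⊖ 𝟘                           ≈⟨ drop-⊖𝟘 (chain z) ⟩
          chain z                                 ≈⟨ ∂t ⟨
          ∂ t                                     ≈⟨ drop-⊖𝟘 (∂ t) ⟨
          ∂ t ⊕ ⊖ 𝟘                               ≈⟨ ⊕-congˡ (⊖-cong (ι-square _ y)) ⟨
          ∂ (t ⊕ ⊖ ∂ y)                           ≈⟨ IsLinear.cong ∂-linear (proj₂ preimage) ⟨
          ∂ (OnNerve.embed (proj₁ preimage))      ≈⟨ OnNerve.embed-∂ (proj₁ preimage) ⟨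
          OnNerve.embed (CN.∂ (proj₁ preimage))   ∎)
        where
        t : Λ
        t = ⟨ T ⟩ (chain z) ⊕ X.embed u

        ∂t : ∂ t ∼ chain z
        ∂t = begin
          ∂ (⟨ T ⟩ (chain z)) ⊕ ∂ (X.embed u)
            ≈⟨ ⊕-cong (lift (chain-supp z) (chain-cycle z)) (∼-sym eq) ⟩
          (chain z ⊕ ⊖ ⟨ w ⟩ (chain z)) ⊕ ⟨ w ⟩ (chain z)
            ≈⟨ solve (chain z ∷ ⟨ w ⟩ (chain z) ∷ []) ((v₀ :+ :- v₁) :+ v₁) v₀ ≡.refl ⟩
          chain z ∎

        t-supp : Supp (Cyl (allFin m) at suc n) t
        t-supp = ⟨⟩-Cyl T-supp (chain-supp z) ⊕
          Uni⇒Cyl (supp-⊆ (Uni-from (allFin m) (λ {τ} → proj₂ (cover τ)) (suc n)) (X.embed-supp u))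

        -- The boundary of `t` is a chain of the nerve, as the retraction requires, and subtracting
        -- `∂ y` does not change it.
        retracted = retraction (allFin m) t-supp
          (resp (∼-sym ∂t) (supp-⊆ (λ _ ((_ , free) , _) → free) (chain-supp z)))

        y = proj₁ retracted

        preimage : ∃[ x ] OnNerve.embed {suc n} x ∼ t ⊕ ⊖ ∂ y
        preimage = OnNerve.embed-surjective
          (supp-⊆ (Ner-to (suc n)) (proj₂ (proj₂ retracted)))

    -- A relation among the transferred classes gives a boundary in X; by `reflects-boundary` the
    -- same relation holds among the original classes.
    homology-dim≤ : homologyAt n (nerve Γ) dim≤dim homologyAt n X
    homology-dim≤ k (z , independent) = transfer ∘ z , λ a (u , sum≈∂u) →
      independent a (reflects-boundary (sumᴺ {k} (λ i → a i HN.*ₗ z i)) u (begin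
        ⟨ w ⟩ (chain (sumᴺ {k} (λ i → a i HN.*ₗ z i)))
          ≈⟨ transfer-sum {k} a z ⟨
        X.embed (proj₁ (sumˣ {k} (λ i → a i HX.*ₗ transfer (z i))))
          ≈⟨ drop-⊖𝟘 _ ⟨
        X.embed (proj₁ (sumˣ {k} (λ i → a i HX.*ₗ transfer (z i)))) ⊕ ⊖ 𝟘
          ≈⟨ X.embed-cong sum≈∂u ⟩
        X.embed (CX.∂ u)
          ≈⟨ X.embed-∂ u ⟩
        ∂ (X.embed u) ∎))

-- Integer degrees and the theorem

H̃-shift : ∀ {c ℓ v p} {F : Field c ℓ} {V : Set v} {K : SimplicialComplex V p} n →
          H̃ (+ n - 1ℤ) K F ≡ ChainComplex.homologyAt F K n
H̃-shift zero    = ≡.refl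
H̃-shift (suc n) = ≡.refl

shift : ∀ k → -1ℤ ≤ k → Σ ℕ λ n → k ≡ + n - 1ℤ
shift (+ n)          _ = suc n , ≡.refl
shift -[1+ zero ]    _ = 0 , ≡.refl
shift -[1+ suc _ ] (-≤- ())

private
  unshift : ∀ i → i - 1ℤ + 1ℤ ≡ i
  unshift = +-*-Solver.solve 1 (λ i → i :- con 1ℤ :+ con 1ℤ := i) ≡.refl
    where open +-*-Solver

  cancel-shift : ∀ {a b} → + a - 1ℤ ≤ + b - 1ℤ → a ℕ.≤ b
  cancel-shift {a} {b} le = ℤ.drop‿+≤+
    (≡.subst₂ _≤_ (unshift (+ a)) (unshift (+ b)) (ℤ.+-monoˡ-≤ 1ℤ le))

  minus-card : ∀ a r → + (a ℕ.+ r) - 1ℤ - + a ≡ + r - 1ℤ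
  minus-card a r = +-*-Solver.solve 2 (λ a r → (a :+ r) :- con 1ℤ :- a := r :- con 1ℤ)
    ≡.refl (+ a) (+ r)
    where open +-*-Solver

theorem1 : (∀ {a} → ExcludedMiddle a) →
    ∀ {c ℓᶠ v p} (𝔽 : Field c ℓᶠ) {V : Set v} (X : SimplicialComplex V p)
    {m : ℕ} (Γ : Fin m → Subcomplex X) →
    ⋃ Γ (allFin m) ≐ X →
    (k ℓ : ℤ) → -1ℤ ≤ k → k ≤ ℓ → ℓ < + m →
    ((σ : SimplexOf (nerve Γ)) → dim σ ≤ k →
    IsZero (H̃ (k - + card σ) (⋂ Γ (vertices σ)) 𝔽)) →
    ((σ : SimplexOf (nerve Γ)) → k + 1ℤ ≤ dim σ → dim σ ≤ ℓ →
    IsZero (H̃ (+ card σ - + 2) (⋃ Γ (vertices σ)) 𝔽)) →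
    H̃ ℓ (nerve Γ) 𝔽 dim≤dim H̃ ℓ X 𝔽
theorem1 em 𝔽 X {m} Γ cover k ℓ -1≤k k≤ℓ _ intersections unions
  with shift k -1≤k | shift ℓ (ℤ.≤-trans -1≤k k≤ℓ)
-- K = k + 1 and J = ℓ + 1 count vertices, and J - K is the number of steps by `Lift-suc`.
... | K , ≡.refl | J , ≡.refl
  = ≡.subst₂ _dim≤dim_ (≡.sym (H̃-shift J)) (≡.sym (H̃-shift J))
      (homology-dim≤ (≡.subst Lift (ℕ.m∸n+n≡m K≤J)
        (lift-from K intersections′ (J ℕ.∸ K) unions′)))
  where
  open Comparison em 𝔽 X Γ cover
  open Lifting em 𝔽 X Γ using (Lift)

  K≤J : K ℕ.≤ J
  K≤J = cancel-shift k≤ℓ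

  intersections′ : ∀ σ r → card σ ℕ.+ r ≡ K → IsZero (homologyAt r (⋂ Γ (vertices σ)))
  intersections′ σ r ≡.refl = ≡.subst IsZero
    (≡.trans (≡.cong (λ i → H̃ i (⋂ Γ (vertices σ)) 𝔽) (minus-card (card σ) r)) (H̃-shift r))
    (intersections σ (ℤ.+-monoˡ-≤ -1ℤ (+≤+ (ℕ.m≤m+n (card σ) r))))

  unions′ : ∀ σ n → card σ ≡ suc n → K ℕ.≤ n → n ℕ.< J ℕ.∸ K ℕ.+ K →
            IsZero (homologyAt n (⋃ Γ (vertices σ)))
  unions′ σ n len K≤n n<J = ≡.subst IsZero
    (≡.trans (≡.cong (λ k → H̃ (+ k - + 2) (⋃ Γ (vertices σ)) 𝔽) len) (shift-two n))
    (unions σ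
      (≡.subst₂ _≤_ (≡.sym (unshift (+ K))) (≡.cong (λ k → + k - 1ℤ) (≡.sym len)) (+≤+ K≤n))
      (ℤ.+-monoˡ-≤ -1ℤ (+≤+ (ℕ.≤-trans (ℕ.≤-reflexive len)
        (ℕ.≤-trans n<J (ℕ.≤-reflexive (ℕ.m∸n+n≡m K≤J)))))))
    where
    -- The case n = 0 is apart because there the degree is -1.
    shift-two : ∀ n → H̃ (+ suc n - + 2) (⋃ Γ (vertices σ)) 𝔽 ≡ homologyAt n (⋃ Γ (vertices σ))
    shift-two zero    = ≡.refl
    shift-two (suc n) = ≡.refl
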